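{- Let $t\ge 1$ be an integer, let $N=\max\{1.27\times 10^7,\ 6.5025\times 2^{2t+1}\}$, and let $n$ be an integer with $n\ge N+\frac32+3\sqrt{N-\frac74}$. Then the following graph $M_t$ is (up to isomorphism) the extremal graph for $\mathrm{spex}_{\mathcal{OP}}(n,(t+1)K_2)$, i.e. the unique $n$-vertex $(t+1)K_2$-free outerplanar graph with spectral radius equal to $\mathrm{spex}_{\mathcal{OP}}(n,(t+1)K_2)$: (i) if $t=1$, $M_t\cong K_{1,n-1}$; (ii) if $t\ge 2$, $M_t\cong K_1\vee H_{\mathcal{OP}}(2t-1,1)$.
   Context: All graphs are finite and simple. The spectral radius of a graph is the maximum modulus of the eigenvalues of its adjacency matrix. A graph is $F$-free if it does not contain $F$ as a (not necessarily induced) subgraph. $\mathrm{spex}_{\mathcal{OP}}(n,F)$ is the maximum spectral radius over all $n$-vertex $F$-free outerplanar graphs (not required to be connected). $(t+1)K_2$ is the disjoint union of $t+1$ copies of $K_2$. $G_1\vee G_2$ is the join, $\cup$ is disjoint union, $mH$ is the disjoint union of $m$ copies of $H$, and $P_k$ is the path on $k$ vertices. For positive integers $n,n_1,n_2$ with $n-1\ge n_1>n_2\ge 1$, $H_{\mathcal{OP}}(n_1,n_2)$ is the following graph on $n-1$ vertices: $$H_{\mathcal{OP}}(n_1,n_2)=\begin{cases}P_{n_1}\cup \frac{n-1-n_1}{n_2}P_{n_2}, & \text{if } n_2\mid (n-1-n_1);\\[2pt] P_{n_1}\cup\left\lfloor\frac{n-1-n_1}{n_2}\right\rfloor P_{n_2}\cup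 P_{n-1-n_1-\lfloor\frac{n-1-n_1}{n_2}\rfloor n_2}, & \text{otherwise.}\end{cases}$$ In particular $H_{\mathcal{OP}}(2t-1,1)=P_{2t-1}\cup(n-2t)K_1$. -}

module Defs where

open import Algebra.Bundles using (CommutativeMonoid)
import Algebra.Properties.CommutativeSemigroup as CommutativeSemigroupProperties
open import Data.Bool.Base using (Bool; true; false; not; _∨_; if_then_else_; T)
open import Data.Bool.Properties using (∨-comm)
open import Data.Fin.Base as Fin using (Fin; toℕ; splitAt)
import Data.Fin.Properties as Fin
open import Data.Integer.Base using (+_)
open import Data.Nat.Base as ℕ using (ℕ; zero; suc; NonZero; _∸_; _^_; _≡ᵇ_)
import Data.Nat.Properties as ℕ
open import Data.Nat.DivMod using () renaming (_/_ to _div_)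
open import Data.Nat.Divisibility using (_∣?_)
open import Data.Product.Base using (Σ; ∃; _×_; _,_; proj₁; proj₂)
open import Data.Rational.Base as ℚ using (ℚ; 0ℚ; 1ℚ; ½; _/_)
import Data.Rational.Properties as ℚ
open import Data.Sum.Base using (_⊎_; inj₁; inj₂)
open import Data.Vec.Functional using (Vector; foldr)
open import Function.Base using (_∘_)
open import Function.Bundles using (_↔_; _⇔_; module Inverse)
open import Function.Definitions using (Injective)
open import Relation.Binary.PropositionalEquality
  using (_≡_; refl; sym; trans; cong; cong₂; subst; module ≡-Reasoning)
open import Relation.Nullary using (¬_; yes; no)
open import Relation.Nullary.Decidable using (does)

------------------------------------------------------------------------
-- Real numbers as Cauchy sequences of rationals

IsCauchy : (ℕ → ℚ) → Set
IsCauchy x = ∀ (ε : ℚ) → 0ℚ ℚ.< ε →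
  Σ ℕ λ N → ∀ m n → N ℕ.≤ m → N ℕ.≤ n → ℚ.∣ x m ℚ.- x n ∣ ℚ.≤ ε

record ℝ : Set where
  constructor mkℝ
  field
    seq    : ℕ → ℚ
    cauchy : IsCauchy seq

open ℝ public

infix 4 _≃ᵣ_ _≤ᵣ_ _<ᵣ_ _#ᵣ_

_≤ᵣ_ : ℝ → ℝ → Set
x ≤ᵣ y = ∀ (ε : ℚ) → 0ℚ ℚ.< ε →
  Σ ℕ λ N → ∀ n → N ℕ.≤ n → seq x n ℚ.≤ seq y n ℚ.+ ε

_≃ᵣ_ : ℝ → ℝ → Set
x ≃ᵣ y = ∀ (ε : ℚ) → 0ℚ ℚ.< ε →
  Σ ℕ λ N → ∀ n → N ℕ.≤ n → ℚ.∣ seq x n ℚ.- seq y n ∣ ℚ.≤ ε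

_<ᵣ_ : ℝ → ℝ → Set
x <ᵣ y = Σ ℚ λ ε → 0ℚ ℚ.< ε ×
  (Σ ℕ λ N → ∀ n → N ℕ.≤ n → seq x n ℚ.+ ε ℚ.≤ seq y n)

_#ᵣ_ : ℝ → ℝ → Set
x #ᵣ y = x <ᵣ y ⊎ y <ᵣ x

fromℚ : ℚ → ℝ
fromℚ q = mkℝ (λ _ → q) λ ε 0<ε → 0 , λ _ _ _ _ →
  subst (λ d → ℚ.∣ d ∣ ℚ.≤ ε) (sym (ℚ.+-inverseʳ q)) (ℚ.<⇒≤ 0<ε)

fromℕ : ℕ → ℚ
fromℕ n = + n / 1

0ᵣ 1ᵣ : ℝ
0ᵣ = fromℚ 0ℚ
1ᵣ = fromℚ 1ℚ

private
  open CommutativeSemigroupProperties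
    (CommutativeMonoid.commutativeSemigroup ℚ.+-0-commutativeMonoid) using (interchange)

  halves : ∀ ε → ½ ℚ.* ε ℚ.+ ½ ℚ.* ε ≡ ε
  halves ε = trans (sym (ℚ.*-distribʳ-+ ε ½ ½)) (ℚ.*-identityˡ ε)

  half-pos : ∀ {ε} → 0ℚ ℚ.< ε → 0ℚ ℚ.< ½ ℚ.* ε
  half-pos {ε} 0<ε = subst (ℚ._< ½ ℚ.* ε) (ℚ.*-zeroʳ ½) (ℚ.*-monoʳ-<-pos ½ 0<ε)

  +-diff : ∀ a b c d → (a ℚ.+ b) ℚ.- (c ℚ.+ d) ≡ (a ℚ.- c) ℚ.+ (b ℚ.- d)
  +-diff a b c d = trans (cong (a ℚ.+ b ℚ.+_) (ℚ.neg-distrib-+ c d))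
                         (interchange a b (ℚ.- c) (ℚ.- d))

  neg-diff : ∀ a b → (ℚ.- a) ℚ.- (ℚ.- b) ≡ ℚ.- (a ℚ.- b)
  neg-diff a b = sym (ℚ.neg-distrib-+ a (ℚ.- b))

  telescope : ∀ a b c → (a ℚ.- b) ℚ.+ (b ℚ.- c) ≡ a ℚ.- c
  telescope a b c = begin
      (a ℚ.- b) ℚ.+ (b ℚ.- c)              ≡⟨ ℚ.+-assoc a (ℚ.- b) (b ℚ.- c) ⟩
      a ℚ.+ (ℚ.- b ℚ.+ (b ℚ.- c))          ≡⟨ cong (a ℚ.+_) (ℚ.+-assoc (ℚ.- b) b (ℚ.- c)) ⟨
      a ℚ.+ ((ℚ.- b ℚ.+ b) ℚ.- c)          ≡⟨ cong (λ e → a ℚ.+ (e ℚ.- c)) (ℚ.+-inverseˡ b) ⟩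
      a ℚ.+ (0ℚ ℚ.- c)                     ≡⟨ cong (a ℚ.+_) (ℚ.+-identityˡ (ℚ.- c)) ⟩
      a ℚ.- c                              ∎
    where open ≡-Reasoning

  *-distribˡ-- : ∀ a b c → a ℚ.* (b ℚ.- c) ≡ a ℚ.* b ℚ.- a ℚ.* c
  *-distribˡ-- a b c = trans (ℚ.*-distribˡ-+ a b (ℚ.- c))
                             (cong (a ℚ.* b ℚ.+_) (sym (ℚ.neg-distribʳ-* a c)))

  *-diff : ∀ a b c d → (a ℚ.* b) ℚ.- (c ℚ.* d) ≡ a ℚ.* (b ℚ.- d) ℚ.+ d ℚ.* (a ℚ.- c)
  *-diff a b c d = begin
      a ℚ.* b ℚ.- c ℚ.* d
        ≡⟨ telescope (a ℚ.* b) (a ℚ.* d) (c ℚ.* d) ⟨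
      (a ℚ.* b ℚ.- a ℚ.* d) ℚ.+ (a ℚ.* d ℚ.- c ℚ.* d)
        ≡⟨ cong ((a ℚ.* b ℚ.- a ℚ.* d) ℚ.+_)
                (cong₂ (λ p q → p ℚ.- q) (ℚ.*-comm a d) (ℚ.*-comm c d)) ⟩
      (a ℚ.* b ℚ.- a ℚ.* d) ℚ.+ (d ℚ.* a ℚ.- d ℚ.* c)
        ≡⟨ cong₂ ℚ._+_ (*-distribˡ-- a b d) (*-distribˡ-- d a c) ⟨
      a ℚ.* (b ℚ.- d) ℚ.+ d ℚ.* (a ℚ.- c) ∎
    where open ≡-Reasoning

  re-add : ∀ a b → a ≡ b ℚ.+ (a ℚ.- b)
  re-add a b = sym (begin
      b ℚ.+ (a ℚ.- b)      ≡⟨ cong (b ℚ.+_) (ℚ.+-comm a (ℚ.- b)) ⟩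
      b ℚ.+ (ℚ.- b ℚ.+ a)  ≡⟨ ℚ.+-assoc b (ℚ.- b) a ⟨
      (b ℚ.- b) ℚ.+ a      ≡⟨ cong (ℚ._+ a) (ℚ.+-inverseʳ b) ⟩
      0ℚ ℚ.+ a             ≡⟨ ℚ.+-identityˡ a ⟩
      a                    ∎)
    where open ≡-Reasoning

  0<1 : 0ℚ ℚ.< 1ℚ
  0<1 = ℚ.positive⁻¹ 1ℚ

  *-cauchy-bound : ∀ a d B δ → ℚ.∣ a ∣ ℚ.≤ B → ℚ.∣ d ∣ ℚ.≤ δ → ℚ.∣ a ℚ.* d ∣ ℚ.≤ B ℚ.* δ
  *-cauchy-bound a d B δ a≤B d≤δ = begin
      ℚ.∣ a ℚ.* d ∣           ≡⟨ ℚ.∣p*q∣≡∣p∣*∣q∣ a d ⟩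
      ℚ.∣ a ∣ ℚ.* ℚ.∣ d ∣     ≤⟨ ℚ.*-monoʳ-≤-nonNeg ℚ.∣ d ∣ {{ℚ.∣-∣-nonNeg d}} a≤B ⟩
      B ℚ.* ℚ.∣ d ∣           ≤⟨ ℚ.*-monoˡ-≤-nonNeg B {{ℚ.nonNegative 0≤B}} d≤δ ⟩
      B ℚ.* δ                 ∎
    where
    open ℚ.≤-Reasoning
    0≤B : 0ℚ ℚ.≤ B
    0≤B = ℚ.≤-trans (ℚ.0≤∣p∣ a) a≤B

  bounded : ∀ x → IsCauchy x →
    Σ ℚ λ B → 0ℚ ℚ.< B × (Σ ℕ λ N → ∀ n → N ℕ.≤ n → ℚ.∣ x n ∣ ℚ.≤ B)
  bounded x c with c 1ℚ 0<1
  ... | N , h = ℚ.∣ x N ∣ ℚ.+ 1ℚ , ℚ.+-mono-≤-< (ℚ.0≤∣p∣ (x N)) 0<1 , N , λ n N≤n → begin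
      ℚ.∣ x n ∣                            ≡⟨ cong ℚ.∣_∣ (re-add (x n) (x N)) ⟩
      ℚ.∣ x N ℚ.+ (x n ℚ.- x N) ∣          ≤⟨ ℚ.∣p+q∣≤∣p∣+∣q∣ (x N) (x n ℚ.- x N) ⟩
      ℚ.∣ x N ∣ ℚ.+ ℚ.∣ x n ℚ.- x N ∣      ≤⟨ ℚ.+-monoʳ-≤ ℚ.∣ x N ∣ (h n N N≤n ℕ.≤-refl) ⟩
      ℚ.∣ x N ∣ ℚ.+ 1ℚ                     ∎
    where open ℚ.≤-Reasoning

  abstract
    +-cauchy : ∀ x y → IsCauchy x → IsCauchy y → IsCauchy (λ n → x n ℚ.+ y n)
    +-cauchy x y cx cy ε 0<ε
      with cx (½ ℚ.* ε) (half-pos 0<ε) | cy (½ ℚ.* ε) (half-pos 0<ε)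
    ... | M , hx | N , hy = M ℕ.⊔ N , λ m n ≤m ≤n → begin
        ℚ.∣ (x m ℚ.+ y m) ℚ.- (x n ℚ.+ y n) ∣
          ≡⟨ cong ℚ.∣_∣ (+-diff (x m) (y m) (x n) (y n)) ⟩
        ℚ.∣ (x m ℚ.- x n) ℚ.+ (y m ℚ.- y n) ∣
          ≤⟨ ℚ.∣p+q∣≤∣p∣+∣q∣ (x m ℚ.- x n) (y m ℚ.- y n) ⟩
        ℚ.∣ x m ℚ.- x n ∣ ℚ.+ ℚ.∣ y m ℚ.- y n ∣
          ≤⟨ ℚ.+-mono-≤
               (hx m n (ℕ.m⊔n≤o⇒m≤o M N ≤m) (ℕ.m⊔n≤o⇒m≤o M N ≤n))
               (hy m n (ℕ.m⊔n≤o⇒n≤o M N ≤m) (ℕ.m⊔n≤o⇒n≤o M N ≤n)) ⟩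
        ½ ℚ.* ε ℚ.+ ½ ℚ.* ε
          ≡⟨ halves ε ⟩
        ε ∎
      where open ℚ.≤-Reasoning

    neg-cauchy : ∀ x → IsCauchy x → IsCauchy (λ n → ℚ.- x n)
    neg-cauchy x cx ε 0<ε with cx ε 0<ε
    ... | N , h = N , λ m n ≤m ≤n → subst (ℚ._≤ ε)
      (sym (trans (cong ℚ.∣_∣ (neg-diff (x m) (x n))) (ℚ.∣-p∣≡∣p∣ (x m ℚ.- x n))))
      (h m n ≤m ≤n)

    *-cauchy : ∀ x y → IsCauchy x → IsCauchy y → IsCauchy (λ n → x n ℚ.* y n)
    *-cauchy x y cx cy ε 0<ε with bounded x cx | bounded y cy
    ... | A , 0<A , Nx , bx | B , 0<B , Ny , by = N , λ m n ≤m ≤n → begin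
        ℚ.∣ (x m ℚ.* y m) ℚ.- (x n ℚ.* y n) ∣
          ≡⟨ cong ℚ.∣_∣ (*-diff (x m) (y m) (x n) (y n)) ⟩
        ℚ.∣ x m ℚ.* (y m ℚ.- y n) ℚ.+ y n ℚ.* (x m ℚ.- x n) ∣
          ≤⟨ ℚ.∣p+q∣≤∣p∣+∣q∣ (x m ℚ.* (y m ℚ.- y n)) (y n ℚ.* (x m ℚ.- x n)) ⟩
        ℚ.∣ x m ℚ.* (y m ℚ.- y n) ∣ ℚ.+ ℚ.∣ y n ℚ.* (x m ℚ.- x n) ∣
          ≤⟨ ℚ.+-mono-≤
               (*-cauchy-bound (x m) (y m ℚ.- y n) A δ (bx m (Nx≤ ≤m))
                 (proj₂ (cy δ 0<δ) m n (My≤ ≤m) (My≤ ≤n)))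
               (*-cauchy-bound (y n) (x m ℚ.- x n) B δ (by n (Ny≤ ≤n))
                 (proj₂ (cx δ 0<δ) m n (Mx≤ ≤m) (Mx≤ ≤n))) ⟩
        A ℚ.* δ ℚ.+ B ℚ.* δ
          ≡⟨ sym (ℚ.*-distribʳ-+ δ A B) ⟩
        S ℚ.* (i ℚ.* ε)
          ≡⟨ sym (ℚ.*-assoc S i ε) ⟩
        (S ℚ.* i) ℚ.* ε
          ≡⟨ cong (ℚ._* ε) (ℚ.*-inverseʳ S {{ℚ.pos⇒nonZero S {{posS}}}}) ⟩
        1ℚ ℚ.* ε
          ≡⟨ ℚ.*-identityˡ ε ⟩
        ε ∎
      where
      open ℚ.≤-Reasoning
      S : ℚ
      S = A ℚ.+ B
      posS : ℚ.Positive S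
      posS = ℚ.positive (ℚ.+-mono-< 0<A 0<B)
      i : ℚ
      i = ℚ.1/_ S {{ℚ.pos⇒nonZero S {{posS}}}}
      δ : ℚ
      δ = i ℚ.* ε
      0<δ : 0ℚ ℚ.< δ
      0<δ = ℚ.positive⁻¹ δ
        {{ℚ.pos*pos⇒pos i {{ℚ.1/pos⇒pos S {{posS}}}} ε {{ℚ.positive 0<ε}}}}
      Mx My N : ℕ
      Mx = proj₁ (cx δ 0<δ)
      My = proj₁ (cy δ 0<δ)
      N = (Nx ℕ.⊔ Ny) ℕ.⊔ (Mx ℕ.⊔ My)
      Nx≤ : ∀ {m} → N ℕ.≤ m → Nx ℕ.≤ m
      Nx≤ = ℕ.m⊔n≤o⇒m≤o Nx Ny ∘ ℕ.m⊔n≤o⇒m≤o (Nx ℕ.⊔ Ny) (Mx ℕ.⊔ My)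
      Ny≤ : ∀ {m} → N ℕ.≤ m → Ny ℕ.≤ m
      Ny≤ = ℕ.m⊔n≤o⇒n≤o Nx Ny ∘ ℕ.m⊔n≤o⇒m≤o (Nx ℕ.⊔ Ny) (Mx ℕ.⊔ My)
      Mx≤ : ∀ {m} → N ℕ.≤ m → Mx ℕ.≤ m
      Mx≤ = ℕ.m⊔n≤o⇒m≤o Mx My ∘ ℕ.m⊔n≤o⇒n≤o (Nx ℕ.⊔ Ny) (Mx ℕ.⊔ My)
      My≤ : ∀ {m} → N ℕ.≤ m → My ℕ.≤ m
      My≤ = ℕ.m⊔n≤o⇒n≤o Mx My ∘ ℕ.m⊔n≤o⇒n≤o (Nx ℕ.⊔ Ny) (Mx ℕ.⊔ My)

infixl 6 _+ᵣ_ _-ᵣ_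
infixl 7 _*ᵣ_
infix  8 -ᵣ_

_+ᵣ_ : ℝ → ℝ → ℝ
x +ᵣ y = mkℝ (λ n → seq x n ℚ.+ seq y n) (+-cauchy (seq x) (seq y) (cauchy x) (cauchy y))

-ᵣ_ : ℝ → ℝ
-ᵣ x = mkℝ (λ n → ℚ.- seq x n) (neg-cauchy (seq x) (cauchy x))

_-ᵣ_ : ℝ → ℝ → ℝ
x -ᵣ y = x +ᵣ (-ᵣ y)

_*ᵣ_ : ℝ → ℝ → ℝ
x *ᵣ y = mkℝ (λ n → seq x n ℚ.* seq y n) (*-cauchy (seq x) (seq y) (cauchy x) (cauchy y))

IsSqrt : ℝ → ℝ → Set
IsSqrt s x = 0ᵣ ≤ᵣ s × s *ᵣ s ≃ᵣ x

------------------------------------------------------------------------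
-- Complex numbers

record ℂ : Set where
  constructor _+i_
  field
    re : ℝ
    im : ℝ

open ℂ public

infix  4 _≃ᶜ_
infixl 6 _+ᶜ_
infixl 7 _*ᶜ_

_≃ᶜ_ : ℂ → ℂ → Set
z ≃ᶜ w = re z ≃ᵣ re w × im z ≃ᵣ im w

0ᶜ 1ᶜ : ℂ
0ᶜ = 0ᵣ +i 0ᵣ
1ᶜ = 1ᵣ +i 0ᵣ

_+ᶜ_ : ℂ → ℂ → ℂ
z +ᶜ w = (re z +ᵣ re w) +i (im z +ᵣ im w)

_*ᶜ_ : ℂ → ℂ → ℂ
z *ᶜ w = (re z *ᵣ re w -ᵣ im z *ᵣ im w) +i (re z *ᵣ im w +ᵣ im z *ᵣ re w)

-- Apartness from zero, the constructive form of z ≠ 0.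
NonZeroᶜ : ℂ → Set
NonZeroᶜ z = re z #ᵣ 0ᵣ ⊎ im z #ᵣ 0ᵣ

IsModulus : ℝ → ℂ → Set
IsModulus r z = IsSqrt r (re z *ᵣ re z +ᵣ im z *ᵣ im z)

------------------------------------------------------------------------
-- Eigenvalues

Matrix : ℕ → Set
Matrix n = Fin n → Fin n → ℂ

sumᶜ : ∀ {n} → Vector ℂ n → ℂ
sumᶜ = foldr _+ᶜ_ 0ᶜ

_·_ : ∀ {n} → Matrix n → Vector ℂ n → Vector ℂ n
(A · v) i = sumᶜ (λ j → A i j *ᶜ v j)

IsEigenvalue : ∀ {n} → Matrix n → ℂ → Set
IsEigenvalue {n} A μ = Σ (Vector ℂ n) λ v →
  (∃ λ i → NonZeroᶜ (v i)) × (∀ i → (A · v) i ≃ᶜ μ *ᶜ v i)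

------------------------------------------------------------------------
-- Finite simple graphs

record Graph : Set where
  field
    order      : ℕ
    adj        : Fin order → Fin order → Bool
    adj-sym    : ∀ u v → adj u v ≡ adj v u
    adj-irrefl : ∀ v → adj v v ≡ false

  Vertex : Set
  Vertex = Fin order

  Adj : Vertex → Vertex → Set
  Adj u v = T (adj u v)

open Graph public

infix 4 _≅_

_≅_ : Graph → Graph → Set
G ≅ H = Σ (Vertex G ↔ Vertex H) λ f →
  ∀ u v → adj G u v ≡ adj H (Inverse.to f u) (Inverse.to f v)

-- G contains F as a (not necessarily induced) subgraph.
Contains : Graph → Graph → Set
Contains G F = Σ (Vertex F → Vertex G) λ f →
  Injective _≡_ _≡_ f × (∀ u v → Adj F u v → Adj G (f u) (f v))

Free : Graph → Graph → Set
Free F G = ¬ Contains G F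

-- An outerplanar drawing: the vertices lie on a circle and the edges are drawn
-- without crossings inside the disc it bounds.  Cutting the circle at a point
-- turns the placement of the vertices into an injection to ℕ; two edges can be
-- drawn in the disc without crossing unless their ends alternate on the circle.
Outerplanar : Graph → Set
Outerplanar G = Σ (Vertex G → ℕ) λ pos →
  Injective _≡_ _≡_ pos ×
  (∀ a b c d → Adj G a b → Adj G c d →
     ¬ (pos a ℕ.< pos c × pos c ℕ.< pos b × pos b ℕ.< pos d))

adjacencyMatrix : (G : Graph) → Matrix (order G)
adjacencyMatrix G u v = if adj G u v then 1ᶜ else 0ᶜ

IsSpectralRadius : Graph → ℝ → Set
IsSpectralRadius G ρ =
  (Σ ℂ λ μ → IsEigenvalue (adjacencyMatrix G) μ × IsModulus ρ μ) ×
  (∀ μ r → IsEigenvalue (adjacencyMatrix G) μ → IsModulus r μ → r ≤ᵣ ρ)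

OuterplanarFree : ℕ → Graph → Graph → Set
OuterplanarFree n F G = order G ≡ n × Outerplanar G × Free F G

IsSpexOP : ℕ → Graph → ℝ → Set
IsSpexOP n F ρ =
  (Σ Graph λ G → OuterplanarFree n F G × IsSpectralRadius G ρ) ×
  (∀ G r → OuterplanarFree n F G → IsSpectralRadius G r → r ≤ᵣ ρ)

-- The maximum spex_OP(n, F) exists, and the graphs attaining it are exactly
-- those isomorphic to M.
IsUniqueExtremalOP : ℕ → Graph → Graph → Set
IsUniqueExtremalOP n F M = Σ ℝ λ ρ → IsSpexOP n F ρ ×
  (∀ G → (OuterplanarFree n F G × IsSpectralRadius G ρ) ⇔ G ≅ M)

------------------------------------------------------------------------
-- Graph constructions

edgeless : ℕ → Graph
edgeless n = record
  { order      = n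
  ; adj        = λ _ _ → false
  ; adj-sym    = λ _ _ → refl
  ; adj-irrefl = λ _ → refl
  }

private
  ≟-sym : ∀ {n} (u v : Fin n) → not (does (u Fin.≟ v)) ≡ not (does (v Fin.≟ u))
  ≟-sym u v with u Fin.≟ v | v Fin.≟ u
  ... | yes _   | yes _   = refl
  ... | no _    | no _    = refl
  ... | yes u≡v | no v≢u  with () ← v≢u (sym u≡v)
  ... | no u≢v  | yes v≡u with () ← u≢v (sym v≡u)

  ≟-irrefl : ∀ {n} (v : Fin n) → not (does (v Fin.≟ v)) ≡ false
  ≟-irrefl v with v Fin.≟ v
  ... | yes _   = refl
  ... | no v≢v with () ← v≢v refl

  suc≢ᵇ : ∀ n → (suc n ≡ᵇ n) ≡ false
  suc≢ᵇ zero    = refl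
  suc≢ᵇ (suc n) = suc≢ᵇ n

K : ℕ → Graph
K n = record
  { order      = n
  ; adj        = λ u v → not (does (u Fin.≟ v))
  ; adj-sym    = ≟-sym
  ; adj-irrefl = ≟-irrefl
  }

P : ℕ → Graph
P n = record
  { order      = n
  ; adj        = λ u v → (suc (toℕ u) ≡ᵇ toℕ v) ∨ (suc (toℕ v) ≡ᵇ toℕ u)
  ; adj-sym    = λ u v → ∨-comm (suc (toℕ u) ≡ᵇ toℕ v) (suc (toℕ v) ≡ᵇ toℕ u)
  ; adj-irrefl = λ v → cong₂ _∨_ (suc≢ᵇ (toℕ v)) (suc≢ᵇ (toℕ v))
  }

-- Disjoint union with cross edges: all of them if the flag is true, none if it
-- is false.
glue : Bool → Graph → Graph → Graph
glue cross G H = record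
  { order      = order G ℕ.+ order H
  ; adj        = λ u v → adj⊎ (splitAt (order G) u) (splitAt (order G) v)
  ; adj-sym    = λ u v → adj⊎-sym (splitAt (order G) u) (splitAt (order G) v)
  ; adj-irrefl = λ v → adj⊎-irrefl (splitAt (order G) v)
  }
  where
  adj⊎ : Vertex G ⊎ Vertex H → Vertex G ⊎ Vertex H → Bool
  adj⊎ (inj₁ u) (inj₁ v) = adj G u v
  adj⊎ (inj₁ _) (inj₂ _) = cross
  adj⊎ (inj₂ _) (inj₁ _) = cross
  adj⊎ (inj₂ u) (inj₂ v) = adj H u v

  adj⊎-sym : ∀ u v → adj⊎ u v ≡ adj⊎ v u
  adj⊎-sym (inj₁ u) (inj₁ v) = adj-sym G u v
  adj⊎-sym (inj₁ _) (inj₂ _) = refl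
  adj⊎-sym (inj₂ _) (inj₁ _) = refl
  adj⊎-sym (inj₂ u) (inj₂ v) = adj-sym H u v

  adj⊎-irrefl : ∀ v → adj⊎ v v ≡ false
  adj⊎-irrefl (inj₁ v) = adj-irrefl G v
  adj⊎-irrefl (inj₂ v) = adj-irrefl H v

infixr 6 _∪ᴳ_ _∨ᴳ_
infix  7 _×ᴳ_

_∪ᴳ_ : Graph → Graph → Graph
_∪ᴳ_ = glue false

_∨ᴳ_ : Graph → Graph → Graph
_∨ᴳ_ = glue true

_×ᴳ_ : ℕ → Graph → Graph
zero  ×ᴳ G = edgeless 0
suc m ×ᴳ G = G ∪ᴳ m ×ᴳ G

K[_,_] : ℕ → ℕ → Graph
K[ a , b ] = edgeless a ∨ᴳ edgeless b

-- Meaningful for n ∸ 1 ≥ n₁ > n₂ ≥ 1, where the subtractions do not truncate.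
H-OP : (n n₁ n₂ : ℕ) .{{_ : NonZero n₂}} → Graph
H-OP n n₁ n₂ =
  if does (n₂ ∣? r)
  then P n₁ ∪ᴳ (r div n₂) ×ᴳ P n₂
  else P n₁ ∪ᴳ (r div n₂) ×ᴳ P n₂ ∪ᴳ P (r ∸ (r div n₂) ℕ.* n₂)
  where
  r : ℕ
  r = n ∸ 1 ∸ n₁

------------------------------------------------------------------------

N : ℕ → ℚ
N t = fromℕ (127 ℕ.* 10 ^ 5) ℚ.⊔ (+ 65025 / 10000) ℚ.* fromℕ (2 ^ (2 ℕ.* t ℕ.+ 1))

{-# OPTIONS --safe #-}
-- An eigenvector v of G for an eigenvalue of modulus r yields x = |v| with A x ≥ r x.
-- If no vertex of G has degree n − 1, a vertex cover of size 2t and the absence of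
-- K_{2,3} force x to concentrate at a single vertex, and A² x ≥ r² x then gives
-- r² < n − 1.  Otherwise G is a hub joined to a linear forest with degrees d, and
-- expanding A x ≥ r x at the hub gives r⁴ ≤ (n − 1) r² + W₁ r + W₂ + O(t / r), where
-- W₁ = ∑ d and W₂ = ∑ d², whereas the radius ρ of the extremal graph satisfies
-- ρ⁴ ≥ (n − 1) ρ² + W₁ ρ + W₂.  Having no t + 1 disjoint edges bounds the forest by
-- 2 (t − 1) edges, and among the forests with that many edges W₂ is maximal only for
-- a single path.  The number ρ and its eigenvector are the limits of a contracting
-- rational iteration, and all estimates are made on rational approximations.
module Submission where

open import Defs hiding (N; P; K)
open import Data.Bool.Base using (Bool; true; false; T; _∧_; _∨_; if_then_else_)
open import Data.Empty using (⊥; ⊥-elim)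
open import Data.Fin.Base as Fin using (Fin; zero; suc; toℕ; fromℕ<; punchIn; splitAt)
open import Data.Fin.Permutation as Perm using (Permutation; _⟨$⟩ʳ_; _⟨$⟩ˡ_)
import Data.Fin.Properties as Fin
open import Data.Integer.Base as ℤ using (ℤ)
open import Data.Nat.Base as ℕ using (ℕ; zero; suc; z≤n; s≤s)
import Data.Nat.Properties as ℕ
open import Data.Product.Base using (Σ; ∃; _×_; _,_; proj₁; proj₂)
open import Data.Sum.Base using (_⊎_; inj₁; inj₂)
open import Data.Unit.Base using (tt)
open import Function.Base using (_∘_; id)
open import Function.Bundles using (mk↔ₛ′; mk⇔; module Inverse)
open import Function.Definitions using (Injective)
open import Relation.Binary.Definitions using (tri<; tri≈; tri>)
open import Relation.Binary.PropositionalEquality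
open import Relation.Nullary using (¬_; Dec; yes; no; does; ¬?; contradiction; _×-dec_; _⊎-dec_; T?)
open import Relation.Nullary.Decidable using (dec-true)

-- The order of the Cauchy reals is undecidable, and a strict inequality carries a rational margin.
-- Each comparison is therefore uniform: for one fixed `ε`, every rational `q` admitting a
-- normalised vector with `A x + ε ≥ q x` stays a fixed `δ` below the late approximations of ρ.
-- Maximality and uniqueness both come from one alternative, isomorphic to the extremal graph or
-- strictly below ρ, which is decided on the finite graph and never by comparing reals. Stopping the
-- expansion at W₂ is enough because W₁ and W₂ are even: a forest other than a single path with 2 (t
-- - 1) edges loses at least 2 from W₁ r + W₂, while all longer walks add at most 8 W₂ / r ≤ 1, as
-- W₂ ≤ 8 t and r ≥ 28 (t + 1)² in the range that matters. A graph without a hub only has to fall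
-- below √(n - 1), which bounds ρ from below because the extremal graph contains a spanning star.
-- There a single edge missing at the top vertex has to outweigh everything gained elsewhere, and
-- this is what fixes the constant 28.

-- Rational arithmetic and finite sums

module RationalSums where

  import Algebra.Properties.Semiring.Sum as SemiringSum
  open import Algebra.Bundles using (CommutativeRing)
  open import Data.Integer.Base using (+≤+; +<+)
  import Data.Integer.Properties as ℤ
  open import Data.Rational.Base hiding (_≃_)
  open import Data.Rational.Properties
  import Data.Rational.Solver as RationalSolver
  import Data.Rational.Unnormalised.Base as ℚᵘ
  import Data.Rational.Unnormalised.Properties as ℚᵘ

  open RationalSolver.+-*-Solver public
    using (Polynomial; solve; _:+_; _:*_; _:-_; :-_; _:=_; con)
  open SemiringSum (CommutativeRing.semiring +-*-commutativeRing)
    using (sum; sum-cong-≗; ∑-distrib-+; ∑-comm; sum-permute; *-distribˡ-sum; *-distribʳ-sum; sum-replicate-zero)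

  #_ : ∀ {n} → ℕ → Polynomial n
  # k = con (fromℕ k)

  infixl 6 _⊕_
  infixl 7 _⊗_

  _⊕_ : ∀ {p q} → 0ℚ ≤ p → 0ℚ ≤ q → 0ℚ ≤ p + q
  _⊕_ = +-mono-≤ {0ℚ}

  _⊗_ : ∀ {p q} → 0ℚ ≤ p → 0ℚ ≤ q → 0ℚ ≤ p * q
  _⊗_ {p} {q} 0≤p 0≤q =
    nonNegative⁻¹ (p * q) {{nonNeg*nonNeg⇒nonNeg p {{nonNegative 0≤p}} q {{nonNegative 0≤q}}}}

  *-pos : ∀ {p q} → 0ℚ < p → 0ℚ < q → 0ℚ < p * q
  *-pos {p} {q} 0<p 0<q = positive⁻¹ (p * q) {{pos*pos⇒pos p {{positive 0<p}} q {{positive 0<q}}}}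

  ≤⇒0≤- : ∀ {p q} → p ≤ q → 0ℚ ≤ q - p
  ≤⇒0≤- {p} {q} p≤q = subst (_≤ q - p) (+-inverseʳ p) (+-monoˡ-≤ (- p) p≤q)

  <⇒0<- : ∀ {p q} → p < q → 0ℚ < q - p
  <⇒0<- {p} {q} p<q = subst (_< q - p) (+-inverseʳ p) (+-monoˡ-< (- p) p<q)

  ≤-by : ∀ {p q d} → q ≡ p + d → 0ℚ ≤ d → p ≤ q
  ≤-by {p} {q} refl 0≤d = subst (_≤ q) (+-identityʳ p) (+-monoʳ-≤ p 0≤d)

  <-by : ∀ {p q d} → q ≡ p + d → 0ℚ < d → p < q
  <-by {p} {q} refl 0<d = subst (_< q) (+-identityʳ p) (+-monoʳ-< p 0<d)

  *-monoˡ : ∀ {r p q} → 0ℚ ≤ r → p ≤ q → r * p ≤ r * q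
  *-monoˡ {r} 0≤r = *-monoˡ-≤-nonNeg r {{nonNegative 0≤r}}

  *-monoʳ : ∀ {r p q} → 0ℚ ≤ r → p ≤ q → p * r ≤ q * r
  *-monoʳ {r} 0≤r = *-monoʳ-≤-nonNeg r {{nonNegative 0≤r}}

  *-mono : ∀ {p q r s} → 0ℚ ≤ q → 0ℚ ≤ r → p ≤ q → r ≤ s → p * r ≤ q * s
  *-mono 0≤q 0≤r p≤q r≤s = ≤-trans (*-monoʳ 0≤r p≤q) (*-monoˡ 0≤q r≤s)

  *-cancelˡ : ∀ {r p q} → 0ℚ < r → r * p ≤ r * q → p ≤ q
  *-cancelˡ {r} 0<r = *-cancelˡ-≤-pos r {{positive 0<r}}

  0≤square : ∀ p → 0ℚ ≤ p * p
  0≤square p with ≤-total 0ℚ p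
  ... | inj₁ 0≤p = 0≤p ⊗ 0≤p
  ... | inj₂ p≤0 = subst (0ℚ ≤_) (solve 1 (λ p → :- p :* :- p := p :* p) refl p)
                     (neg-antimono-≤ p≤0 ⊗ neg-antimono-≤ p≤0)

  square-cancel-≤ : ∀ {p q} → 0ℚ ≤ q → p * p ≤ q * q → p ≤ q
  square-cancel-≤ {p} {q} 0≤q p²≤q² = ≮⇒≥ λ q<p → <-irrefl refl (<-≤-trans
    (<-by (solve 2 (λ p q → p :* p := q :* q :+ ((p :- q) :* (p :- q) :+ (# 2 :* q) :* (p :- q))) refl p q)
          (+-mono-<-≤ (*-pos (<⇒0<- q<p) (<⇒0<- q<p))
                      (((nonNegative⁻¹ (fromℕ 2)) ⊗ 0≤q) ⊗ <⇒≤ (<⇒0<- q<p))))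
    p²≤q²)

  ∣-∣-≤ : ∀ {p q} → p ≤ q → - p ≤ q → ∣ p ∣ ≤ q
  ∣-∣-≤ {p} p≤q -p≤q with ∣p∣≡p∨∣p∣≡-p p
  ... | inj₁ eq = subst (_≤ _) (sym eq) p≤q
  ... | inj₂ eq = subst (_≤ _) (sym eq) -p≤q

  p≤∣p∣ : ∀ p → p ≤ ∣ p ∣
  p≤∣p∣ p with ≤-total 0ℚ p
  ... | inj₁ 0≤p = ≤-reflexive (sym (0≤p⇒∣p∣≡p 0≤p))
  ... | inj₂ p≤0 = ≤-trans p≤0 (0≤∣p∣ p)

  -p≤∣p∣ : ∀ p → - p ≤ ∣ p ∣
  -p≤∣p∣ p = subst (- p ≤_) (∣-p∣≡∣p∣ p) (p≤∣p∣ (- p))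

  private
    -- `fromℕ n` is normalised by a gcd and does not compute for a variable `n`, so its arithmetic
    -- is transferred from unnormalised fractions.
    toℚᵘ-fromℕ : ∀ n → toℚᵘ (fromℕ n) ℚᵘ.≃ ℚᵘ.mkℚᵘ (ℤ.+ n) 0
    toℚᵘ-fromℕ n = toℚᵘ-fromℚᵘ (ℚᵘ.mkℚᵘ (ℤ.+ n) 0)

  fromℕ-+ : ∀ m n → fromℕ (m ℕ.+ n) ≡ fromℕ m + fromℕ n
  fromℕ-+ m n = toℚᵘ-injective (ℚᵘ.≃-trans (toℚᵘ-fromℕ (m ℕ.+ n)) (ℚᵘ.≃-trans
    (ℚᵘ.*≡* (cong (ℤ._* ℤ.+ 1) (sym (cong₂ ℤ._+_ (ℤ.*-identityʳ (ℤ.+ m)) (ℤ.*-identityʳ (ℤ.+ n))))))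
    (ℚᵘ.≃-sym (ℚᵘ.≃-trans (toℚᵘ-homo-+ (fromℕ m) (fromℕ n))
                          (ℚᵘ.+-cong (toℚᵘ-fromℕ m) (toℚᵘ-fromℕ n))))))

  fromℕ-* : ∀ m n → fromℕ (m ℕ.* n) ≡ fromℕ m * fromℕ n
  fromℕ-* m n = toℚᵘ-injective (ℚᵘ.≃-trans (toℚᵘ-fromℕ (m ℕ.* n)) (ℚᵘ.≃-trans
    (ℚᵘ.*≡* (cong (ℤ._* ℤ.+ 1) (ℤ.pos-* m n)))
    (ℚᵘ.≃-sym (ℚᵘ.≃-trans (toℚᵘ-homo-* (fromℕ m) (fromℕ n))
                          (ℚᵘ.*-cong (toℚᵘ-fromℕ m) (toℚᵘ-fromℕ n))))))

  fromℕ-mono-≤ : ∀ {m n} → m ℕ.≤ n → fromℕ m ≤ fromℕ n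
  fromℕ-mono-≤ {m} {n} m≤n = toℚᵘ-cancel-≤
    (ℚᵘ.≤-respˡ-≃ (ℚᵘ.≃-sym (toℚᵘ-fromℕ m)) (ℚᵘ.≤-respʳ-≃ (ℚᵘ.≃-sym (toℚᵘ-fromℕ n))
      (ℚᵘ.*≤* (ℤ.*-monoʳ-≤-nonNeg (ℤ.+ 1) (+≤+ m≤n)))))

  fromℕ-mono-< : ∀ {m n} → m ℕ.< n → fromℕ m < fromℕ n
  fromℕ-mono-< {m} {n} m<n = toℚᵘ-cancel-<
    (ℚᵘ.<-respˡ-≃ (ℚᵘ.≃-sym (toℚᵘ-fromℕ m)) (ℚᵘ.<-respʳ-≃ (ℚᵘ.≃-sym (toℚᵘ-fromℕ n))
      (ℚᵘ.*<* (ℤ.*-monoʳ-<-pos (ℤ.+ 1) (+<+ m<n)))))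

  fromℕ-cancel-≤ : ∀ {m n} → fromℕ m ≤ fromℕ n → m ℕ.≤ n
  fromℕ-cancel-≤ {m} {n} m≤n = ℕ.≮⇒≥ λ n<m →
    <-irrefl refl (<-≤-trans (fromℕ-mono-< {n} {m} n<m) m≤n)

  0≤fromℕ : ∀ n → 0ℚ ≤ fromℕ n
  0≤fromℕ n = fromℕ-mono-≤ {0} {n} ℕ.z≤n

  -- Opaque, so that unification never unfolds a sum.
  opaque

    ∑ : ∀ {n} → (Fin n → ℚ) → ℚ
    ∑ = sum

    ∑-zero : (f : Fin 0 → ℚ) → ∑ f ≡ 0ℚ
    ∑-zero f = refl

    ∑-suc : ∀ {n} (f : Fin (suc n) → ℚ) → ∑ f ≡ f zero + ∑ (λ i → f (suc i))
    ∑-suc f = refl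

    ∑-cong : ∀ {n} {f g : Fin n → ℚ} → (∀ i → f i ≡ g i) → ∑ f ≡ ∑ g
    ∑-cong = sum-cong-≗

    ∑-+ : ∀ {n} (f g : Fin n → ℚ) → ∑ (λ i → f i + g i) ≡ ∑ f + ∑ g
    ∑-+ = ∑-distrib-+

    ∑-swap : ∀ {m n} (f : Fin m → Fin n → ℚ) →
      ∑ (λ i → ∑ (λ j → f i j)) ≡ ∑ (λ j → ∑ (λ i → f i j))
    ∑-swap = ∑-comm

    ∑-*ˡ : ∀ {n} c (f : Fin n → ℚ) → c * ∑ f ≡ ∑ (λ i → c * f i)
    ∑-*ˡ = *-distribˡ-sum

    ∑-*ʳ : ∀ {n} c (f : Fin n → ℚ) → ∑ f * c ≡ ∑ (λ i → f i * c)
    ∑-*ʳ = *-distribʳ-sum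

    ∑-permute : ∀ {m n} (f : Fin n → ℚ) (π : Permutation m n) → ∑ f ≡ ∑ (λ i → f (π ⟨$⟩ʳ i))
    ∑-permute = sum-permute

    ∑-mono : ∀ {n} {f g : Fin n → ℚ} → (∀ i → f i ≤ g i) → ∑ f ≤ ∑ g
    ∑-mono {zero}  f≤g = ≤-refl
    ∑-mono {suc n} f≤g = +-mono-≤ (f≤g zero) (∑-mono (λ i → f≤g (suc i)))

    0≤∑ : ∀ {n} {f : Fin n → ℚ} → (∀ i → 0ℚ ≤ f i) → 0ℚ ≤ ∑ f
    0≤∑ {n} {f} 0≤f = subst (_≤ ∑ f) (sum-replicate-zero n) (∑-mono 0≤f)

    term≤∑ : ∀ {n} {f : Fin n → ℚ} → (∀ i → 0ℚ ≤ f i) → ∀ i → f i ≤ ∑ f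
    term≤∑ {suc n} {f} 0≤f zero = ≤-by refl (0≤∑ (λ i → 0≤f (suc i)))
    term≤∑ {suc n} {f} 0≤f (suc i) = ≤-trans (term≤∑ (λ i → 0≤f (suc i)) i)
      (≤-by (+-comm (f zero) _) (0≤f zero))

    ∑-const : ∀ n c → ∑ {n} (λ _ → c) ≡ fromℕ n * c
    ∑-const zero    c = sym (*-zeroˡ c)
    ∑-const (suc n) c = trans (cong (c +_) (∑-const n c))
      (trans (solve 2 (λ c n → c :+ n :* c := (con 1ℚ :+ n) :* c) refl c (fromℕ n))
             (cong (_* c) (sym (fromℕ-+ 1 n))))

    ∑-neg : ∀ {n} (f : Fin n → ℚ) → ∑ (λ i → - f i) ≡ - ∑ f
    ∑-neg {zero}  f = refl
    ∑-neg {suc n} f = trans (cong (- f zero +_) (∑-neg (λ i → f (suc i))))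
                            (sym (neg-distrib-+ (f zero) _))

    ∣∑∣≤∑∣∣ : ∀ {n} (f : Fin n → ℚ) → ∣ ∑ f ∣ ≤ ∑ (λ i → ∣ f i ∣)
    ∣∑∣≤∑∣∣ {zero}  f = ≤-refl
    ∣∑∣≤∑∣∣ {suc n} f = ≤-trans (∣p+q∣≤∣p∣+∣q∣ (f zero) _)
      (+-monoʳ-≤ ∣ f zero ∣ (∣∑∣≤∑∣∣ (λ i → f (suc i))))

  ⟦_⟧ : Bool → ℚ
  ⟦ b ⟧ = if b then 1ℚ else 0ℚ

  0≤⟦_⟧ : ∀ b → 0ℚ ≤ ⟦ b ⟧
  0≤⟦ true ⟧ = nonNegative⁻¹ 1ℚ
  0≤⟦ false ⟧ = ≤-refl

  ⟦_⟧≤1 : ∀ b → ⟦ b ⟧ ≤ 1ℚ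
  ⟦ true ⟧≤1 = ≤-refl
  ⟦ false ⟧≤1 = nonNegative⁻¹ 1ℚ

-- Sub-eigenvectors from approximate eigenvectors

module Subinvariance where

  open import Data.Rational.Base hiding (_≃_)
  open import Data.Rational.Properties
  open RationalSums

  -- For an eigenvector v of A with eigenvalue μ, the vector |v| / max |v| is an instance
  -- with q = |μ| and ε = 0.
  record SubEigen {n} (A : Fin n → Fin n → Bool) (q ε : ℚ) : Set where
    field
      x      : Fin n → ℚ
      0≤x    : ∀ i → 0ℚ ≤ x i
      x≤1    : ∀ i → x i ≤ 1ℚ
      top    : Fin n
      x-top  : x top ≡ 1ℚ
      0≤q    : 0ℚ ≤ q
      sub    : ∀ i → q * x i ≤ ∑ (λ j → ⟦ A i j ⟧ * x j) + ε

  Eventually : (ℕ → Set) → Set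
  Eventually P = Σ ℕ λ N → ∀ k → N ℕ.≤ k → P k

  ev-map₂ : ∀ {P Q R : ℕ → Set} → (∀ k → P k → Q k → R k) →
            Eventually P → Eventually Q → Eventually R
  ev-map₂ f (M , p) (N , q) = M ℕ.⊔ N , λ k ≤k →
    f k (p k (ℕ.m⊔n≤o⇒m≤o M N ≤k)) (q k (ℕ.m⊔n≤o⇒n≤o M N ≤k))

  ev-map : ∀ {P Q : ℕ → Set} → (∀ k → P k → Q k) → Eventually P → Eventually Q
  ev-map f (N , p) = N , λ k ≤k → f k (p k ≤k)

  ev-all : ∀ {n} {P : Fin n → ℕ → Set} → (∀ i → Eventually (P i)) →
           Eventually (λ k → ∀ i → P i k)
  ev-all {zero}  ev = 0 , λ _ _ ()
  ev-all {suc n} ev = ev-map₂ (λ { k p q zero → p ; k p q (suc i) → q i })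
    (ev zero) (ev-all (λ i → ev (suc i)))

  argmax : ∀ {n} (f : Fin (suc n) → ℚ) → ∃ λ u → ∀ i → f i ≤ f u
  argmax {zero}  f = zero , λ { zero → ≤-refl }
  argmax {suc n} f with argmax (λ i → f (suc i))
  ... | u , max with ≤-total (f zero) (f (suc u))
  ...   | inj₁ ≤u = suc u , λ { zero → ≤u ; (suc i) → max i }
  ...   | inj₂ u≤ = zero , λ { zero → ≤-refl ; (suc i) → ≤-trans (max i) u≤ }

  infix 8 _⊙_
  _⊙_ : ∀ {n} → (Fin n → Fin n → Bool) → (Fin n → ℚ) → Fin n → ℚ
  (A ⊙ x) i = ∑ (λ j → ⟦ A i j ⟧ * x j)

  module _ {n} (A : Fin n → Fin n → Bool) where

    ⊙-symmetric : (∀ i j → A i j ≡ A j i) → ∀ x y →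
      ∑ (λ i → y i * (A ⊙ x) i) ≡ ∑ (λ i → x i * (A ⊙ y) i)
    ⊙-symmetric A-sym x y = begin
      ∑ (λ i → y i * ∑ (λ j → ⟦ A i j ⟧ * x j))
        ≡⟨ ∑-cong (λ i → ∑-*ˡ (y i) _) ⟩
      ∑ (λ i → ∑ (λ j → y i * (⟦ A i j ⟧ * x j)))
        ≡⟨ ∑-swap _ ⟩
      ∑ (λ j → ∑ (λ i → y i * (⟦ A i j ⟧ * x j)))
        ≡⟨ ∑-cong (λ j → ∑-cong λ i →
             trans (cong (λ b → y i * (⟦ b ⟧ * x j)) (A-sym i j))
                   (solve 3 (λ y a x → y :* (a :* x) := x :* (a :* y)) refl (y i) ⟦ A j i ⟧ (x j))) ⟩
      ∑ (λ j → ∑ (λ i → x j * (⟦ A j i ⟧ * y i)))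
        ≡⟨ ∑-cong (λ j → sym (∑-*ˡ (x j) _)) ⟩
      ∑ (λ j → x j * ∑ (λ i → ⟦ A j i ⟧ * y i)) ∎
      where open ≡-Reasoning

    ∣⊙∣ : ∀ x i → ∣ (A ⊙ x) i ∣ ≤ (A ⊙ (λ j → ∣ x j ∣)) i
    ∣⊙∣ x i = ≤-trans (∣∑∣≤∑∣∣ _) (≤-reflexive (∑-cong λ j →
      trans (∣p*q∣≡∣p∣*∣q∣ ⟦ A i j ⟧ (x j)) (cong (_* ∣ x j ∣) (0≤p⇒∣p∣≡p 0≤⟦ A i j ⟧))))

  ∣p∣*∣p∣≡p*p : ∀ p → ∣ p ∣ * ∣ p ∣ ≡ p * p
  ∣p∣*∣p∣≡p*p p = trans (sym (∣p*q∣≡∣p∣*∣q∣ p p)) (0≤p⇒∣p∣≡p (0≤square p))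

  -- The symmetry of A makes the imaginary part β of an approximate eigenvalue small:
  -- β Σ (X² + Y²) = Σ (Y·(A X) − X·(A Y)) up to the errors.
  module ApproximateEigenvector {n} (A : Fin (suc n) → Fin (suc n) → Bool) (A-sym : ∀ i j → A i j ≡ A j i)
    (α β : ℚ) (X Y : Fin (suc n) → ℚ) (η : ℚ)
    (eqX : ∀ i → ∣ (A ⊙ X) i - (α * X i - β * Y i) ∣ ≤ η)
    (eqY : ∀ i → ∣ (A ⊙ Y) i - (α * Y i + β * X i) ∣ ≤ η)
    (i₀ : Fin (suc n)) (δ : ℚ) (0<δ : 0ℚ < δ) (δ≤ : δ ≤ ∣ X i₀ ∣ + ∣ Y i₀ ∣)
    (ε : ℚ) (η≤ε : (fromℕ 2 + fromℕ 2 * fromℕ (suc n)) * η ≤ ε * δ)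
    where

    private
      N : ℚ
      N = fromℕ (suc n)

      -- The sum |X| + |Y| stands in for the modulus, which need not be rational. It obeys the same
      -- inequality as soon as β is small.
      W : Fin (suc n) → ℚ
      W i = ∣ X i ∣ + ∣ Y i ∣

      0≤W : ∀ i → 0ℚ ≤ W i
      0≤W i = 0≤∣p∣ (X i) ⊕ 0≤∣p∣ (Y i)

      0≤η : 0ℚ ≤ η
      0≤η = ≤-trans (0≤∣p∣ ((A ⊙ X) i₀ - (α * X i₀ - β * Y i₀))) (eqX i₀)

      u : Fin (suc n)
      u = proj₁ (argmax W)

      w : ℚ
      w = W u

      W≤w : ∀ i → W i ≤ w
      W≤w = proj₂ (argmax W)

      δ≤w : δ ≤ w
      δ≤w = ≤-trans δ≤ (W≤w i₀)

      0<w : 0ℚ < w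
      0<w = <-≤-trans 0<δ δ≤w

      e f : Fin (suc n) → ℚ
      e i = (A ⊙ X) i - (α * X i - β * Y i)
      f i = (A ⊙ Y) i - (α * Y i + β * X i)

      S : ℚ
      S = ∑ (λ i → X i * X i + Y i * Y i)

      -- The terms with α cancel pointwise, the two bilinear forms by symmetry of `A`. With zero
      -- errors this is the reality of the eigenvalues of a symmetric matrix.
      β-identity : ∑ (λ i → Y i * e i - X i * f i) ≡ β * S
      β-identity = begin
        ∑ (λ i → Y i * e i - X i * f i)
          ≡⟨ ∑-cong (λ i → solve 6 (λ X Y a b AX AY →
               Y :* (AX :- (a :* X :- b :* Y)) :- X :* (AY :- (a :* Y :+ b :* X))
               := (Y :* AX :+ :- (X :* AY)) :+ b :* (X :* X :+ Y :* Y))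
               refl (X i) (Y i) α β ((A ⊙ X) i) ((A ⊙ Y) i)) ⟩
        ∑ (λ i → (Y i * (A ⊙ X) i + - (X i * (A ⊙ Y) i)) + β * (X i * X i + Y i * Y i))
          ≡⟨ ∑-+ (λ i → Y i * (A ⊙ X) i + - (X i * (A ⊙ Y) i)) _ ⟩
        ∑ (λ i → Y i * (A ⊙ X) i + - (X i * (A ⊙ Y) i)) + ∑ (λ i → β * (X i * X i + Y i * Y i))
          ≡⟨ cong₂ _+_ (∑-+ (λ i → Y i * (A ⊙ X) i) _) (sym (∑-*ˡ β _)) ⟩
        (∑ (λ i → Y i * (A ⊙ X) i) + ∑ (λ i → - (X i * (A ⊙ Y) i))) + β * S
          ≡⟨ cong (λ s → (∑ (λ i → Y i * (A ⊙ X) i) + s) + β * S) (∑-neg (λ i → X i * (A ⊙ Y) i)) ⟩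
        (∑ (λ i → Y i * (A ⊙ X) i) - ∑ (λ i → X i * (A ⊙ Y) i)) + β * S
          ≡⟨ cong (λ s → (s - ∑ (λ i → X i * (A ⊙ Y) i)) + β * S) (⊙-symmetric A A-sym X Y) ⟩
        (∑ (λ i → X i * (A ⊙ Y) i) - ∑ (λ i → X i * (A ⊙ Y) i)) + β * S
          ≡⟨ solve 2 (λ s b → (s :- s) :+ b := b) refl (∑ (λ i → X i * (A ⊙ Y) i)) (β * S) ⟩
        β * S ∎
        where open ≡-Reasoning

      0≤S-terms : ∀ i → 0ℚ ≤ X i * X i + Y i * Y i
      0≤S-terms i = 0≤square (X i) ⊕ 0≤square (Y i)

      -- Since S is at least w² / 2, the bound of |β| S by a multiple of w η turns into a bound of
      -- |β| w by a multiple of η.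
      w²≤2S : w * w ≤ fromℕ 2 * S
      w²≤2S = ≤-trans
        (≤-by (trans (cong (fromℕ 2 *_) (sym (cong₂ _+_ (∣p∣*∣p∣≡p*p (X u)) (∣p∣*∣p∣≡p*p (Y u)))))
                     (solve 2 (λ p q → # 2 :* (p :* p :+ q :* q) := (p :+ q) :* (p :+ q) :+ (p :- q) :* (p :- q))
                              refl (∣ X u ∣) (∣ Y u ∣)))
              (0≤square (∣ X u ∣ - ∣ Y u ∣)))
        (*-monoˡ (0≤fromℕ 2) (term≤∑ 0≤S-terms u))

      ∣β∣S≤ : ∣ β ∣ * S ≤ N * (w * η)
      ∣β∣S≤ = begin
        ∣ β ∣ * S ≡⟨ cong (∣ β ∣ *_) (sym (0≤p⇒∣p∣≡p (0≤∑ 0≤S-terms))) ⟩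
        ∣ β ∣ * ∣ S ∣ ≡⟨ sym (∣p*q∣≡∣p∣*∣q∣ β S) ⟩
        ∣ β * S ∣ ≡⟨ cong ∣_∣ (sym β-identity) ⟩
        ∣ ∑ (λ i → Y i * e i - X i * f i) ∣ ≤⟨ ∣∑∣≤∑∣∣ _ ⟩
        ∑ (λ i → ∣ Y i * e i - X i * f i ∣) ≤⟨ ∑-mono term ⟩
        ∑ {suc n} (λ _ → w * η) ≡⟨ ∑-const (suc n) (w * η) ⟩
        N * (w * η) ∎
        where
        open ≤-Reasoning
        term : ∀ i → ∣ Y i * e i - X i * f i ∣ ≤ w * η
        term i = begin
          ∣ Y i * e i - X i * f i ∣ ≤⟨ ∣p-q∣≤∣p∣+∣q∣ (Y i * e i) (X i * f i) ⟩
          ∣ Y i * e i ∣ + ∣ X i * f i ∣ ≡⟨ cong₂ _+_ (∣p*q∣≡∣p∣*∣q∣ (Y i) (e i)) (∣p*q∣≡∣p∣*∣q∣ (X i) (f i)) ⟩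
          ∣ Y i ∣ * ∣ e i ∣ + ∣ X i ∣ * ∣ f i ∣ ≤⟨ +-mono-≤ (*-monoˡ (0≤∣p∣ (Y i)) (eqX i)) (*-monoˡ (0≤∣p∣ (X i)) (eqY i)) ⟩
          ∣ Y i ∣ * η + ∣ X i ∣ * η ≡⟨ solve 3 (λ x y h → y :* h :+ x :* h := (x :+ y) :* h) refl (∣ X i ∣) (∣ Y i ∣) η ⟩
          W i * η ≤⟨ *-monoʳ 0≤η (W≤w i) ⟩
          w * η ∎

      ∣β∣w≤ : ∣ β ∣ * w ≤ fromℕ 2 * N * η
      ∣β∣w≤ = *-cancelˡ 0<w (begin
        w * (∣ β ∣ * w) ≡⟨ solve 2 (λ w b → w :* (b :* w) := b :* (w :* w)) refl w ∣ β ∣ ⟩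
        ∣ β ∣ * (w * w) ≤⟨ *-monoˡ (0≤∣p∣ β) w²≤2S ⟩
        ∣ β ∣ * (fromℕ 2 * S) ≡⟨ solve 2 (λ b s → b :* (# 2 :* s) := # 2 :* (b :* s)) refl ∣ β ∣ S ⟩
        fromℕ 2 * (∣ β ∣ * S) ≤⟨ *-monoˡ (0≤fromℕ 2) ∣β∣S≤ ⟩
        fromℕ 2 * (N * (w * η)) ≡⟨ solve 3 (λ n w h → # 2 :* (n :* (w :* h)) := w :* (# 2 :* n :* h)) refl N w η ⟩
        w * (fromℕ 2 * N * η) ∎)
        where open ≤-Reasoning

      bound : ∀ i → ∣ α ∣ * W i ≤ (A ⊙ W) i + ε * δ
      bound i = begin
        ∣ α ∣ * W i
          ≡⟨ *-distribˡ-+ (∣ α ∣) (∣ X i ∣) (∣ Y i ∣) ⟩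
        ∣ α ∣ * ∣ X i ∣ + ∣ α ∣ * ∣ Y i ∣
          ≡⟨ cong₂ _+_ (sym (∣p*q∣≡∣p∣*∣q∣ α (X i))) (sym (∣p*q∣≡∣p∣*∣q∣ α (Y i))) ⟩
        ∣ α * X i ∣ + ∣ α * Y i ∣
          ≡⟨ cong₂ (λ p q → ∣ p ∣ + ∣ q ∣)
               (solve 5 (λ AX a b X Y → a :* X := (AX :+ :- (AX :- (a :* X :- b :* Y))) :+ b :* Y) refl ((A ⊙ X) i) α β (X i) (Y i))
               (solve 5 (λ AY a b X Y → a :* Y := (AY :+ :- (AY :- (a :* Y :+ b :* X))) :+ :- (b :* X)) refl ((A ⊙ Y) i) α β (X i) (Y i)) ⟩
        ∣ ((A ⊙ X) i + - e i) + β * Y i ∣ + ∣ ((A ⊙ Y) i + - f i) + - (β * X i) ∣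
          ≤⟨ +-mono-≤ (three _ _ _ (∣⊙∣ A X i) (neg-bound (e i) (eqX i)) (≤-reflexive (∣p*q∣≡∣p∣*∣q∣ β (Y i))))
                      (three _ _ _ (∣⊙∣ A Y i) (neg-bound (f i) (eqY i)) (≤-reflexive (trans (∣-p∣≡∣p∣ (β * X i)) (∣p*q∣≡∣p∣*∣q∣ β (X i))))) ⟩
        (((A ⊙ (λ j → ∣ X j ∣)) i + η) + ∣ β ∣ * ∣ Y i ∣) + (((A ⊙ (λ j → ∣ Y j ∣)) i + η) + ∣ β ∣ * ∣ X i ∣)
          ≡⟨ solve 6 (λ AX AY h b X Y → ((AX :+ h) :+ b :* Y) :+ ((AY :+ h) :+ b :* X)
                        := (AX :+ AY) :+ (# 2 :* h :+ b :* (X :+ Y)))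
               refl ((A ⊙ (λ j → ∣ X j ∣)) i) ((A ⊙ (λ j → ∣ Y j ∣)) i) η (∣ β ∣) (∣ X i ∣) (∣ Y i ∣) ⟩
        ((A ⊙ (λ j → ∣ X j ∣)) i + (A ⊙ (λ j → ∣ Y j ∣)) i) + (fromℕ 2 * η + ∣ β ∣ * W i)
          ≡⟨ cong (_+ (fromℕ 2 * η + ∣ β ∣ * W i)) (trans (sym (∑-+ (λ j → ⟦ A i j ⟧ * ∣ X j ∣) _))
               (∑-cong λ j → sym (*-distribˡ-+ ⟦ A i j ⟧ (∣ X j ∣) (∣ Y j ∣)))) ⟩
        (A ⊙ W) i + (fromℕ 2 * η + ∣ β ∣ * W i)
          ≤⟨ +-monoʳ-≤ ((A ⊙ W) i) (≤-trans
               (+-monoʳ-≤ (fromℕ 2 * η) (≤-trans (*-monoˡ (0≤∣p∣ β) (W≤w i)) ∣β∣w≤))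
               (≤-trans (≤-reflexive (solve 2 (λ h n → # 2 :* h :+ # 2 :* n :* h := (# 2 :+ # 2 :* n) :* h) refl η N)) η≤ε)) ⟩
        (A ⊙ W) i + ε * δ ∎
        where
        open ≤-Reasoning
        three : ∀ p q r {p' q' r'} → ∣ p ∣ ≤ p' → ∣ q ∣ ≤ q' → ∣ r ∣ ≤ r' → ∣ (p + q) + r ∣ ≤ (p' + q') + r'
        three p q r hp hq hr = ≤-trans (∣p+q∣≤∣p∣+∣q∣ (p + q) r)
          (+-mono-≤ (≤-trans (∣p+q∣≤∣p∣+∣q∣ p q) (+-mono-≤ hp hq)) hr)
        neg-bound : ∀ p → ∣ p ∣ ≤ η → ∣ - p ∣ ≤ η
        neg-bound p h = subst (_≤ η) (sym (∣-p∣≡∣p∣ p)) h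

      instance
        w≢0 : NonZero w
        w≢0 = pos⇒nonZero w {{positive 0<w}}

      0≤1/w : 0ℚ ≤ 1/ w
      0≤1/w = <⇒≤ (positive⁻¹ (1/ w) {{1/pos⇒pos w {{positive 0<w}}}})

      0≤ε : 0ℚ ≤ ε
      0≤ε = *-cancelˡ 0<δ (subst₂ _≤_ (sym (*-zeroʳ δ)) (*-comm ε δ)
        (≤-trans ((0≤fromℕ 2 ⊕ 0≤fromℕ 2 ⊗ 0≤fromℕ (suc n)) ⊗ 0≤η) η≤ε))

    subEigen : SubEigen A ∣ α ∣ ε
    subEigen = record
      { x     = λ i → W i * 1/ w
      ; 0≤x   = λ i → 0≤W i ⊗ 0≤1/w
      ; x≤1   = λ i → subst (W i * 1/ w ≤_) (*-inverseʳ w) (*-monoʳ 0≤1/w (W≤w i))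
      ; top   = u
      ; x-top = *-inverseʳ w
      ; 0≤q   = 0≤∣p∣ α
      ; sub   = λ i → begin
          ∣ α ∣ * (W i * 1/ w) ≡⟨ sym (*-assoc ∣ α ∣ (W i) (1/ w)) ⟩
          -- The error was fixed as `ε * δ` before normalising; as δ ≤ w, division by w leaves at
          -- most `ε`.
          ∣ α ∣ * W i * 1/ w ≤⟨ *-monoʳ 0≤1/w (≤-trans (bound i) (+-monoʳ-≤ ((A ⊙ W) i) (*-monoˡ 0≤ε δ≤w))) ⟩
          ((A ⊙ W) i + ε * w) * 1/ w ≡⟨ solve 4 (λ a e w v → (a :+ e :* w) :* v := a :* v :+ e :* (w :* v)) refl ((A ⊙ W) i) ε w (1/ w) ⟩
          (A ⊙ W) i * 1/ w + ε * (w * 1/ w) ≡⟨ cong₂ _+_ (trans (∑-*ʳ (1/ w) (λ j → ⟦ A i j ⟧ * W j)) (∑-cong λ j → *-assoc ⟦ A i j ⟧ (W j) (1/ w)))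
                                                                (trans (cong (ε *_) (*-inverseʳ w)) (*-identityʳ ε)) ⟩
          ∑ (λ j → ⟦ A i j ⟧ * (W j * 1/ w)) + ε ∎
      }
      where open ≤-Reasoning

    ∣β∣≤ε : ∣ β ∣ ≤ ε
    ∣β∣≤ε = *-cancelˡ 0<δ (begin
      δ * ∣ β ∣ ≡⟨ *-comm δ ∣ β ∣ ⟩
      ∣ β ∣ * δ ≤⟨ *-monoˡ (0≤∣p∣ β) δ≤w ⟩
      ∣ β ∣ * w ≤⟨ ∣β∣w≤ ⟩
      fromℕ 2 * N * η ≤⟨ ≤-by (solve 2 (λ h n → (# 2 :+ # 2 :* n) :* h := # 2 :* n :* h :+ # 2 :* h) refl η N) (0≤fromℕ 2 ⊗ 0≤η) ⟩
      (fromℕ 2 + fromℕ 2 * N) * η ≤⟨ η≤ε ⟩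
      ε * δ ≡⟨ *-comm ε δ ⟩
      δ * ε ∎)
      where open ≤-Reasoning

-- From complex eigenvectors to their rational stages

module EigenvalueApproximation where

  open import Data.Rational.Base hiding (_≃_)
  open import Data.Rational.Properties
  open RationalSums
  open Subinvariance

  opaque
    unfolding ∑

    seq-re-sum : ∀ {n} (f : Fin n → ℂ) k → seq (re (sumᶜ f)) k ≡ ∑ (λ j → seq (re (f j)) k)
    seq-re-sum {zero}  f k = refl
    seq-re-sum {suc n} f k = cong (seq (re (f zero)) k +_) (seq-re-sum (λ i → f (suc i)) k)

    seq-im-sum : ∀ {n} (f : Fin n → ℂ) k → seq (im (sumᶜ f)) k ≡ ∑ (λ j → seq (im (f j)) k)
    seq-im-sum {zero}  f k = refl
    seq-im-sum {suc n} f k = cong (seq (im (f zero)) k +_) (seq-im-sum (λ i → f (suc i)) k)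

  bitᶜ : Bool → ℂ
  bitᶜ b = if b then 1ᶜ else 0ᶜ

  seq-re-bit : ∀ b z k → seq (re (bitᶜ b *ᶜ z)) k ≡ ⟦ b ⟧ * seq (re z) k
  seq-re-bit true  z k = solve 2 (λ x y → con 1ℚ :* x :- con 0ℚ :* y := con 1ℚ :* x) refl (seq (re z) k) (seq (im z) k)
  seq-re-bit false z k = solve 2 (λ x y → con 0ℚ :* x :- con 0ℚ :* y := con 0ℚ :* x) refl (seq (re z) k) (seq (im z) k)

  seq-im-bit : ∀ b z k → seq (im (bitᶜ b *ᶜ z)) k ≡ ⟦ b ⟧ * seq (im z) k
  seq-im-bit true  z k = solve 2 (λ x y → con 1ℚ :* y :+ con 0ℚ :* x := con 1ℚ :* y) refl (seq (re z) k) (seq (im z) k)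
  seq-im-bit false z k = solve 2 (λ x y → con 0ℚ :* y :+ con 0ℚ :* x := con 0ℚ :* y) refl (seq (re z) k) (seq (im z) k)

  seq-re-⊙ : ∀ {n} (A : Fin n → Fin n → Bool) v i k →
    seq (re (((λ i j → bitᶜ (A i j)) · v) i)) k ≡ (A ⊙ (λ j → seq (re (v j)) k)) i
  seq-re-⊙ A v i k = trans (seq-re-sum (λ j → bitᶜ (A i j) *ᶜ v j) k)
    (∑-cong λ j → seq-re-bit (A i j) (v j) k)

  seq-im-⊙ : ∀ {n} (A : Fin n → Fin n → Bool) v i k →
    seq (im (((λ i j → bitᶜ (A i j)) · v) i)) k ≡ (A ⊙ (λ j → seq (im (v j)) k)) i
  seq-im-⊙ A v i k = trans (seq-im-sum (λ j → bitᶜ (A i j) *ᶜ v j) k)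
    (∑-cong λ j → seq-im-bit (A i j) (v j) k)

  ⊓-pos : ∀ {p q} → 0ℚ < p → 0ℚ < q → 0ℚ < p ⊓ q
  ⊓-pos {p} {q} 0<p 0<q with ⊓-sel p q
  ... | inj₁ eq = subst (0ℚ <_) (sym eq) 0<p
  ... | inj₂ eq = subst (0ℚ <_) (sym eq) 0<q

  0<1+ : ∀ n → 0ℚ < fromℕ (suc n)
  0<1+ n = fromℕ-mono-< {0} {suc n} (ℕ.s≤s ℕ.z≤n)

  small-multiple : ∀ c e → 0ℚ < c → 0ℚ < e → ∃ λ η → 0ℚ < η × c * η ≤ e
  small-multiple c e 0<c 0<e = 1/ c * e , *-pos (positive⁻¹ (1/ c) {{1/pos⇒pos c {{positive 0<c}}}}) 0<e ,
    ≤-reflexive (trans (sym (*-assoc c (1/ c) e)) (trans (cong (_* e) (*-inverseʳ c)) (*-identityˡ e)))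
    where instance
      _ : NonZero c
      _ = pos⇒nonZero c {{positive 0<c}}

  -- One δ has to serve all late stages, because the tolerance for the eigenvalue equations is
  -- chosen from it before any stage is.
  nonZero-bound : ∀ z → NonZeroᶜ z →
    ∃ λ δ → 0ℚ < δ × Eventually (λ k → δ ≤ ∣ seq (re z) k ∣ + ∣ seq (im z) k ∣)
  nonZero-bound z = λ where
      (inj₁ (inj₁ (δ , 0<δ , ev))) → δ , 0<δ , ev-map (λ k h → ≤-trans (below h) (inl k)) ev
      (inj₁ (inj₂ (δ , 0<δ , ev))) → δ , 0<δ , ev-map (λ k h → ≤-trans (above h) (inl k)) ev
      (inj₂ (inj₁ (δ , 0<δ , ev))) → δ , 0<δ , ev-map (λ k h → ≤-trans (below h) (inr k)) ev
      (inj₂ (inj₂ (δ , 0<δ , ev))) → δ , 0<δ , ev-map (λ k h → ≤-trans (above h) (inr k)) ev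
    where
    below : ∀ {p δ} → p + δ ≤ 0ℚ → δ ≤ ∣ p ∣
    below {p} {δ} h = ≤-trans (≤-by (solve 2 (λ p d → :- p := d :+ (con 0ℚ :- (p :+ d))) refl p δ) (≤⇒0≤- h)) (-p≤∣p∣ p)
    above : ∀ {p δ} → 0ℚ + δ ≤ p → δ ≤ ∣ p ∣
    above {p} {δ} h = ≤-trans (subst (_≤ p) (+-identityˡ δ) h) (p≤∣p∣ p)
    inl : ∀ k → ∣ seq (re z) k ∣ ≤ ∣ seq (re z) k ∣ + ∣ seq (im z) k ∣
    inl k = ≤-by refl (0≤∣p∣ (seq (im z) k))
    inr : ∀ k → ∣ seq (im z) k ∣ ≤ ∣ seq (re z) k ∣ + ∣ seq (im z) k ∣
    inr k = ≤-by (+-comm (∣ seq (re z) k ∣) (∣ seq (im z) k ∣)) (0≤∣p∣ (seq (re z) k))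

  -- Two errors are collected in `fromℕ 2 * ε`: that of r² against α² + β², and β² itself, as q is
  -- only |α|.
  ApproximatedBy : ∀ {n} → (Fin n → Fin n → Bool) → ℚ → ℚ → Set
  ApproximatedBy A ε r = ∃ λ q → SubEigen A q ε × r * r ≤ q * q + fromℕ 2 * ε

  eigenvalue⇒subEigen : ∀ {n} (A : Fin n → Fin n → Bool) → (∀ i j → A i j ≡ A j i) →
    ∀ μ r → IsEigenvalue (λ i j → bitᶜ (A i j)) μ → IsModulus r μ →
    ∀ ε → 0ℚ < ε → ε ≤ 1ℚ → Eventually (λ k → ApproximatedBy A ε (seq r k))
  eigenvalue⇒subEigen {zero} A A-sym μ r (v , (() , _) , _)
  eigenvalue⇒subEigen {suc n} A A-sym μ r (v , (i₀ , v₀≢0) , eqs) (_ , r²≃) ε 0<ε ε≤1 =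
    ev-map₂ (λ k (δ≤ , mod) (eqX , eqY) → conclude k δ≤ mod eqX eqY)
      (ev-map₂ (λ k p q → p , q) (proj₂ (proj₂ (nonZero-bound (v i₀) v₀≢0))) (r²≃ η 0<η))
      (ev-map₂ (λ k p q → p , q) (ev-all (λ i → proj₁ (eqs i) η 0<η)) (ev-all (λ i → proj₂ (eqs i) η 0<η)))
    where
    δ : ℚ
    δ = proj₁ (nonZero-bound (v i₀) v₀≢0)
    0<δ : 0ℚ < δ
    0<δ = proj₁ (proj₂ (nonZero-bound (v i₀) v₀≢0))
    c : ℚ
    c = fromℕ 2 + fromℕ 2 * fromℕ (suc n)
    0<c : 0ℚ < c
    0<c = +-mono-<-≤ (0<1+ 1) (0≤fromℕ 2 ⊗ 0≤fromℕ (suc n))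
    small : ∃ λ η → 0ℚ < η × c * η ≤ ε * δ
    small = small-multiple c (ε * δ) 0<c (*-pos 0<ε 0<δ)
    η : ℚ
    η = proj₁ small ⊓ ε
    0<η : 0ℚ < η
    0<η = ⊓-pos (proj₁ (proj₂ small)) 0<ε
    cη≤ : c * η ≤ ε * δ
    cη≤ = ≤-trans (*-monoˡ (<⇒≤ 0<c) (p⊓q≤p (proj₁ small) ε)) (proj₂ (proj₂ small))
    α β : ℕ → ℚ
    α = seq (re μ)
    β = seq (im μ)
    X Y : ℕ → Fin (suc n) → ℚ
    X k i = seq (re (v i)) k
    Y k i = seq (im (v i)) k
    conclude : ∀ k → δ ≤ ∣ X k i₀ ∣ + ∣ Y k i₀ ∣ →
      ∣ seq r k * seq r k - (α k * α k + β k * β k) ∣ ≤ η →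
      (∀ i → ∣ seq (re (((λ i j → bitᶜ (A i j)) · v) i)) k - (α k * X k i - β k * Y k i) ∣ ≤ η) →
      (∀ i → ∣ seq (im (((λ i j → bitᶜ (A i j)) · v) i)) k - (α k * Y k i + β k * X k i) ∣ ≤ η) →
      ApproximatedBy A ε (seq r k)
    conclude k δ≤ mod eqX eqY = ∣ α k ∣ , subEigen , r²≤
      where
      open ApproximateEigenvector A A-sym (α k) (β k) (X k) (Y k) η
        (λ i → subst (λ p → ∣ p - (α k * X k i - β k * Y k i) ∣ ≤ η) (seq-re-⊙ A v i k) (eqX i))
        (λ i → subst (λ p → ∣ p - (α k * Y k i + β k * X k i) ∣ ≤ η) (seq-im-⊙ A v i k) (eqY i))
        i₀ δ 0<δ δ≤ ε cη≤
      β²≤ε : ∣ β k ∣ * ∣ β k ∣ ≤ ε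
      β²≤ε = ≤-trans (*-mono (<⇒≤ 0<ε) (0≤∣p∣ (β k)) ∣β∣≤ε (≤-trans ∣β∣≤ε ε≤1)) (≤-reflexive (*-identityʳ ε))
      open ≤-Reasoning
      r²≤ : seq r k * seq r k ≤ ∣ α k ∣ * ∣ α k ∣ + fromℕ 2 * ε
      r²≤ = begin
        seq r k * seq r k
          ≡⟨ solve 3 (λ r a b → r := (a :+ b) :+ (r :- (a :+ b))) refl (seq r k * seq r k) (α k * α k) (β k * β k) ⟩
        (α k * α k + β k * β k) + (seq r k * seq r k - (α k * α k + β k * β k))
          ≤⟨ +-mono-≤ (+-monoʳ-≤ (α k * α k) (subst (_≤ ε) (∣p∣*∣p∣≡p*p (β k)) β²≤ε))
               (≤-trans (p≤∣p∣ (seq r k * seq r k - (α k * α k + β k * β k))) (≤-trans mod (p⊓q≤q (proj₁ small) ε))) ⟩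
        (α k * α k + ε) + ε
          ≡⟨ solve 2 (λ a e → (a :+ e) :+ e := a :+ # 2 :* e) refl (α k * α k) ε ⟩
        α k * α k + fromℕ 2 * ε
          ≡⟨ cong (_+ fromℕ 2 * ε) (sym (∣p∣*∣p∣≡p*p (α k))) ⟩
        ∣ α k ∣ * ∣ α k ∣ + fromℕ 2 * ε ∎

-- Geometric convergence

module GeometricSequences where

  import Data.Integer.Properties as ℤ
  open import Data.Rational.Base hiding (_≃_)
  open import Data.Rational.Properties
  import Data.Rational.Unnormalised.Base as ℚᵘ
  import Data.Rational.Unnormalised.Properties as ℚᵘ
  open RationalSums
  open Subinvariance
  open EigenvalueApproximation

  -- recip 0 = 0.
  recip : ℚ → ℚ
  recip p with p ≟ 0ℚ
  ... | yes _  = 0ℚ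
  ... | no p≢0 = (1/ p) {{≢-nonZero p≢0}}

  *-recip : ∀ {p} → 0ℚ < p → p * recip p ≡ 1ℚ
  *-recip {p} 0<p with p ≟ 0ℚ
  ... | yes p≡0 = contradiction (sym p≡0) (<⇒≢ 0<p)
  ... | no p≢0  = *-inverseʳ p {{≢-nonZero p≢0}}

  0≤recip : ∀ {p} → 0ℚ < p → 0ℚ ≤ recip p
  0≤recip {p} 0<p = *-cancelˡ 0<p (subst₂ _≤_ (sym (*-zeroʳ p)) (sym (*-recip 0<p)) (nonNegative⁻¹ 1ℚ))

  archimedean : ∀ q → ∃ λ N → q ≤ fromℕ N
  archimedean q@(mkℚ n d-1 _) = ℤ.∣ n ∣ , toℚᵘ-cancel-≤
    (ℚᵘ.≤-respʳ-≃ (ℚᵘ.≃-sym (toℚᵘ-fromℚᵘ (ℚᵘ.mkℚᵘ (ℤ.+ ℤ.∣ n ∣) 0)))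
      (ℚᵘ.*≤* (ℤ.≤-trans (ℤ.≤-reflexive (ℤ.*-identityʳ n)) (bound n))))
    where
    bound : ∀ n → n ℤ.≤ (ℤ.+ ℤ.∣ n ∣) ℤ.* (ℤ.+ suc d-1)
    bound (ℤ.+ k) = subst ((ℤ.+ k) ℤ.≤_) (ℤ.pos-* k (suc d-1)) (ℤ.+≤+ (ℕ.m≤m*n k (suc d-1)))
    bound (ℤ.-[1+ k ]) = ℤ.≤-trans ℤ.-≤+ (subst (ℤ.+ 0 ℤ.≤_) (ℤ.pos-* (suc k) (suc d-1)) (ℤ.+≤+ ℕ.z≤n))

  ¼ ¾ : ℚ
  ¼ = (ℤ.+ 1) / 4
  ¾ = (ℤ.+ 3) / 4

  decay : ℕ → ℚ
  decay zero    = 1ℚ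
  decay (suc k) = ¾ * decay k

  0≤decay : ∀ k → 0ℚ ≤ decay k
  0≤decay zero    = nonNegative⁻¹ 1ℚ
  0≤decay (suc k) = nonNegative⁻¹ ¾ ⊗ 0≤decay k

  -- An explicit form of (3/4)^k → 0, namely at most 3 / (k + 3), so that an Archimedean integer
  -- already names the stage.
  decay-bound : ∀ k → decay k * (fromℕ k + fromℕ 3) ≤ fromℕ 3
  decay-bound zero    = ≤-refl
  decay-bound (suc k) = ≤-trans
    (≤-by (trans (solve 2 (λ d k → d :* (k :+ # 3) := con ¾ :* d :* ((con 1ℚ :+ k) :+ # 3) :+ con ¼ :* (d :* k)) refl (decay k) (fromℕ k))
                       (cong (λ s → ¾ * decay k * (s + fromℕ 3) + ¼ * (decay k * fromℕ k)) (sym (fromℕ-+ 1 k))))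
          (nonNegative⁻¹ ¼ ⊗ (0≤decay k ⊗ 0≤fromℕ k)))
    (decay-bound k)

  decay→0 : ∀ C ε → 0ℚ ≤ C → 0ℚ < ε → Eventually (λ k → C * decay k ≤ ε)
  decay→0 C ε 0≤C 0<ε with archimedean (fromℕ 3 * C * recip ε)
  ... | N , ≤N = N , λ k N≤k → *-cancelˡ (0<k+3 k) (begin
      (fromℕ k + fromℕ 3) * (C * decay k) ≡⟨ solve 3 (λ k c d → (k :+ # 3) :* (c :* d) := c :* (d :* (k :+ # 3))) refl (fromℕ k) C (decay k) ⟩
      C * (decay k * (fromℕ k + fromℕ 3)) ≤⟨ *-monoˡ 0≤C (decay-bound k) ⟩
      C * fromℕ 3 ≡⟨ solve 1 (λ c → c :* # 3 := # 3 :* c :* con 1ℚ) refl C ⟩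
      fromℕ 3 * C * 1ℚ ≡⟨ cong (fromℕ 3 * C *_) (sym (*-recip 0<ε)) ⟩
      fromℕ 3 * C * (ε * recip ε) ≡⟨ solve 3 (λ c e r → c :* (e :* r) := e :* (c :* r)) refl (fromℕ 3 * C) ε (recip ε) ⟩
      ε * (fromℕ 3 * C * recip ε) ≤⟨ *-monoˡ (<⇒≤ 0<ε) (≤-trans ≤N (fromℕ-mono-≤ {N} {k} N≤k)) ⟩
      ε * fromℕ k ≤⟨ ≤-by (solve 2 (λ e k → (k :+ # 3) :* e := e :* k :+ # 3 :* e) refl ε (fromℕ k)) (0≤fromℕ 3 ⊗ <⇒≤ 0<ε) ⟩
      (fromℕ k + fromℕ 3) * ε ∎)
    where
    open ≤-Reasoning
    0<k+3 : ∀ k → 0ℚ < fromℕ k + fromℕ 3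
    0<k+3 k = +-mono-≤-< {0ℚ} (0≤fromℕ k) (0<1+ 2)

  module _ (s : ℕ → ℚ) (C : ℚ) (0≤C : 0ℚ ≤ C) (step : ∀ k → ∣ s (suc k) - s k ∣ ≤ C * decay k) where

    private
      D : ℚ
      D = fromℕ 4 * C

      -- As 1 - 3/4 = 1/4, each step bound `C * decay j` is the difference of consecutive values of
      -- `D * decay` with D = 4 C, and the bounds telescope.
      jump : ∀ k j → ∣ s (j ℕ.+ k) - s k ∣ ≤ D * decay k - D * decay (j ℕ.+ k)
      jump k zero    = ≤-reflexive (trans (cong ∣_∣ (+-inverseʳ (s k))) (sym (+-inverseʳ (D * decay k))))
      jump k (suc j) = begin
        ∣ s (suc j ℕ.+ k) - s k ∣
          ≡⟨ cong ∣_∣ (solve 3 (λ a b c → a :- c := (a :- b) :+ (b :- c)) refl (s (suc j ℕ.+ k)) (s (j ℕ.+ k)) (s k)) ⟩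
        ∣ (s (suc j ℕ.+ k) - s (j ℕ.+ k)) + (s (j ℕ.+ k) - s k) ∣
          ≤⟨ ≤-trans (∣p+q∣≤∣p∣+∣q∣ (s (suc j ℕ.+ k) - s (j ℕ.+ k)) (s (j ℕ.+ k) - s k)) (+-mono-≤ (step (j ℕ.+ k)) (jump k j)) ⟩
        C * decay (j ℕ.+ k) + (D * decay k - D * decay (j ℕ.+ k))
          ≡⟨ solve 3 (λ c d e → c :* e :+ (# 4 :* c :* d :- # 4 :* c :* e)
                        := # 4 :* c :* d :- # 4 :* c :* (con ¾ :* e)) refl C (decay k) (decay (j ℕ.+ k)) ⟩
        D * decay k - D * decay (suc j ℕ.+ k) ∎
        where open ≤-Reasoning

      0≤D : 0ℚ ≤ D
      0≤D = 0≤fromℕ 4 ⊗ 0≤C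

      later : ∀ {k n} → k ℕ.≤ n → ∣ s n - s k ∣ ≤ D * decay k
      later {k} {n} k≤n = ≤-trans
        (subst (λ n → ∣ s n - s k ∣ ≤ D * decay k - D * decay n) (ℕ.m∸n+n≡m k≤n) (jump k (n ℕ.∸ k)))
        (≤-by (solve 2 (λ d e → d := (d :- e) :+ e) refl (D * decay k) (D * decay n)) (0≤D ⊗ 0≤decay n))

    geometric⇒cauchy : IsCauchy s
    geometric⇒cauchy ε 0<ε = N , λ i j N≤i N≤j → begin
        ∣ s i - s j ∣
          ≡⟨ cong ∣_∣ (solve 3 (λ a b c → a :- c := (a :- b) :+ :- (c :- b)) refl (s i) (s N) (s j)) ⟩
        ∣ (s i - s N) + - (s j - s N) ∣
          ≤⟨ ∣p+q∣≤∣p∣+∣q∣ (s i - s N) (- (s j - s N)) ⟩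
        ∣ s i - s N ∣ + ∣ - (s j - s N) ∣
          ≤⟨ +-mono-≤ (later N≤i) (subst (_≤ D * decay N) (sym (∣-p∣≡∣p∣ (s j - s N))) (later N≤j)) ⟩
        D * decay N + D * decay N
          ≡⟨ solve 2 (λ d e → d :* e :+ d :* e := # 2 :* d :* e) refl D (decay N) ⟩
        fromℕ 2 * D * decay N
          ≤⟨ proj₂ small N ℕ.≤-refl ⟩
        ε ∎
      where
      open ≤-Reasoning
      small : Eventually (λ k → fromℕ 2 * D * decay k ≤ ε)
      small = decay→0 (fromℕ 2 * D) ε (0≤fromℕ 2 ⊗ 0≤D) 0<ε
      N : ℕ
      N = proj₁ small

  geometric⇒≃ : ∀ x y C → 0ℚ ≤ C → (∀ k → ∣ seq x k - seq y k ∣ ≤ C * decay k) → x ≃ᵣ y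
  geometric⇒≃ x y C 0≤C close ε 0<ε = ev-map (λ k → ≤-trans (close k)) (decay→0 C ε 0≤C 0<ε)

-- Graphs with a dominating vertex

module HubGraphs where

  open import Data.Rational.Base hiding (_≃_)
  open import Data.Rational.Properties
  open RationalSums
  open Subinvariance

  hubAdj : ∀ {m} → (Fin m → Fin m → Bool) → Fin (suc m) → Fin (suc m) → Bool
  hubAdj B zero    zero    = false
  hubAdj B zero    (suc j) = true
  hubAdj B (suc i) zero    = true
  hubAdj B (suc i) (suc j) = B i j

  hubAdj-sym : ∀ {m} {B : Fin m → Fin m → Bool} → (∀ i j → B i j ≡ B j i) →
    ∀ i j → hubAdj B i j ≡ hubAdj B j i
  hubAdj-sym B-sym zero    zero    = refl
  hubAdj-sym B-sym zero    (suc j) = refl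
  hubAdj-sym B-sym (suc i) zero    = refl
  hubAdj-sym B-sym (suc i) (suc j) = B-sym i j

  cons : ∀ {m} → ℚ → (Fin m → ℚ) → Fin (suc m) → ℚ
  cons a y zero    = a
  cons a y (suc i) = y i

  hub-⊙-zero : ∀ {m} (B : Fin m → Fin m → Bool) x → (hubAdj B ⊙ x) zero ≡ ∑ (λ i → x (suc i))
  hub-⊙-zero B x = trans (∑-suc (λ j → ⟦ hubAdj B zero j ⟧ * x j))
    (trans (cong₂ _+_ (*-zeroˡ (x zero)) (∑-cong λ i → *-identityˡ (x (suc i)))) (+-identityˡ _))

  hub-⊙-suc : ∀ {m} (B : Fin m → Fin m → Bool) x i →
    (hubAdj B ⊙ x) (suc i) ≡ x zero + (B ⊙ (λ j → x (suc j))) i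
  hub-⊙-suc B x i = trans (∑-suc (λ j → ⟦ hubAdj B (suc i) j ⟧ * x j))
    (cong (_+ (B ⊙ (λ j → x (suc j))) i) (*-identityˡ (x zero)))

  module Degrees {m} (B : Fin m → Fin m → Bool) where

    deg : Fin m → ℚ
    deg i = ∑ (λ j → ⟦ B i j ⟧)

    -- For symmetric `B` these count the walks with one and with two edges.
    W₁ W₂ : ℚ
    W₁ = ∑ deg
    W₂ = ∑ (λ i → deg i * deg i)

    0≤deg : ∀ i → 0ℚ ≤ deg i
    0≤deg i = 0≤∑ (λ j → 0≤⟦ B i j ⟧)

    ⊙-mono : ∀ {x y} → (∀ j → x j ≤ y j) → ∀ i → (B ⊙ x) i ≤ (B ⊙ y) i
    ⊙-mono x≤y i = ∑-mono (λ j → *-monoˡ 0≤⟦ B i j ⟧ (x≤y j))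

    ⊙-const : ∀ c i → (B ⊙ (λ _ → c)) i ≡ deg i * c
    ⊙-const c i = sym (∑-*ʳ c (λ j → ⟦ B i j ⟧))

    ⊙-+ : ∀ x y i → (B ⊙ (λ j → x j + y j)) i ≡ (B ⊙ x) i + (B ⊙ y) i
    ⊙-+ x y i = trans (∑-cong λ j → *-distribˡ-+ ⟦ B i j ⟧ (x j) (y j))
                      (∑-+ (λ j → ⟦ B i j ⟧ * x j) (λ j → ⟦ B i j ⟧ * y j))

    ⊙-*ˡ : ∀ c x i → c * (B ⊙ x) i ≡ (B ⊙ (λ j → c * x j)) i
    ⊙-*ˡ c x i = trans (∑-*ˡ c (λ j → ⟦ B i j ⟧ * x j))
      (∑-cong λ j → solve 3 (λ c b x → c :* (b :* x) := b :* (c :* x)) refl c ⟦ B i j ⟧ (x j))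

    ∑⊙ : (∀ i j → B i j ≡ B j i) → ∀ x → ∑ (B ⊙ x) ≡ ∑ (λ j → deg j * x j)
    ∑⊙ B-sym x = trans (∑-swap (λ i j → ⟦ B i j ⟧ * x j))
      (∑-cong λ j → trans (sym (∑-*ʳ (x j) (λ i → ⟦ B i j ⟧)))
                          (cong (_* x j) (∑-cong λ i → cong ⟦_⟧ (B-sym i j))))

-- The Perron eigenpair of a hub graph

module HubEigenpair where

  open import Data.Rational.Base hiding (_≃_)
  open import Data.Rational.Properties
  open RationalSums
  open Subinvariance
  open EigenvalueApproximation
  open GeometricSequences
  open HubGraphs

  -- The eigenvector of the hub graph over B, normalised to 1 at the hub, is
  -- y = (1 + g) / p on the other vertices, where g = B y.  The eigenvalue p solves
  -- p = ∑ y, and the Babylonian step p ↦ (p + ∑ y) / 2 makes the joint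
  -- iteration for p and g a contraction.
  module Eigenpair {m} (B : Fin m → Fin m → Bool) (B-sym : ∀ i j → B i j ≡ B j i)
    (deg≤2 : ∀ i → Degrees.deg B i ≤ fromℕ 2)
    (8W₁≤m : fromℕ 8 * Degrees.W₁ B ≤ fromℕ m) (16≤m : fromℕ 16 ≤ fromℕ m)
    where

    open Degrees B

    M : ℚ
    M = fromℕ m

    private
      1≤M : 1ℚ ≤ M
      1≤M = ≤-trans (fromℕ-mono-≤ {1} {16} (ℕ.s≤s ℕ.z≤n)) 16≤m

      0≤M : 0ℚ ≤ M
      0≤M = 0≤fromℕ m

    State : Set
    State = ℚ × (Fin m → ℚ)

    private
      entry : State → Fin m → ℚ
      entry (p , g) i = (1ℚ + g i) * recip p

    step : State → State
    step s@(p , g) = ½ * (p + ∑ (entry s)) , B ⊙ entry s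

    -- The bounds sustain each other: M ≤ p² and M ≥ 16 give p ≥ 4, hence y ≤ ½, and degrees at most
    -- 2 then give g ≤ 1 at the next state.
    record Inv (s : State) : Set where
      field
        M≤p² : M ≤ proj₁ s * proj₁ s
        0≤p  : 0ℚ ≤ proj₁ s
        p≤M  : proj₁ s ≤ M
        0≤g  : ∀ i → 0ℚ ≤ proj₂ s i
        g≤1  : ∀ i → proj₂ s i ≤ 1ℚ

      4≤p : fromℕ 4 ≤ proj₁ s
      4≤p = square-cancel-≤ 0≤p (≤-trans 16≤m M≤p²)

      0<p : 0ℚ < proj₁ s
      0<p = <-≤-trans (0<1+ 3) 4≤p

      pv : proj₁ s * recip (proj₁ s) ≡ 1ℚ
      pv = *-recip 0<p

      0≤v : 0ℚ ≤ recip (proj₁ s)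
      0≤v = 0≤recip 0<p

      v≤¼ : recip (proj₁ s) ≤ ¼
      v≤¼ = *-cancelˡ (0<1+ 3) (≤-trans (*-monoʳ 0≤v 4≤p) (≤-reflexive pv))

      0≤1+g : ∀ i → 0ℚ ≤ 1ℚ + proj₂ s i
      0≤1+g i = nonNegative⁻¹ 1ℚ ⊕ 0≤g i

      1+g≤2 : ∀ i → 1ℚ + proj₂ s i ≤ fromℕ 2
      1+g≤2 i = +-monoʳ-≤ 1ℚ (g≤1 i)

      0≤y : ∀ i → 0ℚ ≤ entry s i
      0≤y i = 0≤1+g i ⊗ 0≤v

      y≤½ : ∀ i → entry s i ≤ ½
      y≤½ i = *-mono (0≤fromℕ 2) 0≤v (1+g≤2 i) v≤¼

      0≤∑g : 0ℚ ≤ ∑ (proj₂ s)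
      0≤∑g = 0≤∑ 0≤g

      ∑g≤M : ∑ (proj₂ s) ≤ M
      ∑g≤M = ≤-trans (∑-mono g≤1) (≤-reflexive (trans (∑-const m 1ℚ) (*-identityʳ M)))

      ∑y : ∑ (entry s) ≡ (M + ∑ (proj₂ s)) * recip (proj₁ s)
      ∑y = trans (sym (∑-*ʳ (recip (proj₁ s)) (λ i → 1ℚ + proj₂ s i)))
        (cong (_* recip (proj₁ s)) (trans (∑-+ (λ _ → 1ℚ) (proj₂ s))
          (cong (_+ ∑ (proj₂ s)) (trans (∑-const m 1ℚ) (*-identityʳ M)))))

    step-Inv : ∀ s → Inv s → Inv (step s)
    step-Inv s@(p , g) inv = record
      -- Arithmetic against geometric mean: the square of ½ (p + M / p) is already at least M, and ∑
      -- y ≥ M / p.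
      { M≤p² = ≤-trans
          (≤-by (trans (solve 3 (λ p v M → con ½ :* (p :+ M :* v) :* (con ½ :* (p :+ M :* v))
                           := (M :* (p :* v)) :+ con ¼ :* ((p :- M :* v) :* (p :- M :* v)))
                         refl p v M)
                       (cong (λ u → u + ¼ * ((p - M * v) * (p - M * v))) (trans (cong (M *_) pv) (*-identityʳ M))))
                (nonNegative⁻¹ ¼ ⊗ 0≤square (p - M * v)))
          (*-mono 0≤p′ 0≤mid mid≤ mid≤)
      ; 0≤p = 0≤p′
      ; p≤M = ≤-trans (*-monoˡ (nonNegative⁻¹ ½) (+-mono-≤ p≤M (≤-trans (≤-reflexive ∑y)
                (*-mono (0≤M ⊕ 0≤M) 0≤v (+-monoʳ-≤ M ∑g≤M) v≤¼))))
              (≤-by (solve 1 (λ M → M := con ½ :* (M :+ (M :+ M) :* con ¼) :+ con ¼ :* M) refl M)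
                    (nonNegative⁻¹ ¼ ⊗ 0≤M))
      ; 0≤g = λ i → 0≤∑ (λ j → 0≤⟦ B i j ⟧ ⊗ 0≤y j)
      ; g≤1 = λ i → ≤-trans (⊙-mono y≤½ i) (≤-trans (≤-reflexive (⊙-const ½ i)) (*-monoʳ (nonNegative⁻¹ ½) (deg≤2 i)))
      }
      where
      open Inv inv
      v : ℚ
      v = recip p
      0≤mid : 0ℚ ≤ ½ * (p + M * v)
      0≤mid = nonNegative⁻¹ ½ ⊗ (0≤p ⊕ 0≤M ⊗ 0≤v)
      mid≤ : ½ * (p + M * v) ≤ ½ * (p + ∑ (entry s))
      mid≤ = *-monoˡ (nonNegative⁻¹ ½) (+-monoʳ-≤ p (≤-trans
        (≤-by (*-distribʳ-+ v M (∑ g)) (0≤∑g ⊗ 0≤v)) (≤-reflexive (sym ∑y))))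
      0≤p′ : 0ℚ ≤ ½ * (p + ∑ (entry s))
      0≤p′ = ≤-trans 0≤mid mid≤

    -- The ℓ¹ norm in g is chosen because summing |B x| over all vertices gives at most ∑ deg |x|,
    -- where a common change of all entries is weighted by the small number W₁.
    dist : State → State → ℚ
    dist (p , g) (p̃ , g̃) = ∣ p - p̃ ∣ + ∑ (λ i → ∣ g i - g̃ i ∣)

    module _ {s t : State} (invS : Inv s) (invT : Inv t) where
      private
        module S = Inv invS
        module T = Inv invT

        p = proj₁ s
        p̃ = proj₁ t
        g = proj₂ s
        g̃ = proj₂ t
        v = recip p
        ṽ = recip p̃

        δ γ : ℚ
        δ = ∣ p - p̃ ∣
        γ = ∑ (λ i → ∣ g i - g̃ i ∣)

        0≤δ : 0ℚ ≤ δ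
        0≤δ = 0≤∣p∣ (p - p̃)

        0≤γ : 0ℚ ≤ γ
        0≤γ = 0≤∑ (λ i → 0≤∣p∣ (g i - g̃ i))

        0≤vṽ : 0ℚ ≤ v * ṽ
        0≤vṽ = S.0≤v ⊗ T.0≤v

        v-ṽ : v - ṽ ≡ (p̃ - p) * (v * ṽ)
        v-ṽ = begin
          v - ṽ ≡⟨ solve 2 (λ v w → v :- w := v :* con 1ℚ :- w :* con 1ℚ) refl v ṽ ⟩
          v * 1ℚ - ṽ * 1ℚ ≡⟨ cong₂ (λ a b → v * a - ṽ * b) (sym T.pv) (sym S.pv) ⟩
          v * (p̃ * ṽ) - ṽ * (p * v) ≡⟨ solve 4 (λ p q v w → v :* (q :* w) :- w :* (p :* v) := (q :- p) :* (v :* w)) refl p p̃ v ṽ ⟩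
          (p̃ - p) * (v * ṽ) ∎
          where open ≡-Reasoning

        M≤pp̃ : M ≤ p * p̃
        M≤pp̃ = square-cancel-≤ (S.0≤p ⊗ T.0≤p) (≤-trans (*-mono (0≤square p) 0≤M S.M≤p² T.M≤p²)
          (≤-reflexive (solve 2 (λ p q → p :* p :* (q :* q) := p :* q :* (p :* q)) refl p p̃)))

        Mvṽ≤1 : M * (v * ṽ) ≤ 1ℚ
        Mvṽ≤1 = ≤-trans (*-monoʳ 0≤vṽ M≤pp̃) (≤-reflexive (trans
          (solve 4 (λ p q v w → p :* q :* (v :* w) := (p :* v) :* (q :* w)) refl p p̃ v ṽ)
          (cong₂ _*_ S.pv T.pv)))

        r : ℚ
        r = (M + ∑ g) * (v * ṽ)

        -- ½ (1 - r) is the difference quotient of the Babylonian step in p. The undamped map p ↦ (M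
        -- + ∑ g) / p has quotient -r, about -1 near the fixed point, and would not contract.
        ∣1-r∣≤1 : ∣ 1ℚ - r ∣ ≤ 1ℚ
        ∣1-r∣≤1 = ∣-∣-≤
          (≤-by (solve 1 (λ r → con 1ℚ := con 1ℚ :- r :+ r) refl r) ((0≤M ⊕ S.0≤∑g) ⊗ 0≤vṽ))
          (≤-by (solve 1 (λ r → con 1ℚ := :- (con 1ℚ :- r) :+ (# 2 :- r)) refl r) (≤⇒0≤- r≤2))
          where
          r≤2 : r ≤ fromℕ 2
          r≤2 = ≤-trans (*-monoʳ 0≤vṽ (+-monoʳ-≤ M S.∑g≤M)) (≤-trans
            (≤-reflexive (solve 2 (λ M u → (M :+ M) :* u := # 2 :* (M :* u)) refl M (v * ṽ)))
            (*-monoˡ (0≤fromℕ 2) Mvṽ≤1))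

        ∑g-∑g̃≤γ : ∣ ∑ g - ∑ g̃ ∣ ≤ γ
        ∑g-∑g̃≤γ = subst (λ z → ∣ z ∣ ≤ γ)
          (trans (∑-+ g (λ i → - g̃ i)) (cong (∑ g +_) (∑-neg g̃)))
          (∣∑∣≤∑∣∣ (λ i → g i - g̃ i))

        entry-diff : ∀ i → ∣ entry s i - entry t i ∣ ≤ fromℕ 2 * (v * ṽ) * δ + ¼ * ∣ g i - g̃ i ∣
        entry-diff i = begin
          ∣ (1ℚ + g i) * v - (1ℚ + g̃ i) * ṽ ∣
            ≡⟨ cong ∣_∣ (solve 4 (λ g h v w → (con 1ℚ :+ g) :* v :- (con 1ℚ :+ h) :* w
                  := (con 1ℚ :+ g) :* (v :- w) :+ w :* (g :- h)) refl (g i) (g̃ i) v ṽ) ⟩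
          ∣ (1ℚ + g i) * (v - ṽ) + ṽ * (g i - g̃ i) ∣
            ≤⟨ ∣p+q∣≤∣p∣+∣q∣ ((1ℚ + g i) * (v - ṽ)) (ṽ * (g i - g̃ i)) ⟩
          ∣ (1ℚ + g i) * (v - ṽ) ∣ + ∣ ṽ * (g i - g̃ i) ∣
            ≡⟨ cong₂ _+_ (∣p*q∣≡∣p∣*∣q∣ (1ℚ + g i) (v - ṽ)) (∣p*q∣≡∣p∣*∣q∣ ṽ (g i - g̃ i)) ⟩
          ∣ 1ℚ + g i ∣ * ∣ v - ṽ ∣ + ∣ ṽ ∣ * ∣ g i - g̃ i ∣
            ≤⟨ +-mono-≤
                 (*-mono (0≤fromℕ 2) (0≤∣p∣ (v - ṽ)) (≤-trans (≤-reflexive (0≤p⇒∣p∣≡p (S.0≤1+g i))) (S.1+g≤2 i)) (≤-reflexive ∣v-ṽ∣))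
                 (*-monoʳ (0≤∣p∣ (g i - g̃ i)) (≤-trans (≤-reflexive (0≤p⇒∣p∣≡p T.0≤v)) T.v≤¼)) ⟩
          fromℕ 2 * (δ * (v * ṽ)) + ¼ * ∣ g i - g̃ i ∣
            ≡⟨ cong (_+ ¼ * ∣ g i - g̃ i ∣) (solve 2 (λ d u → # 2 :* (d :* u) := # 2 :* u :* d) refl δ (v * ṽ)) ⟩
          fromℕ 2 * (v * ṽ) * δ + ¼ * ∣ g i - g̃ i ∣ ∎
          where
          open ≤-Reasoning
          ∣v-ṽ∣ : ∣ v - ṽ ∣ ≡ δ * (v * ṽ)
          ∣v-ṽ∣ = trans (cong ∣_∣ v-ṽ) (trans (∣p*q∣≡∣p∣*∣q∣ (p̃ - p) (v * ṽ))
            (cong₂ _*_ (trans (cong ∣_∣ (solve 2 (λ p q → q :- p := :- (p :- q)) refl p p̃)) (∣-p∣≡∣p∣ (p - p̃)))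
                       (0≤p⇒∣p∣≡p 0≤vṽ)))

        2vṽ≤1 : fromℕ 2 * (v * ṽ) ≤ 1ℚ
        2vṽ≤1 = ≤-trans (*-monoˡ (0≤fromℕ 2) (*-mono (nonNegative⁻¹ ¼) T.0≤v S.v≤¼ T.v≤¼))
                        (≤-by {d = (fromℕ 7) * (¼ * ½)} refl (nonNegative⁻¹ (fromℕ 7 * (¼ * ½))))

        p-bound : ∣ proj₁ (step s) - proj₁ (step t) ∣ ≤ ½ * (δ + ¼ * γ)
        p-bound = begin
          ∣ ½ * (p + ∑ (entry s)) - ½ * (p̃ + ∑ (entry t)) ∣
            ≡⟨ cong₂ (λ a b → ∣ ½ * (p + a) - ½ * (p̃ + b) ∣) S.∑y T.∑y ⟩
          ∣ ½ * (p + (M + ∑ g) * v) - ½ * (p̃ + (M + ∑ g̃) * ṽ) ∣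
            ≡⟨ cong ∣_∣ (solve 7 (λ p q M G H v w →
                 con ½ :* (p :+ (M :+ G) :* v) :- con ½ :* (q :+ (M :+ H) :* w)
                 := con ½ :* ((p :- q) :+ ((M :+ G) :* (v :- w) :+ (G :- H) :* w))) refl p p̃ M (∑ g) (∑ g̃) v ṽ) ⟩
          ∣ ½ * ((p - p̃) + ((M + ∑ g) * (v - ṽ) + (∑ g - ∑ g̃) * ṽ)) ∣
            ≡⟨ cong (λ u → ∣ ½ * ((p - p̃) + ((M + ∑ g) * u + (∑ g - ∑ g̃) * ṽ)) ∣) v-ṽ ⟩
          ∣ ½ * ((p - p̃) + ((M + ∑ g) * ((p̃ - p) * (v * ṽ)) + (∑ g - ∑ g̃) * ṽ)) ∣
            ≡⟨ cong ∣_∣ (solve 6 (λ p q K D u w → con ½ :* ((p :- q) :+ (K :* ((q :- p) :* u) :+ D :* w))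
                 := con ½ :* ((p :- q) :* (con 1ℚ :- K :* u) :+ D :* w)) refl p p̃ (M + ∑ g) (∑ g - ∑ g̃) (v * ṽ) ṽ) ⟩
          ∣ ½ * ((p - p̃) * (1ℚ - r) + (∑ g - ∑ g̃) * ṽ) ∣
            ≡⟨ ∣p*q∣≡∣p∣*∣q∣ ½ ((p - p̃) * (1ℚ - r) + (∑ g - ∑ g̃) * ṽ) ⟩
          ½ * ∣ (p - p̃) * (1ℚ - r) + (∑ g - ∑ g̃) * ṽ ∣
            ≤⟨ *-monoˡ (nonNegative⁻¹ ½) (≤-trans (∣p+q∣≤∣p∣+∣q∣ ((p - p̃) * (1ℚ - r)) ((∑ g - ∑ g̃) * ṽ))
                 (≤-reflexive (cong₂ _+_ (∣p*q∣≡∣p∣*∣q∣ (p - p̃) (1ℚ - r)) (∣p*q∣≡∣p∣*∣q∣ (∑ g - ∑ g̃) ṽ)))) ⟩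
          ½ * (δ * ∣ 1ℚ - r ∣ + ∣ ∑ g - ∑ g̃ ∣ * ∣ ṽ ∣)
            ≤⟨ *-monoˡ (nonNegative⁻¹ ½) (+-mono-≤
                 (≤-trans (*-monoˡ 0≤δ ∣1-r∣≤1) (≤-reflexive (*-identityʳ δ)))
                 (≤-trans (*-mono 0≤γ (0≤∣p∣ ṽ) ∑g-∑g̃≤γ (≤-trans (≤-reflexive (0≤p⇒∣p∣≡p T.0≤v)) T.v≤¼)) (≤-reflexive (*-comm γ ¼)))) ⟩
          ½ * (δ + ¼ * γ) ∎
          where open ≤-Reasoning

        -- The coefficient of δ is W₁ · 2 v ṽ ≤ ¼, from 8 W₁ ≤ M and M v ṽ ≤ 1. That of γ is a
        -- degree of at most 2 times ¼.
        entries : ∑ (λ j → deg j * ∣ entry s j - entry t j ∣) ≤ ¼ * δ + ½ * γ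
        entries = begin
          ∑ (λ j → deg j * ∣ entry s j - entry t j ∣)
            ≤⟨ ∑-mono (λ j → ≤-trans (*-monoˡ (0≤deg j) (entry-diff j)) (split j)) ⟩
          ∑ (λ j → deg j * (fromℕ 2 * (v * ṽ) * δ) + ½ * ∣ g j - g̃ j ∣)
            ≡⟨ trans (∑-+ (λ j → deg j * (fromℕ 2 * (v * ṽ) * δ)) _)
                 (cong₂ _+_ (sym (∑-*ʳ (fromℕ 2 * (v * ṽ) * δ) deg)) (sym (∑-*ˡ ½ (λ j → ∣ g j - g̃ j ∣)))) ⟩
          W₁ * (fromℕ 2 * (v * ṽ) * δ) + ½ * γ
            ≤⟨ +-monoˡ-≤ (½ * γ) (≤-trans
                 (≤-reflexive (solve 3 (λ w u d → w :* (# 2 :* u :* d) := con ¼ :* (# 8 :* w :* u) :* d) refl W₁ (v * ṽ) δ))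
                 (*-monoʳ 0≤δ (*-monoˡ (nonNegative⁻¹ ¼) (≤-trans (*-monoʳ 0≤vṽ 8W₁≤m) Mvṽ≤1)))) ⟩
          ¼ * 1ℚ * δ + ½ * γ ∎
          where
          open ≤-Reasoning
          split : ∀ j → deg j * (fromℕ 2 * (v * ṽ) * δ + ¼ * ∣ g j - g̃ j ∣) ≤ deg j * (fromℕ 2 * (v * ṽ) * δ) + ½ * ∣ g j - g̃ j ∣
          split j = ≤-trans (≤-reflexive (*-distribˡ-+ (deg j) (fromℕ 2 * (v * ṽ) * δ) _))
            (+-monoʳ-≤ (deg j * (fromℕ 2 * (v * ṽ) * δ)) (≤-trans
              (*-monoʳ (nonNegative⁻¹ ¼ ⊗ 0≤∣p∣ (g j - g̃ j)) (deg≤2 j))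
              (≤-reflexive (solve 1 (λ x → # 2 :* (con ¼ :* x) := con ½ :* x) refl (∣ g j - g̃ j ∣)))))

        g-bound : ∑ (λ i → ∣ proj₂ (step s) i - proj₂ (step t) i ∣) ≤ ¼ * δ + ½ * γ
        g-bound = ≤-trans (∑-mono λ i → ≤-trans
            (≤-reflexive (cong ∣_∣ (diff i)))
            (∣⊙∣ B (λ j → entry s j - entry t j) i))
          (≤-trans (≤-reflexive (∑⊙ B-sym (λ j → ∣ entry s j - entry t j ∣))) entries)
          where
          diff : ∀ i → (B ⊙ entry s) i - (B ⊙ entry t) i ≡ (B ⊙ (λ j → entry s j - entry t j)) i
          diff i = sym (trans (⊙-+ (entry s) (λ j → - entry t j) i)
            (cong ((B ⊙ entry s) i +_) (trans (∑-cong λ j → sym (neg-distribʳ-* ⟦ B i j ⟧ (entry t j))) (∑-neg (λ j → ⟦ B i j ⟧ * entry t j)))))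

      -- The two components add up to ½ + ¼ = ¾ for δ and to ⅛ + ½ < ¾ for γ.
      contraction : dist (step s) (step t) ≤ ¾ * dist s t
      contraction = ≤-trans (+-mono-≤ p-bound g-bound)
        (≤-by (solve 2 (λ d c → con ¾ :* (d :+ c) := con ½ :* (d :+ con ¼ :* c) :+ (con ¼ :* d :+ con ½ :* c) :+ con ¼ :* con ½ :* c) refl δ γ)
              (nonNegative⁻¹ (¼ * ½) ⊗ 0≤γ))

      entry-close : ∀ i → ∣ entry s i - entry t i ∣ ≤ dist s t
      entry-close i = ≤-trans (entry-diff i) (+-mono-≤
        (≤-trans (*-monoʳ 0≤δ 2vṽ≤1) (≤-reflexive (*-identityˡ δ)))
        (≤-trans (*-monoʳ {p = ¼} {1ℚ} (0≤∣p∣ (g i - g̃ i)) (≤-by {d = ¾} refl (nonNegative⁻¹ ¾)))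
          (≤-trans (≤-reflexive (*-identityˡ _)) (term≤∑ (λ i → 0≤∣p∣ (g i - g̃ i)) i))))

    orbit : ℕ → State
    orbit zero    = M , λ _ → 0ℚ
    orbit (suc k) = step (orbit k)

    orbit-Inv : ∀ k → Inv (orbit k)
    orbit-Inv zero = record
      { M≤p² = ≤-trans (≤-reflexive (sym (*-identityʳ M))) (*-monoˡ 0≤M 1≤M)
      ; 0≤p  = 0≤M
      ; p≤M  = ≤-refl
      ; 0≤g  = λ _ → ≤-refl
      ; g≤1  = λ _ → nonNegative⁻¹ 1ℚ
      }
    orbit-Inv (suc k) = step-Inv (orbit k) (orbit-Inv k)

    E : ℚ
    E = dist (orbit 1) (orbit 0)

    0≤E : 0ℚ ≤ E
    0≤E = 0≤∣p∣ (proj₁ (orbit 1) - proj₁ (orbit 0))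
      ⊕ 0≤∑ (λ i → 0≤∣p∣ (proj₂ (orbit 1) i - proj₂ (orbit 0) i))

    gap : ∀ k → dist (orbit (suc k)) (orbit k) ≤ E * decay k
    gap zero    = ≤-reflexive (sym (*-identityʳ E))
    gap (suc k) = ≤-trans (contraction (orbit-Inv (suc k)) (orbit-Inv k))
      (≤-trans (*-monoˡ (nonNegative⁻¹ ¾) (gap k))
        (≤-reflexive (solve 2 (λ e d → con ¾ :* (e :* d) := e :* (con ¾ :* d)) refl E (decay k))))

    P : ℕ → ℚ
    P k = proj₁ (orbit k)

    g : ℕ → Fin m → ℚ
    g k = proj₂ (orbit k)

    y : ℕ → Fin m → ℚ
    y k = entry (orbit k)

    module Orbit k = Inv (orbit-Inv k)

    P-gap : ∀ k → ∣ P (suc k) - P k ∣ ≤ E * decay k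
    P-gap k = ≤-trans (≤-by refl (0≤∑ (λ i → 0≤∣p∣ (g (suc k) i - g k i)))) (gap k)

    ∑g-gap : ∀ k → ∑ (λ i → ∣ g (suc k) i - g k i ∣) ≤ E * decay k
    ∑g-gap k = ≤-trans (≤-by (+-comm (∣ P (suc k) - P k ∣) _) (0≤∣p∣ (P (suc k) - P k))) (gap k)

    y-gap : ∀ k i → ∣ y (suc k) i - y k i ∣ ≤ E * decay k
    y-gap k i = ≤-trans (entry-close (orbit-Inv (suc k)) (orbit-Inv k) i) (gap k)

    Py : ∀ k i → P k * y k i ≡ 1ℚ + g k i
    Py k i = trans (solve 3 (λ p v h → p :* (h :* v) := h :* (p :* v)) refl (P k) (recip (P k)) (1ℚ + g k i))
      (trans (cong ((1ℚ + g k i) *_) (Orbit.pv k)) (*-identityʳ _))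

    ∑y≡ : ∀ k → ∑ (y k) ≡ fromℕ 2 * P (suc k) - P k
    ∑y≡ k = solve 2 (λ p s → s := # 2 :* (con ½ :* (p :+ s)) :- p) refl (P k) (∑ (y k))

    ρ : ℝ
    ρ = mkℝ P (geometric⇒cauchy P E 0≤E P-gap)

    Y : Fin m → ℝ
    Y i = mkℝ (λ k → y k i) (geometric⇒cauchy (λ k → y k i) E 0≤E (λ k → y-gap k i))

    private
      z : ℕ → Fin (suc m) → ℚ
      z k = cons 1ℚ (y k)

      hub-eq : ∀ k → ∣ ∑ (y k) - P k ∣ ≤ fromℕ 2 * E * decay k
      hub-eq k = begin
        ∣ ∑ (y k) - P k ∣ ≡⟨ cong (λ s → ∣ s - P k ∣) (∑y≡ k) ⟩
        ∣ fromℕ 2 * P (suc k) - P k - P k ∣ ≡⟨ cong ∣_∣ (solve 2 (λ p q → # 2 :* q :- p :- p := # 2 :* (q :- p)) refl (P k) (P (suc k))) ⟩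
        ∣ fromℕ 2 * (P (suc k) - P k) ∣ ≡⟨ ∣p*q∣≡∣p∣*∣q∣ (fromℕ 2) (P (suc k) - P k) ⟩
        fromℕ 2 * ∣ P (suc k) - P k ∣ ≤⟨ *-monoˡ (0≤fromℕ 2) (P-gap k) ⟩
        fromℕ 2 * (E * decay k) ≡⟨ sym (*-assoc (fromℕ 2) E (decay k)) ⟩
        fromℕ 2 * E * decay k ∎
        where open ≤-Reasoning

      path-eq : ∀ k i → ∣ (1ℚ + g (suc k) i) - P k * y k i ∣ ≤ fromℕ 2 * E * decay k
      path-eq k i = begin
        ∣ (1ℚ + g (suc k) i) - P k * y k i ∣ ≡⟨ cong (λ s → ∣ (1ℚ + g (suc k) i) - s ∣) (Py k i) ⟩
        ∣ (1ℚ + g (suc k) i) - (1ℚ + g k i) ∣ ≡⟨ cong ∣_∣ (solve 2 (λ a b → (con 1ℚ :+ a) :- (con 1ℚ :+ b) := a :- b) refl (g (suc k) i) (g k i)) ⟩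
        ∣ g (suc k) i - g k i ∣ ≤⟨ ≤-trans (term≤∑ (λ i → 0≤∣p∣ (g (suc k) i - g k i)) i) (∑g-gap k) ⟩
        E * decay k ≤⟨ ≤-by (solve 2 (λ e d → # 2 :* e :* d := e :* d :+ e :* d) refl E (decay k)) (0≤E ⊗ 0≤decay k) ⟩
        fromℕ 2 * E * decay k ∎
        where open ≤-Reasoning

      z-eq : ∀ k i → ∣ (hubAdj B ⊙ z k) i - P k * z k i ∣ ≤ fromℕ 2 * E * decay k
      z-eq k zero    = subst (_≤ fromℕ 2 * E * decay k)
        (cong₂ (λ a b → ∣ a - b ∣) (sym (hub-⊙-zero B (z k))) (sym (*-identityʳ (P k)))) (hub-eq k)
      z-eq k (suc i) = subst (_≤ fromℕ 2 * E * decay k)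
        (cong (λ a → ∣ a - P k * y k i ∣) (sym (hub-⊙-suc B (z k) i))) (path-eq k i)

      zʳ : Fin (suc m) → ℝ
      zʳ zero    = 1ᵣ
      zʳ (suc i) = Y i

      zᶜ : Fin (suc m) → ℂ
      zᶜ i = zʳ i +i 0ᵣ

      seq-z : ∀ i k → seq (zʳ i) k ≡ z k i
      seq-z zero    k = refl
      seq-z (suc i) k = refl

      0≤2E : 0ℚ ≤ fromℕ 2 * E
      0≤2E = 0≤fromℕ 2 ⊗ 0≤E

      pointwise⇒≃ : ∀ x y → (∀ k → seq x k ≡ seq y k) → x ≃ᵣ y
      pointwise⇒≃ x y eq ε 0<ε = 0 , λ k _ → subst (_≤ ε)
        (sym (trans (cong (λ a → ∣ a - seq y k ∣) (eq k)) (cong ∣_∣ (+-inverseʳ (seq y k))))) (<⇒≤ 0<ε)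

    isEigenvalue : IsEigenvalue (λ i j → bitᶜ (hubAdj B i j)) (ρ +i 0ᵣ)
    isEigenvalue = zᶜ , (zero , inj₁ (inj₂ (1ℚ , positive⁻¹ 1ℚ , 0 , λ _ _ → ≤-refl))) , λ i →
        geometric⇒≃ (re (Az i)) (re (λz i)) (fromℕ 2 * E) 0≤2E (λ k → subst (_≤ fromℕ 2 * E * decay k)
          (cong₂ (λ a b → ∣ a - b ∣)
            (sym (trans (seq-re-⊙ (hubAdj B) zᶜ i k) (∑-cong λ j → cong (⟦ hubAdj B i j ⟧ *_) (seq-z j k))))
            (trans (solve 2 (λ p z → p :* z := p :* z :- con 0ℚ :* con 0ℚ) refl (P k) (z k i)) (cong (λ u → P k * u - 0ℚ * 0ℚ) (sym (seq-z i k)))))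
          (z-eq k i))
      , pointwise⇒≃ (im (Az i)) (im (λz i)) (λ k → trans (seq-im-⊙ (hubAdj B) zᶜ i k)
          (trans (∑-cong λ j → *-zeroʳ ⟦ hubAdj B i j ⟧)
          (trans (∑-const (suc m) 0ℚ) (trans (*-zeroʳ (fromℕ (suc m)))
            (solve 2 (λ p z → con 0ℚ := p :* con 0ℚ :+ con 0ℚ :* z) refl (P k) (seq (zʳ i) k))))))
      where
      Az λz : Fin (suc m) → ℂ
      Az = (λ i j → bitᶜ (hubAdj B i j)) · zᶜ
      λz i = (ρ +i 0ᵣ) *ᶜ zᶜ i

    isModulus : IsModulus ρ (ρ +i 0ᵣ)
    isModulus = (λ ε 0<ε → 0 , λ k _ → ≤-trans (Orbit.0≤p k) (≤-by refl (<⇒≤ 0<ε))) ,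
      pointwise⇒≃ (ρ *ᵣ ρ) (ρ *ᵣ ρ +ᵣ 0ᵣ *ᵣ 0ᵣ) (λ k → solve 1 (λ p → p :* p := p :* p :+ con 0ℚ :* con 0ℚ) refl (P k))

    -- Perron's argument. Pairing x with the positive approximate eigenvector z and moving the
    -- matrix across by symmetry gives q S ≤ P S + N (η + ε) for S = ⟨z, x⟩. Every entry of z is at
    -- least 1 / P and x attains 1, so S ≥ 1 / P, and dividing by S costs at most the factor P ≤ M.
    subEigen≤ : ∀ {q ε} → 0ℚ ≤ ε → SubEigen (hubAdj B) q ε → ∀ k →
      -- The negated claim supplies `P k ≤ q`, so that `v ≤ S` may be multiplied by `q - P k`.
      q ≤ P k + M * fromℕ (suc m) * (fromℕ 2 * E * decay k + ε)
    subEigen≤ {q} {ε} 0≤ε se k = ≮⇒≥ λ over → <-irrefl refl (<-≤-trans over (from-over (q-pos over)))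
      where
      open SubEigen se
      open ≤-Reasoning
      N η S v : ℚ
      N = fromℕ (suc m)
      η = fromℕ 2 * E * decay k
      v = recip (P k)
      S = ∑ (λ i → z k i * x i)
      0≤η : 0ℚ ≤ η
      0≤η = 0≤2E ⊗ 0≤decay k
      0≤z : ∀ i → 0ℚ ≤ z k i
      0≤z zero    = nonNegative⁻¹ 1ℚ
      0≤z (suc i) = Orbit.0≤y k i
      z≤1 : ∀ i → z k i ≤ 1ℚ
      z≤1 zero    = ≤-refl
      z≤1 (suc i) = ≤-trans (Orbit.y≤½ k i) (≤-by {d = ½} refl (nonNegative⁻¹ ½))
      v≤z : ∀ i → v ≤ z k i
      v≤z zero    = ≤-trans (Orbit.v≤¼ k) (≤-by {d = ¾} refl (nonNegative⁻¹ ¾))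
      v≤z (suc i) = ≤-by (solve 2 (λ v g → (con 1ℚ :+ g) :* v := v :+ g :* v) refl v (g k i)) (Orbit.0≤g k i ⊗ Orbit.0≤v k)
      v≤S : v ≤ S
      v≤S = ≤-trans (v≤z top) (≤-trans (≤-reflexive (sym (trans (cong (z k top *_) x-top) (*-identityʳ (z k top)))))
        (term≤∑ (λ i → 0≤z i ⊗ 0≤x i) top))
      qS≤ : q * S ≤ P k * S + N * (η + ε)
      qS≤ = begin
        q * S
          ≡⟨ trans (∑-*ˡ q _) (∑-cong λ i → solve 3 (λ q z x → q :* (z :* x) := z :* (q :* x)) refl q (z k i) (x i)) ⟩
        ∑ (λ i → z k i * (q * x i))
          ≤⟨ ∑-mono (λ i → ≤-trans (*-monoˡ (0≤z i) (sub i)) (≤-trans (≤-reflexive (*-distribˡ-+ (z k i) _ ε))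
               (+-monoʳ-≤ (z k i * (hubAdj B ⊙ x) i) (≤-trans (*-monoʳ 0≤ε (z≤1 i)) (≤-reflexive (*-identityˡ ε)))))) ⟩
        ∑ (λ i → z k i * (hubAdj B ⊙ x) i + ε)
          ≡⟨ trans (∑-+ (λ i → z k i * (hubAdj B ⊙ x) i) (λ _ → ε)) (cong₂ _+_ (⊙-symmetric (hubAdj B) (hubAdj-sym B-sym) x (z k)) (∑-const (suc m) ε)) ⟩
        ∑ (λ i → x i * (hubAdj B ⊙ z k) i) + N * ε
          ≤⟨ +-monoˡ-≤ (N * ε) (∑-mono (λ i → ≤-trans (*-monoˡ (0≤x i)
               (≤-trans (≤-reflexive (solve 2 (λ a b → a := b :+ (a :- b)) refl ((hubAdj B ⊙ z k) i) (P k * z k i)))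
                        (+-monoʳ-≤ (P k * z k i) (≤-trans (p≤∣p∣ _) (z-eq k i)))))
               (≤-trans (≤-reflexive (solve 4 (λ x p z h → x :* (p :* z :+ h) := p :* (z :* x) :+ x :* h) refl (x i) (P k) (z k i) η))
                 (+-monoʳ-≤ (P k * (z k i * x i)) (≤-trans (*-monoʳ 0≤η (x≤1 i)) (≤-reflexive (*-identityˡ η))))))) ⟩
        ∑ (λ i → P k * (z k i * x i) + η) + N * ε
          ≡⟨ cong (_+ N * ε) (trans (∑-+ (λ i → P k * (z k i * x i)) (λ _ → η)) (cong₂ _+_ (sym (∑-*ˡ (P k) _)) (∑-const (suc m) η))) ⟩
        P k * S + N * η + N * ε
          ≡⟨ solve 4 (λ a n h e → a :+ n :* h :+ n :* e := a :+ n :* (h :+ e)) refl (P k * S) N η ε ⟩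
        P k * S + N * (η + ε) ∎
      q-pos : P k + M * N * (η + ε) < q → P k ≤ q
      q-pos over = ≤-trans (≤-by refl ((0≤M ⊗ 0≤fromℕ (suc m)) ⊗ (0≤η ⊕ 0≤ε))) (<⇒≤ over)
      from-over : P k ≤ q → q ≤ P k + M * N * (η + ε)
      from-over P≤q = begin
        q
          ≡⟨ trans (solve 2 (λ p q → q := p :+ con 1ℚ :* (q :- p)) refl (P k) q) (cong (λ u → P k + u * (q - P k)) (sym (Orbit.pv k))) ⟩
        P k + P k * v * (q - P k)
          ≤⟨ +-monoʳ-≤ (P k) (≤-trans (≤-reflexive (*-assoc (P k) v (q - P k))) (*-mono 0≤M (Orbit.0≤v k ⊗ ≤⇒0≤- P≤q) (Orbit.p≤M k)
               (≤-trans (*-monoʳ (≤⇒0≤- P≤q) v≤S) (≤-by {d = P k * S + N * (η + ε) - q * S} (solve 4 (λ p q s b → b := s :* (q :- p) :+ (p :* s :+ b :- q :* s)) refl (P k) q S (N * (η + ε))) (≤⇒0≤- qS≤))))) ⟩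
        P k + M * (N * (η + ε))
          ≡⟨ cong (P k +_) (sym (*-assoc M N (η + ε))) ⟩
        P k + M * N * (η + ε) ∎

    -- Not the characteristic polynomial. It is the defect left when p y = 1 + B y is substituted
    -- repeatedly into p = ∑ y and walks with three or more forest edges are dropped.
    charpoly : ℚ → ℚ
    charpoly p = p * p * p * p - M * (p * p) - W₁ * p - W₂

    -- At the exact eigenpair p² = M + H, p H = W₁ + K and p K ≥ W₂, for H = ∑ deg y and K = ∑ deg
    -- g, so the polynomial is nonnegative. At stage k the lag between consecutive states spoils
    -- this by at most (2 p³ + p² + 2 p) d ≤ 5 M³ d.
    charpoly-P : ∀ k → - (fromℕ 5 * (M * M * M) * (E * decay k)) ≤ charpoly (P k)
    charpoly-P k = ≤-trans (neg-antimono-≤ error≤) (≤-by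
      (trans (solve 9 (λ p M w₁ w₂ G H K K′ d →
          p :* p :* p :* p :- M :* (p :* p) :- w₁ :* p :- w₂
          := (:- ((# 2 :* (p :* p :* p) :+ p :* p :+ # 2 :* p) :* d)
              :+ (p :* p :* (p :* p :- (M :+ G :- # 2 :* p :* d)) :+ p :* p :* (G :- (H :- d))
                  :+ p :* (K :- (K′ :- # 2 :* d)) :+ (p :* K′ :- w₂)))
             :+ p :* (p :* H :- (w₁ :+ K)))
          refl p M W₁ W₂ G H K K′ d)
        -- The summand p (p H - (W₁ + K)) of the identity is no error term: it vanishes by `pH≡`.
        (trans (cong (λ u → base + p * u) (trans (cong (_- (W₁ + K)) pH≡) (+-inverseʳ (W₁ + K))))
               (trans (cong (base +_) (*-zeroʳ p)) (+-identityʳ base))))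
      (((0≤square p ⊗ ≤⇒0≤- p²≥) ⊕ (0≤square p ⊗ ≤⇒0≤- G≥) ⊕ (Orbit.0≤p k ⊗ ≤⇒0≤- K≥)) ⊕ ≤⇒0≤- pK′≥))
      where
      p d G H K K′ base : ℚ
      p = P k
      d = E * decay k
      G = ∑ (g k)
      H = ∑ (λ j → deg j * y k j)
      K = ∑ (λ j → deg j * g k j)
      K′ = ∑ (λ j → deg j * g (suc k) j)
      base = - ((fromℕ 2 * (p * p * p) + p * p + fromℕ 2 * p) * d)
              + (p * p * (p * p - (M + G - fromℕ 2 * p * d)) + p * p * (G - (H - d))
                  + p * (K - (K′ - fromℕ 2 * d)) + (p * K′ - W₂))
      0≤d : 0ℚ ≤ d
      0≤d = 0≤E ⊗ 0≤decay k
      1≤p : 1ℚ ≤ p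
      1≤p = ≤-trans (fromℕ-mono-≤ {1} {4} (ℕ.s≤s ℕ.z≤n)) (Orbit.4≤p k)
      0≤p-1 : 0ℚ ≤ p - 1ℚ
      0≤p-1 = ≤⇒0≤- 1≤p
      error≤ : (fromℕ 2 * (p * p * p) + p * p + fromℕ 2 * p) * d ≤ fromℕ 5 * (M * M * M) * d
      error≤ = *-monoʳ 0≤d (≤-trans
        (≤-by {fromℕ 2 * (p * p * p) + p * p + fromℕ 2 * p} {fromℕ 5 * (p * p * p)} (solve 1 (λ p → # 5 :* (p :* p :* p) := (# 2 :* (p :* p :* p) :+ p :* p :+ # 2 :* p)
                 :+ (p :* p :* (p :- con 1ℚ) :+ # 2 :* p :* (p :- con 1ℚ) :* (p :+ con 1ℚ))) refl p)
              (0≤square p ⊗ 0≤p-1 ⊕ 0≤fromℕ 2 ⊗ Orbit.0≤p k ⊗ 0≤p-1 ⊗ (Orbit.0≤p k ⊕ nonNegative⁻¹ 1ℚ)))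
        (*-monoˡ (0≤fromℕ 5) (*-mono (0≤M ⊗ 0≤M) (Orbit.0≤p k)
          (*-mono 0≤M (Orbit.0≤p k) (Orbit.p≤M k) (Orbit.p≤M k)) (Orbit.p≤M k))))
      gap-abs : ∀ (c : Fin m → ℚ) b → 0ℚ ≤ b → (∀ i → 0ℚ ≤ c i) → (∀ i → c i ≤ b) →
        ∑ (λ i → c i * g (suc k) i) - b * d ≤ ∑ (λ i → c i * g k i)
      gap-abs c b 0≤b 0≤c c≤b = ≤-by {d = b * d - (∑ (λ i → c i * g (suc k) i) - ∑ (λ i → c i * g k i))}
        (solve 3 (λ x y e → y := x :- e :+ (e :- (x :- y))) refl (∑ (λ i → c i * g (suc k) i)) (∑ (λ i → c i * g k i)) (b * d))
        (≤⇒0≤- (begin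
          ∑ (λ i → c i * g (suc k) i) - ∑ (λ i → c i * g k i)
            ≡⟨ sym (trans (∑-+ (λ i → c i * g (suc k) i) (λ i → - (c i * g k i))) (cong (∑ (λ i → c i * g (suc k) i) +_) (∑-neg (λ i → c i * g k i)))) ⟩
          ∑ (λ i → c i * g (suc k) i + - (c i * g k i))
            ≤⟨ ∑-mono (λ i → ≤-trans (≤-reflexive (solve 3 (λ c a b → c :* a :+ :- (c :* b) := c :* (a :- b)) refl (c i) (g (suc k) i) (g k i)))
                 (≤-trans (*-monoˡ (0≤c i) (p≤∣p∣ (g (suc k) i - g k i))) (*-monoʳ (0≤∣p∣ (g (suc k) i - g k i)) (c≤b i)))) ⟩
          ∑ (λ i → b * ∣ g (suc k) i - g k i ∣)
            ≡⟨ sym (∑-*ˡ b (λ i → ∣ g (suc k) i - g k i ∣)) ⟩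
          b * ∑ (λ i → ∣ g (suc k) i - g k i ∣)
            ≤⟨ *-monoˡ 0≤b (∑g-gap k) ⟩
          b * d ∎))
        where open ≤-Reasoning
      p²≥ : M + G - fromℕ 2 * p * d ≤ p * p
      p²≥ = ≤-by {d = p * (fromℕ 2 * E * decay k - (∑ (y k) - p))}
        (trans (solve 4 (λ p s e d → p :* p := p :* s :- # 2 :* p :* (e :* d) :+ p :* (# 2 :* e :* d :- (s :- p))) refl p (∑ (y k)) E (decay k))
               (cong (λ u → u - fromℕ 2 * p * d + p * (fromℕ 2 * E * decay k - (∑ (y k) - p))) p∑y≡))
        (Orbit.0≤p k ⊗ ≤⇒0≤- (≤-trans (p≤∣p∣ _) (hub-eq k)))
        where
        p∑y≡ : p * ∑ (y k) ≡ M + G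
        p∑y≡ = trans (cong (p *_) (Orbit.∑y k)) (trans
          (solve 3 (λ p a v → p :* (a :* v) := a :* (p :* v)) refl p (M + G) (recip p))
          (trans (cong ((M + G) *_) (Orbit.pv k)) (*-identityʳ (M + G))))
      G≥ : H - d ≤ G
      G≥ = subst₂ _≤_
        (cong₂ _-_ (trans (∑-cong λ i → *-identityˡ (g (suc k) i)) (∑⊙ B-sym (y k))) (*-identityˡ d))
        (∑-cong λ i → *-identityˡ (g k i))
        (gap-abs (λ _ → 1ℚ) 1ℚ (nonNegative⁻¹ 1ℚ) (λ _ → nonNegative⁻¹ 1ℚ) (λ _ → ≤-refl))
      K≥ : K′ - fromℕ 2 * d ≤ K
      K≥ = gap-abs deg (fromℕ 2) (0≤fromℕ 2) 0≤deg deg≤2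
      pH≡ : p * H ≡ W₁ + K
      pH≡ = trans (∑-*ˡ p (λ j → deg j * y k j)) (trans
        (∑-cong λ j → trans (solve 3 (λ p h y → p :* (h :* y) := h :* (p :* y)) refl p (deg j) (y k j))
          (trans (cong (deg j *_) (Py k j)) (solve 2 (λ h g → h :* (con 1ℚ :+ g) := h :+ h :* g) refl (deg j) (g k j))))
        (∑-+ deg (λ j → deg j * g k j)))
      pK′≥ : W₂ ≤ p * K′
      pK′≥ = begin
        ∑ (λ i → deg i * deg i)
          ≤⟨ ∑-mono (λ i → *-monoˡ (0≤deg i) (≤-trans (≤-reflexive (trans (sym (*-identityʳ (deg i))) (sym (⊙-const 1ℚ i))))
               (≤-trans (⊙-mono (λ j → ≤-trans (≤-by refl (Orbit.0≤g k j)) (≤-reflexive (sym (Py k j)))) i) (≤-reflexive (sym (⊙-*ˡ p (y k) i)))))) ⟩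
        ∑ (λ i → deg i * (p * g (suc k) i))
          ≡⟨ trans (∑-cong λ i → solve 3 (λ h p g → h :* (p :* g) := p :* (h :* g)) refl (deg i) p (g (suc k) i)) (sym (∑-*ˡ p _)) ⟩
        p * K′ ∎
        where open ≤-Reasoning

-- Upper bound in the presence of a hub

module UpperBounds where

  open import Data.Rational.Base hiding (_≃_)
  open import Data.Rational.Properties
  open RationalSums
  open Subinvariance
  open EigenvalueApproximation
  open GeometricSequences
  open HubGraphs

  kronecker : ∀ {n} → Fin n → Fin n → ℚ
  kronecker i k = ⟦ does (i Fin.≟ k) ⟧

  ∑-kronecker : ∀ {n} (i : Fin n) (f : Fin n → ℚ) → ∑ (λ k → kronecker i k * f k) ≡ f i
  ∑-kronecker {suc n} zero f = trans (∑-suc (λ k → kronecker zero k * f k))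
    (trans (cong₂ _+_ (*-identityˡ (f zero))
      (trans (∑-cong λ k → *-zeroˡ (f (suc k))) (trans (∑-const n 0ℚ) (*-zeroʳ (fromℕ n)))))
      (+-identityʳ (f zero)))
  ∑-kronecker {suc n} (suc i) f = trans (∑-suc (λ k → kronecker (suc i) k * f k))
    (trans (cong₂ _+_ (*-zeroˡ (f zero)) (∑-kronecker i (λ k → f (suc k)))) (+-identityˡ (f (suc i))))

  bit*≤ : ∀ b {p} → 0ℚ ≤ p → ⟦ b ⟧ * p ≤ p
  bit*≤ b {p} 0≤p = ≤-trans (*-monoʳ 0≤p ⟦ b ⟧≤1) (≤-reflexive (*-identityˡ p))

  ⟦⟧-idem : ∀ b → ⟦ b ⟧ * ⟦ b ⟧ ≡ ⟦ b ⟧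
  ⟦⟧-idem true  = refl
  ⟦⟧-idem false = refl

  module _ {m} (B : Fin m → Fin m → Bool) (B-sym : ∀ i j → B i j ≡ B j i)
    (deg≤2 : ∀ i → Degrees.deg B i ≤ fromℕ 2)
    {q ε : ℚ} (se : SubEigen (hubAdj B) q ε) (0≤ε : 0ℚ ≤ ε) (ε≤1 : ε ≤ 1ℚ) (4<q : fromℕ 4 < q)
    where

    open Degrees B
    private
      open SubEigen se
      M : ℚ
      M = fromℕ m
      X gx : Fin m → ℚ
      X i = x (suc i)
      gx = B ⊙ X

      gx≤2 : ∀ i → gx i ≤ fromℕ 2
      gx≤2 i = ≤-trans (⊙-mono (λ j → x≤1 (suc j)) i)
        (≤-trans (≤-reflexive (trans (⊙-const 1ℚ i) (*-identityʳ (deg i)))) (deg≤2 i))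

      sub-suc : ∀ i → q * X i ≤ x zero + gx i + ε
      sub-suc i = ≤-trans (sub (suc i)) (≤-reflexive (cong (_+ ε) (hub-⊙-suc B x i)))

      -- At a forest vertex with entry 1 the hub contributes at most 1, the forest neighbours at
      -- most 2 and the error at most 1, against q > 4. Hence the maximum sits at the hub.
      top-zero : ∀ i → x i ≡ 1ℚ → x zero ≡ 1ℚ
      top-zero zero    x≡1 = x≡1
      top-zero (suc i) x≡1 = ⊥-elim (<-irrefl refl (<-≤-trans 4<q (begin
        q ≡⟨ sym (trans (cong (q *_) x≡1) (*-identityʳ q)) ⟩
        q * x (suc i) ≤⟨ sub-suc i ⟩
        x zero + gx i + ε ≤⟨ +-mono-≤ (+-mono-≤ (x≤1 zero) (gx≤2 i)) ε≤1 ⟩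
        1ℚ + fromℕ 2 + 1ℚ ≡⟨⟩
        fromℕ 4 ∎)))
        where open ≤-Reasoning

      x₀≡1 : x zero ≡ 1ℚ
      x₀≡1 = top-zero top x-top

      qX≤ : ∀ i → q * X i ≤ (1ℚ + ε) + gx i
      qX≤ i = ≤-trans (sub-suc i) (≤-reflexive (trans (cong (λ u → u + gx i + ε) x₀≡1)
        (solve 2 (λ g e → con 1ℚ :+ g :+ e := con 1ℚ :+ e :+ g) refl (gx i) ε)))

      q≤∑X : q ≤ ∑ X + ε
      q≤∑X = subst₂ _≤_ (trans (cong (q *_) x₀≡1) (*-identityʳ q)) (cong (_+ ε) (hub-⊙-zero B x)) (sub zero)

      weighted : (c : Fin m → ℚ) → (∀ i → 0ℚ ≤ c i) →
        q * ∑ (λ i → c i * X i) ≤ ∑ c * (1ℚ + ε) + ∑ (λ i → c i * gx i)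
      weighted c 0≤c = begin
        q * ∑ (λ i → c i * X i) ≡⟨ trans (∑-*ˡ q _) (∑-cong λ i → solve 3 (λ q c x → q :* (c :* x) := c :* (q :* x)) refl q (c i) (X i)) ⟩
        ∑ (λ i → c i * (q * X i)) ≤⟨ ∑-mono (λ i → ≤-trans (*-monoˡ (0≤c i) (qX≤ i)) (≤-reflexive (*-distribˡ-+ (c i) (1ℚ + ε) (gx i)))) ⟩
        ∑ (λ i → c i * (1ℚ + ε) + c i * gx i) ≡⟨ trans (∑-+ (λ i → c i * (1ℚ + ε)) _) (cong (_+ ∑ (λ i → c i * gx i)) (sym (∑-*ʳ (1ℚ + ε) c))) ⟩
        ∑ c * (1ℚ + ε) + ∑ (λ i → c i * gx i) ∎
        where open ≤-Reasoning

      H K L : ℚ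
      H = ∑ (λ i → deg i * X i)
      K = ∑ (λ i → (B ⊙ deg) i * X i)
      L = ∑ (λ i → (B ⊙ deg) i * gx i)

      0≤degdeg : ∀ i → 0ℚ ≤ (B ⊙ deg) i
      0≤degdeg i = 0≤∑ (λ j → 0≤⟦ B i j ⟧ ⊗ 0≤deg j)

      ∑degdeg : ∑ (B ⊙ deg) ≡ W₂
      ∑degdeg = ∑⊙ B-sym deg

      ∑1·_ : ∀ (f : Fin m → ℚ) → ∑ (λ i → 1ℚ * f i) ≡ ∑ f
      ∑1· f = ∑-cong λ i → *-identityˡ (f i)

      q∑X≤ : q * ∑ X ≤ M * (1ℚ + ε) + H
      q∑X≤ = subst₂ _≤_ (cong (q *_) (∑1· X))
        (cong₂ (λ a b → a * (1ℚ + ε) + b) (trans (∑-const m 1ℚ) (*-identityʳ M)) (trans (∑1· gx) (∑⊙ B-sym X)))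
        (weighted (λ _ → 1ℚ) (λ _ → nonNegative⁻¹ 1ℚ))

      qH≤ : q * H ≤ W₁ * (1ℚ + ε) + K
      qH≤ = subst (λ k → q * H ≤ W₁ * (1ℚ + ε) + k)
        (trans (⊙-symmetric B B-sym X deg) (∑-cong λ i → *-comm (X i) ((B ⊙ deg) i)))
        (weighted deg 0≤deg)

      qK≤ : q * K ≤ W₂ * (1ℚ + ε) + L
      qK≤ = subst (λ w → q * K ≤ w * (1ℚ + ε) + L) ∑degdeg (weighted (B ⊙ deg) 0≤degdeg)

      -- Spending q once more on the neighbours, where q X ≤ 4, gains the factor 1 / q that makes
      -- the remainder L of order W₂ / q.
      q·gx≤8 : ∀ i → q * gx i ≤ fromℕ 8
      q·gx≤8 i = begin
        q * gx i ≡⟨ ⊙-*ˡ q X i ⟩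
        (B ⊙ (λ j → q * X j)) i ≤⟨ ⊙-mono (λ j → ≤-trans (qX≤ j) (+-mono-≤ (+-monoʳ-≤ 1ℚ ε≤1) (gx≤2 j))) i ⟩
        (B ⊙ (λ _ → fromℕ 4)) i ≡⟨ ⊙-const (fromℕ 4) i ⟩
        deg i * fromℕ 4 ≤⟨ *-monoʳ (0≤fromℕ 4) (deg≤2 i) ⟩
        fromℕ 8 ∎
        where open ≤-Reasoning

      qL≤ : q * L ≤ fromℕ 8 * W₂
      qL≤ = begin
        q * L ≡⟨ trans (∑-*ˡ q _) (∑-cong λ i → solve 3 (λ q c x → q :* (c :* x) := c :* (q :* x)) refl q ((B ⊙ deg) i) (gx i)) ⟩
        ∑ (λ i → (B ⊙ deg) i * (q * gx i)) ≤⟨ ∑-mono (λ i → *-monoˡ (0≤degdeg i) (q·gx≤8 i)) ⟩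
        ∑ (λ i → (B ⊙ deg) i * fromℕ 8) ≡⟨ trans (sym (∑-*ʳ (fromℕ 8) (B ⊙ deg))) (trans (cong (_* fromℕ 8) ∑degdeg) (*-comm W₂ (fromℕ 8))) ⟩
        fromℕ 8 * W₂ ∎
        where open ≤-Reasoning

    -- Iterating q X ≤ 1 + ε + B X turns q³ ∑ X into walk counts; κ bounds the walks
    -- beyond those counted by W₂.
    charpoly-subEigen : ∀ {κ} → fromℕ 8 * W₂ ≤ q * κ →
      q * q * q * q - M * (q * q) - W₁ * q - W₂ ≤ κ + (W₂ + q * W₁ + q * q * (M + q)) * ε
    charpoly-subEigen {κ} 8W₂≤ = ≤-by
      (solve 10 (λ q M w₁ w₂ e s H K L κ →
        κ :+ (w₂ :+ q :* w₁ :+ q :* q :* (M :+ q)) :* e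
        := (q :* q :* q :* q :- M :* (q :* q) :- w₁ :* q :- w₂)
           :+ (q :* q :* q :* (s :+ e :- q) :+ q :* q :* (M :* (con 1ℚ :+ e) :+ H :- q :* s)
               :+ q :* (w₁ :* (con 1ℚ :+ e) :+ K :- q :* H) :+ (w₂ :* (con 1ℚ :+ e) :+ L :- q :* K) :+ (κ :- L)))
        refl q M W₁ W₂ ε (∑ X) H K L κ)
      (0≤q ⊗ 0≤q ⊗ 0≤q ⊗ ≤⇒0≤- q≤∑X ⊕ 0≤q ⊗ 0≤q ⊗ ≤⇒0≤- q∑X≤ ⊕ 0≤q ⊗ ≤⇒0≤- qH≤ ⊕ ≤⇒0≤- qK≤ ⊕ ≤⇒0≤- L≤κ)
      where
      L≤κ : L ≤ κ
      L≤κ = *-cancelˡ (<-trans (0<1+ 3) 4<q) (≤-trans qL≤ 8W₂≤)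

    q≤M+ε : q ≤ M + ε
    q≤M+ε = ≤-trans q≤∑X (+-monoˡ-≤ ε (≤-trans (∑-mono (λ i → x≤1 (suc i))) (≤-reflexive (trans (∑-const m 1ℚ) (*-identityʳ M)))))

  -- Upper bound in the absence of a hub

  1/100 : ℚ
  1/100 = (ℤ.+ 1) / 100

  module NoHub {m} (A : Fin (suc m) → Fin (suc m) → Bool) (A-sym : ∀ i j → A i j ≡ A j i)
    (A-irrefl : ∀ i → A i i ≡ false)
    (C : Fin (suc m) → Bool) (cover : ∀ i j → ⟦ A i j ⟧ ≤ ⟦ C i ⟧ + ⟦ C j ⟧)
    (t : ℚ) (1≤t : 1ℚ ≤ t) (∑C≤2t : ∑ (λ i → ⟦ C i ⟧) ≤ fromℕ 2 * t)
    (common≤2 : ∀ i j → i ≢ j → ∑ (λ k → ⟦ A i k ⟧ * ⟦ A j k ⟧) ≤ fromℕ 2)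
    (noHub : ∀ i → Degrees.deg A i ≤ fromℕ m - 1ℚ)
    (size : fromℕ 28 * ((t + 1ℚ) * (t + 1ℚ)) * (fromℕ 28 * ((t + 1ℚ) * (t + 1ℚ))) ≤ fromℕ m - ¼)
    {q ε : ℚ} (se : SubEigen A q ε) (0≤ε : 0ℚ ≤ ε) (ε≤ : (fromℕ (suc m) + fromℕ m) * ε ≤ 1/100) (ε≤1 : ε ≤ 1ℚ)
    where

    open Degrees A
    private
      open SubEigen se

      M R : ℚ
      M = fromℕ m
      R = fromℕ 28 * ((t + 1ℚ) * (t + 1ℚ))

      u : Fin (suc m)
      u = top

      a : Fin (suc m) → Fin (suc m) → ℚ
      a i j = ⟦ A i j ⟧

      c : Fin (suc m) → ℚ
      c i = ⟦ C i ⟧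

      -- The matrix A²: numbers of common neighbours, at most 2 off the diagonal.
      co : Fin (suc m) → Fin (suc m) → ℚ
      co i k = ∑ (λ j → a i j * a k j)

      0≤co : ∀ i k → 0ℚ ≤ co i k
      0≤co i k = 0≤∑ (λ j → 0≤⟦ A i j ⟧ ⊗ 0≤⟦ A k j ⟧)

      co-refl : ∀ i → co i i ≡ deg i
      co-refl i = ∑-cong λ j → ⟦⟧-idem (A i j)

      ∑-two-steps : ∀ i (f : Fin (suc m) → ℚ) → ∑ (λ j → a i j * (A ⊙ f) j) ≡ ∑ (λ k → co i k * f k)
      ∑-two-steps i f = begin
        ∑ (λ j → a i j * ∑ (λ k → a j k * f k)) ≡⟨ ∑-cong (λ j → ∑-*ˡ (a i j) _) ⟩
        ∑ (λ j → ∑ (λ k → a i j * (a j k * f k))) ≡⟨ ∑-swap _ ⟩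
        ∑ (λ k → ∑ (λ j → a i j * (a j k * f k))) ≡⟨ ∑-cong (λ k → trans (∑-cong λ j → trans (cong (λ b → a i j * (⟦ b ⟧ * f k)) (A-sym j k)) (sym (*-assoc (a i j) (a k j) (f k)))) (sym (∑-*ʳ (f k) _))) ⟩
        ∑ (λ k → co i k * f k) ∎
        where open ≡-Reasoning

      0≤c : ∀ i → 0ℚ ≤ c i
      0≤c i = 0≤⟦ C i ⟧

      0≤t : 0ℚ ≤ t
      0≤t = ≤-trans (nonNegative⁻¹ 1ℚ) 1≤t

      q≤M : q ≤ M
      q≤M = begin
        q ≡⟨ sym (trans (cong (q *_) x-top) (*-identityʳ q)) ⟩
        q * x u ≤⟨ sub u ⟩
        (A ⊙ x) u + ε ≤⟨ +-mono-≤ (≤-trans (⊙-mono x≤1 u) (≤-trans (≤-reflexive (trans (⊙-const 1ℚ u) (*-identityʳ (deg u)))) (noHub u))) ε≤1 ⟩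
        M - 1ℚ + 1ℚ ≡⟨ solve 1 (λ M → M :- con 1ℚ :+ con 1ℚ := M) refl M ⟩
        M ∎
        where open ≤-Reasoning

      deg≤N : ∀ i → deg i ≤ fromℕ (suc m)
      deg≤N i = ≤-trans (∑-mono (λ j → ⟦ A i j ⟧≤1)) (≤-reflexive (trans (∑-const (suc m) 1ℚ) (*-identityʳ (fromℕ (suc m)))))

      error≤ : ∀ i → deg i * ε + q * ε ≤ 1/100
      error≤ i = ≤-trans (≤-reflexive (sym (*-distribʳ-+ ε (deg i) q))) (≤-trans (*-monoʳ 0≤ε (+-mono-≤ (deg≤N i) q≤M)) ε≤)

      expand : ∀ i → q * q * x i ≤ ∑ (λ j → a i j * (q * x j)) + q * ε
      expand i = begin
        q * q * x i ≡⟨ *-assoc q q (x i) ⟩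
        q * (q * x i) ≤⟨ *-monoˡ 0≤q (sub i) ⟩
        q * ((A ⊙ x) i + ε) ≡⟨ *-distribˡ-+ q ((A ⊙ x) i) ε ⟩
        q * (A ⊙ x) i + q * ε ≡⟨ cong (_+ q * ε) (⊙-*ˡ q x i) ⟩
        ∑ (λ j → a i j * (q * x j)) + q * ε ∎
        where open ≤-Reasoning

      -- Outside the cover all neighbours lie in the cover.
      through-cover : ∀ j → q * x j ≤ q * c j + ((A ⊙ (λ k → c k * x k)) j + ε)
      through-cover j with C j in eq
      ... | true  = ≤-by {d = (A ⊙ (λ k → c k * x k)) j + ε + q * (1ℚ - x j)}
                      (solve 4 (λ q x s e → q :* con 1ℚ :+ (s :+ e) := q :* x :+ (s :+ e :+ q :* (con 1ℚ :- x))) refl q (x j) ((A ⊙ (λ k → c k * x k)) j) ε)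
                      ((0≤∑ (λ k → 0≤⟦ A j k ⟧ ⊗ (0≤c k ⊗ 0≤x k)) ⊕ 0≤ε) ⊕ 0≤q ⊗ ≤⇒0≤- (x≤1 j))
      ... | false = ≤-trans (sub j) (≤-trans
                      (+-monoˡ-≤ ε (∑-mono (λ k → neighbour k)))
                      (≤-reflexive (trans (sym (+-identityˡ ((A ⊙ (λ k → c k * x k)) j + ε))) (cong (_+ ((A ⊙ (λ k → c k * x k)) j + ε)) (sym (*-zeroʳ q))))))
        where
        neighbour : ∀ k → a j k * x k ≤ a j k * (c k * x k)
        neighbour k with A j k in eq′ | C k in eq″
        ... | false | b     = ≤-reflexive (trans (*-zeroˡ (x k)) (sym (*-zeroˡ (⟦ b ⟧ * x k))))
        ... | true  | true  = ≤-reflexive (cong (1ℚ *_) (sym (*-identityˡ (x k))))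
        ... | true  | false = ⊥-elim (<-irrefl refl (<-≤-trans (positive⁻¹ 1ℚ)
          (subst₂ _≤_ (cong ⟦_⟧ eq′) (cong₂ (λ b b′ → ⟦ b ⟧ + ⟦ b′ ⟧) eq eq″) (cover j k))))

      co-cover : ∀ i k → co i k * (c k * x k) ≤ kronecker i k * (deg i * x k) + fromℕ 2 * c k
      co-cover i k with i Fin.≟ k
      ... | yes refl = ≤-trans (≤-reflexive (cong (_* (c i * x i)) (co-refl i)))
        (≤-by {d = deg i * (x i - c i * x i) + fromℕ 2 * c i}
          (solve 3 (λ d c x → con 1ℚ :* (d :* x) :+ # 2 :* c := d :* (c :* x) :+ (d :* (x :- c :* x) :+ # 2 :* c)) refl (deg i) (c i) (x i))
          (0≤deg i ⊗ ≤⇒0≤- (bit*≤ (C i) (0≤x i)) ⊕ 0≤fromℕ 2 ⊗ 0≤c i))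
      ... | no i≢k = ≤-trans (*-mono (0≤fromℕ 2) (0≤c k ⊗ 0≤x k) (common≤2 i k i≢k)
          (≤-trans (*-monoˡ (0≤c k) (x≤1 k)) (≤-reflexive (*-identityʳ (c k)))))
        (≤-reflexive (trans (sym (+-identityˡ _)) (cong (_+ fromℕ 2 * c k) (sym (*-zeroˡ (deg i * x k))))))

      -- Neighbours in the cover cost q each. From the others every second step ends in the cover,
      -- with multiplicity at most 2, except for the returns to i itself, which make up
      -- `deg i * x i`.
      cover-bound : ∀ i → q * q * x i ≤ deg i * x i + ((q + fromℕ 2) * (fromℕ 2 * t) + 1/100)
      cover-bound i = begin
        q * q * x i
          ≤⟨ expand i ⟩
        ∑ (λ j → a i j * (q * x j)) + q * ε
          ≤⟨ +-monoˡ-≤ (q * ε) (∑-mono (λ j → ≤-trans (*-monoˡ 0≤⟦ A i j ⟧ (through-cover j)) (split j))) ⟩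
        ∑ (λ j → q * c j + (a i j * (A ⊙ (λ k → c k * x k)) j + a i j * ε)) + q * ε
          ≡⟨ cong (_+ q * ε) (trans (∑-+ (λ j → q * c j) _) (cong₂ _+_ (sym (∑-*ˡ q c))
               (trans (∑-+ (λ j → a i j * (A ⊙ (λ k → c k * x k)) j) _) (cong₂ _+_ (∑-two-steps i _) (sym (∑-*ʳ ε (a i))))))) ⟩
        q * ∑ c + (∑ (λ k → co i k * (c k * x k)) + deg i * ε) + q * ε
          ≤⟨ +-monoˡ-≤ (q * ε) (+-monoʳ-≤ (q * ∑ c) (+-monoˡ-≤ (deg i * ε) (≤-trans (∑-mono (co-cover i)) (≤-reflexive
               (trans (∑-+ (λ k → kronecker i k * (deg i * x k)) _) (cong₂ _+_ (∑-kronecker i (λ k → deg i * x k)) (sym (∑-*ˡ (fromℕ 2) c)))))))) ⟩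
        q * ∑ c + (deg i * x i + fromℕ 2 * ∑ c + deg i * ε) + q * ε
          ≡⟨ solve 5 (λ q s d x′ e → q :* s :+ (x′ :+ # 2 :* s :+ d :* e) :+ q :* e
               := x′ :+ ((q :+ # 2) :* s :+ (d :* e :+ q :* e))) refl q (∑ c) (deg i) (deg i * x i) ε ⟩
        deg i * x i + ((q + fromℕ 2) * ∑ c + (deg i * ε + q * ε))
          ≤⟨ +-monoʳ-≤ (deg i * x i) (+-mono-≤ (*-monoˡ (0≤q ⊕ 0≤fromℕ 2) ∑C≤2t) (error≤ i)) ⟩
        deg i * x i + ((q + fromℕ 2) * (fromℕ 2 * t) + 1/100) ∎
        where
        open ≤-Reasoning
        split : ∀ j → a i j * (q * c j + ((A ⊙ (λ k → c k * x k)) j + ε))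
          ≤ q * c j + (a i j * (A ⊙ (λ k → c k * x k)) j + a i j * ε)
        split j = ≤-trans (≤-reflexive (solve 4 (λ a k s e → a :* (k :+ (s :+ e)) := a :* k :+ (a :* s :+ a :* e)) refl (a i j) (q * c j) ((A ⊙ (λ k → c k * x k)) j) ε))
          (+-monoˡ-≤ _ (bit*≤ (A i j) (0≤q ⊗ 0≤c j)))

      -- The number of vertices other than u that are not adjacent to u; without a hub it is at
      -- least 1.
      D : ℚ
      D = M - deg u

      1≤D : 1ℚ ≤ D
      1≤D = ≤-by (solve 2 (λ M d → M :- d := con 1ℚ :+ (M :- con 1ℚ :- d)) refl M (deg u)) (≤⇒0≤- (noHub u))

      ∑non-neighbours : ∑ (λ k → 1ℚ - a u k) ≡ D + 1ℚ
      ∑non-neighbours = begin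
        ∑ (λ k → 1ℚ - a u k) ≡⟨ trans (∑-+ (λ _ → 1ℚ) (λ k → - a u k)) (cong₂ _+_ (trans (∑-const (suc m) 1ℚ) (*-identityʳ (fromℕ (suc m)))) (∑-neg (a u))) ⟩
        fromℕ (suc m) - deg u ≡⟨ cong (_- deg u) (fromℕ-+ 1 m) ⟩
        1ℚ + M - deg u ≡⟨ solve 2 (λ M d → con 1ℚ :+ M :- d := M :- d :+ con 1ℚ) refl M (deg u) ⟩
        D + 1ℚ ∎
        where open ≡-Reasoning

      -- At most 2 neighbours are shared with u, and the rest lie among the D + 1 vertices not
      -- adjacent to u, which include u itself.
      deg-other : ∀ i → u ≢ i → deg i ≤ D + fromℕ 3
      deg-other i u≢i = begin
        ∑ (a i) ≤⟨ ∑-mono (λ k → split (A u k) (A i k)) ⟩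
        ∑ (λ k → a u k * a i k + (1ℚ - a u k)) ≡⟨ trans (∑-+ (λ k → a u k * a i k) _) (cong (co u i +_) ∑non-neighbours) ⟩
        co u i + (D + 1ℚ) ≤⟨ +-monoˡ-≤ (D + 1ℚ) (common≤2 u i u≢i) ⟩
        fromℕ 2 + (D + 1ℚ) ≡⟨ solve 1 (λ D → # 2 :+ (D :+ con 1ℚ) := D :+ # 3) refl D ⟩
        D + fromℕ 3 ∎
        where
        open ≤-Reasoning
        split : ∀ b b′ → ⟦ b′ ⟧ ≤ ⟦ b ⟧ * ⟦ b′ ⟧ + (1ℚ - ⟦ b ⟧)
        split true  true  = ≤-refl
        split true  false = ≤-refl
        split false true  = ≤-refl
        split false false = nonNegative⁻¹ 1ℚ

      -- Triangles through u: every edge inside the neighbourhood of u meets the cover.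
      triangles : ∑ (λ k → a u k * co u k) ≤ fromℕ 8 * t
      triangles = begin
        ∑ (λ k → a u k * co u k)
          ≡⟨ ∑-cong (λ k → ∑-*ˡ (a u k) _) ⟩
        ∑ (λ k → ∑ (λ j → a u k * (a u j * a k j)))
          ≤⟨ ∑-mono (λ k → ∑-mono λ j → ≤-trans (*-monoˡ 0≤⟦ A u k ⟧ (*-monoˡ 0≤⟦ A u j ⟧ (through k j)))
               (≤-reflexive (solve 5 (λ p r s c d → p :* (r :* (s :* (c :+ d))) := c :* (p :* (r :* s)) :+ d :* (p :* (r :* s))) refl (a u k) (a u j) (a k j) (c k) (c j)))) ⟩
        ∑ (λ k → ∑ (λ j → c k * (a u k * (a u j * a k j)) + c j * (a u k * (a u j * a k j))))
          ≡⟨ trans (∑-cong λ k → ∑-+ (λ j → c k * (a u k * (a u j * a k j))) _) (∑-+ (λ k → ∑ (λ j → c k * (a u k * (a u j * a k j)))) _) ⟩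
        ∑ (λ k → ∑ (λ j → c k * (a u k * (a u j * a k j)))) + ∑ (λ k → ∑ (λ j → c j * (a u k * (a u j * a k j))))
          ≡⟨ cong₂ _+_ (∑-cong λ k → trans (sym (∑-*ˡ (c k) _)) (cong (c k *_) (sym (∑-*ˡ (a u k) _))))
               (trans (∑-swap _) (∑-cong λ j → trans (sym (∑-*ˡ (c j) _)) (cong (c j *_) (trans (∑-cong λ k →
                 trans (cong (λ b → a u k * (a u j * ⟦ b ⟧)) (A-sym k j)) (solve 3 (λ p r s → p :* (r :* s) := r :* (p :* s)) refl (a u k) (a u j) (a j k)))
                 (sym (∑-*ˡ (a u j) _)))))) ⟩
        ∑ (λ k → c k * (a u k * co u k)) + ∑ (λ k → c k * (a u k * co u k))
          ≤⟨ +-mono-≤ half half ⟩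
        fromℕ 4 * t + fromℕ 4 * t
          ≡⟨ solve 1 (λ t → # 4 :* t :+ # 4 :* t := # 8 :* t) refl t ⟩
        fromℕ 8 * t ∎
        where
        open ≤-Reasoning
        through : ∀ k j → a k j ≤ a k j * (c k + c j)
        through k j = ≤-trans (≤-reflexive (sym (⟦⟧-idem (A k j)))) (*-monoˡ 0≤⟦ A k j ⟧ (cover k j))
        near : ∀ k → a u k * co u k ≤ fromℕ 2
        near k with u Fin.≟ k
        ... | yes refl = ≤-trans (≤-reflexive (trans (cong (λ b → ⟦ b ⟧ * co u u) (A-irrefl u)) (*-zeroˡ (co u u)))) (0≤fromℕ 2)
        ... | no u≢k   = ≤-trans (bit*≤ (A u k) (0≤co u k)) (common≤2 u k u≢k)
        half : ∑ (λ k → c k * (a u k * co u k)) ≤ fromℕ 4 * t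
        half = ≤-trans (∑-mono (λ k → *-monoˡ (0≤c k) (near k))) (≤-trans (≤-reflexive (sym (∑-*ʳ (fromℕ 2) c)))
          (≤-trans (*-monoʳ (0≤fromℕ 2) ∑C≤2t) (≤-reflexive (solve 1 (λ t → # 2 :* t :* # 2 := # 4 :* t) refl t))))

      -- Off u the entries are at most 5 t / (2 q) (`spread`). Expanding A² at u with deg u = M - D
      -- then gives D ≤ 0.26 + 5 t (D + 1 + 4 t) / q, where 0.26 = ¼ + 1/100. For q ≥ 28 (t + 1)²
      -- this fails for every D ≥ 1: in the limit of large t at D = 1 the requirement is 20 / 28 +
      -- 0.26 < 1, and 28 is the least integer satisfying it.
      module Contradiction (M-¼≤q² : M - ¼ ≤ q * q) where

        R≤q : R ≤ q
        R≤q = square-cancel-≤ 0≤q (≤-trans size M-¼≤q²)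

        β : ℚ
        β = (q + fromℕ 2) * (fromℕ 2 * t) + 1/100

        D≤ : D ≤ ¼ + β
        D≤ = ≤-by {d = (q * q - (M - ¼)) + (deg u + β - q * q)}
          (solve 4 (λ M d b Q → con ¼ :+ b := M :- d :+ (Q :- (M :- con ¼) :+ (d :+ b :- Q))) refl M (deg u) β (q * q))
          (≤⇒0≤- M-¼≤q² ⊕ ≤⇒0≤- (subst₂ _≤_ (trans (cong (q * q *_) x-top) (*-identityʳ (q * q))) (cong (_+ β) (trans (cong (deg u *_) x-top) (*-identityʳ (deg u)))) (cover-bound u)))

        s r : ℚ
        s = t - 1ℚ
        r = q - R

        0≤s : 0ℚ ≤ s
        0≤s = ≤⇒0≤- 1≤t

        0≤r : 0ℚ ≤ r
        0≤r = ≤⇒0≤- R≤q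

        0≤q-1 : 0ℚ ≤ q - 1ℚ
        0≤q-1 = subst (0ℚ ≤_)
          (solve 2 (λ q t → (q :- # 28 :* ((t :+ con 1ℚ) :* (t :+ con 1ℚ))) :+ (# 28 :* t :* t :+ # 56 :* t :+ # 27)
                    := q :- con 1ℚ) refl q t)
          (0≤r ⊕ (0≤fromℕ 28 ⊗ 0≤t ⊗ 0≤t ⊕ 0≤fromℕ 56 ⊗ 0≤t ⊕ 0≤fromℕ 27))

        Z : ℚ
        Z = q * q - fromℕ 4 - β

        0<Z : 0ℚ < Z
        0<Z = subst (0ℚ <_)
          (solve 2 (λ q t →
              let r = q :- # 28 :* ((t :+ con 1ℚ) :* (t :+ con 1ℚ)) in
              ((q :- con 1ℚ) :* (r :+ # 28 :* t :* t :+ # 54 :* t :+ # 28)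
                :+ (r :+ # 28 :* t :* t :+ # 50 :* t)) :+ con ((ℤ.+ 2399) / 100)
              := q :* q :- # 4 :- ((q :+ # 2) :* (# 2 :* t) :+ con 1/100)) refl q t)
          (+-mono-≤-<
            (0≤q-1 ⊗ (0≤r ⊕ 0≤fromℕ 28 ⊗ 0≤t ⊗ 0≤t ⊕ 0≤fromℕ 54 ⊗ 0≤t ⊕ 0≤fromℕ 28)
              ⊕ (0≤r ⊕ 0≤fromℕ 28 ⊗ 0≤t ⊗ 0≤t ⊕ 0≤fromℕ 50 ⊗ 0≤t))
            (positive⁻¹ ((ℤ.+ 2399) / 100)))

        -- β is about 2 t q and Z about q², so β / Z is about 2 t / q. The constant 5/2 in place of
        -- 2 absorbs the lower-order terms.
        2qβ≤5tZ : fromℕ 2 * q * β ≤ fromℕ 5 * t * Z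
        2qβ≤5tZ = ≤-by
          (solve 2 (λ q t →
              let r = q :- # 28 :* ((t :+ con 1ℚ) :* (t :+ con 1ℚ))
                  b = (q :+ # 2) :* (# 2 :* t) :+ con 1/100 in
              # 5 :* t :* (q :* q :- # 4 :- b)
              := # 2 :* q :* b
                 :+ (# 28 :* t :* t :* t :+ # 25 :* t :* t :+ t :* (t :- con 1ℚ)
                     :+ con ((ℤ.+ 19) / 20) :* (t :- con 1ℚ) :+ con ((ℤ.+ 93) / 100) :+ t :* r
                     :+ (q :- con 1ℚ) :* (# 28 :* t :* t :* t :+ # 46 :* t :* t
                         :+ con ((ℤ.+ 999) / 50) :* t :+ con ((ℤ.+ 1) / 50) :* (t :- con 1ℚ) :+ t :* r)))
            refl q t)
          (0≤fromℕ 28 ⊗ 0≤t ⊗ 0≤t ⊗ 0≤t ⊕ 0≤fromℕ 25 ⊗ 0≤t ⊗ 0≤t ⊕ 0≤t ⊗ 0≤s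
            ⊕ nonNegative⁻¹ ((ℤ.+ 19) / 20) ⊗ 0≤s ⊕ nonNegative⁻¹ ((ℤ.+ 93) / 100) ⊕ 0≤t ⊗ 0≤r
            ⊕ 0≤q-1 ⊗ (0≤fromℕ 28 ⊗ 0≤t ⊗ 0≤t ⊗ 0≤t ⊕ 0≤fromℕ 46 ⊗ 0≤t ⊗ 0≤t
                ⊕ nonNegative⁻¹ ((ℤ.+ 999) / 50) ⊗ 0≤t ⊕ nonNegative⁻¹ ((ℤ.+ 1) / 50) ⊗ 0≤s ⊕ 0≤t ⊗ 0≤r))

        spread : ∀ i → u ≢ i → fromℕ 2 * q * x i ≤ fromℕ 5 * t
        spread i u≢i = *-cancelˡ 0<Z (begin
          Z * (fromℕ 2 * q * x i) ≡⟨ solve 3 (λ z q x → z :* (# 2 :* q :* x) := # 2 :* q :* (z :* x)) refl Z q (x i) ⟩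
          fromℕ 2 * q * (Z * x i) ≤⟨ *-monoˡ (0≤fromℕ 2 ⊗ 0≤q) Zx≤β ⟩
          fromℕ 2 * q * β ≤⟨ 2qβ≤5tZ ⟩
          fromℕ 5 * t * Z ≡⟨ *-comm (fromℕ 5 * t) Z ⟩
          Z * (fromℕ 5 * t) ∎)
          where
          open ≤-Reasoning
          deg≤4+β : deg i ≤ fromℕ 4 + β
          deg≤4+β = ≤-trans (deg-other i u≢i) (≤-trans (+-monoˡ-≤ (fromℕ 3) D≤)
            (≤-by (solve 1 (λ b → # 4 :+ b := con ¼ :+ b :+ # 3 :+ con ¾) refl β) (nonNegative⁻¹ ¾)))
          Zx≤β : Z * x i ≤ β
          Zx≤β = ≤-by (solve 4 (λ b Q d x → b := (Q :- # 4 :- b) :* x :+ ((# 4 :+ b :- d) :* x :+ (d :* x :+ b :- Q :* x)))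
                         refl β (q * q) (deg i) (x i))
            (≤⇒0≤- deg≤4+β ⊗ 0≤x i ⊕ ≤⇒0≤- (cover-bound i))

        -- Non-neighbours of u receive the uniform bound 2, while neighbours keep their number of
        -- common neighbours: there are too many of them for a uniform bound, but their total is
        -- controlled by the triangles through u.
        pair : ∀ k → fromℕ 2 * q * (co u k * x k)
          ≤ kronecker u k * (fromℕ 2 * q * deg u) + fromℕ 5 * t * (fromℕ 2 * (1ℚ - a u k) + a u k * co u k)
        pair k with u Fin.≟ k
        ... | yes refl = ≤-by {d = fromℕ 5 * t * (fromℕ 2 * (1ℚ - a u u) + a u u * co u u)}
          (cong (_+ fromℕ 5 * t * (fromℕ 2 * (1ℚ - a u u) + a u u * co u u))
            (trans (*-identityˡ (fromℕ 2 * q * deg u)) (cong (fromℕ 2 * q *_) (sym (trans (cong₂ _*_ (co-refl u) x-top) (*-identityʳ (deg u)))))))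
          (0≤fromℕ 5 ⊗ 0≤t ⊗ (0≤fromℕ 2 ⊗ ≤⇒0≤- ⟦ A u u ⟧≤1 ⊕ 0≤⟦ A u u ⟧ ⊗ 0≤co u u))
        ... | no u≢k = begin
          fromℕ 2 * q * (co u k * x k) ≡⟨ solve 3 (λ q w x → # 2 :* q :* (w :* x) := # 2 :* q :* x :* w) refl q (co u k) (x k) ⟩
          fromℕ 2 * q * x k * co u k ≤⟨ *-mono (0≤fromℕ 5 ⊗ 0≤t) (0≤co u k) (spread k u≢k) (split (A u k)) ⟩
          fromℕ 5 * t * (fromℕ 2 * (1ℚ - a u k) + a u k * co u k)
            ≡⟨ trans (sym (+-identityˡ _)) (cong (_+ fromℕ 5 * t * (fromℕ 2 * (1ℚ - a u k) + a u k * co u k)) (sym (*-zeroˡ (fromℕ 2 * q * deg u)))) ⟩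
          0ℚ * (fromℕ 2 * q * deg u) + fromℕ 5 * t * (fromℕ 2 * (1ℚ - a u k) + a u k * co u k) ∎
          where
          open ≤-Reasoning
          split : ∀ b → co u k ≤ fromℕ 2 * (1ℚ - ⟦ b ⟧) + ⟦ b ⟧ * co u k
          split true  = ≤-reflexive (solve 1 (λ w → w := # 2 :* (con 1ℚ :- con 1ℚ) :+ con 1ℚ :* w) refl (co u k))
          split false = ≤-trans (common≤2 u k u≢k) (≤-reflexive (solve 1 (λ w → # 2 := # 2 :* (con 1ℚ :- con 0ℚ) :+ con 0ℚ :* w) refl (co u k)))

        2q∑co≤ : fromℕ 2 * q * ∑ (λ k → co u k * x k) ≤ fromℕ 2 * q * deg u + fromℕ 5 * t * (fromℕ 2 * (D + 1ℚ) + fromℕ 8 * t)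
        2q∑co≤ = begin
          fromℕ 2 * q * ∑ (λ k → co u k * x k)
            ≡⟨ ∑-*ˡ (fromℕ 2 * q) _ ⟩
          ∑ (λ k → fromℕ 2 * q * (co u k * x k))
            ≤⟨ ∑-mono pair ⟩
          ∑ (λ k → kronecker u k * (fromℕ 2 * q * deg u) + fromℕ 5 * t * (fromℕ 2 * (1ℚ - a u k) + a u k * co u k))
            ≡⟨ trans (∑-+ (λ k → kronecker u k * (fromℕ 2 * q * deg u)) _) (cong₂ _+_ (∑-kronecker u (λ _ → fromℕ 2 * q * deg u))
                 (trans (sym (∑-*ˡ (fromℕ 5 * t) _)) (cong (fromℕ 5 * t *_) (trans (∑-+ (λ k → fromℕ 2 * (1ℚ - a u k)) _)
                   (cong (_+ ∑ (λ k → a u k * co u k)) (trans (sym (∑-*ˡ (fromℕ 2) _)) (cong (fromℕ 2 *_) ∑non-neighbours))))))) ⟩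
          fromℕ 2 * q * deg u + fromℕ 5 * t * (fromℕ 2 * (D + 1ℚ) + ∑ (λ k → a u k * co u k))
            ≤⟨ +-monoʳ-≤ (fromℕ 2 * q * deg u) (*-monoˡ (0≤fromℕ 5 ⊗ 0≤t) (+-monoʳ-≤ (fromℕ 2 * (D + 1ℚ)) triangles)) ⟩
          fromℕ 2 * q * deg u + fromℕ 5 * t * (fromℕ 2 * (D + 1ℚ) + fromℕ 8 * t) ∎
          where open ≤-Reasoning

        q²≤ : q * q ≤ ∑ (λ k → co u k * x k) + 1/100
        q²≤ = begin
          q * q ≡⟨ sym (trans (cong (q * q *_) x-top) (*-identityʳ (q * q))) ⟩
          q * q * x u ≤⟨ expand u ⟩
          ∑ (λ j → a u j * (q * x j)) + q * ε ≤⟨ +-monoˡ-≤ (q * ε) (∑-mono λ j → ≤-trans (*-monoˡ 0≤⟦ A u j ⟧ (sub j)) (≤-reflexive (*-distribˡ-+ (a u j) ((A ⊙ x) j) ε))) ⟩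
          ∑ (λ j → a u j * (A ⊙ x) j + a u j * ε) + q * ε ≡⟨ cong (_+ q * ε) (trans (∑-+ (λ j → a u j * (A ⊙ x) j) _) (cong₂ _+_ (∑-two-steps u x) (sym (∑-*ʳ ε (a u))))) ⟩
          ∑ (λ k → co u k * x k) + deg u * ε + q * ε ≡⟨ +-assoc (∑ (λ k → co u k * x k)) (deg u * ε) (q * ε) ⟩
          ∑ (λ k → co u k * x k) + (deg u * ε + q * ε) ≤⟨ +-monoʳ-≤ (∑ (λ k → co u k * x k)) (error≤ u) ⟩
          ∑ (λ k → co u k * x k) + 1/100 ∎
          where open ≤-Reasoning

        impossible : ⊥
        impossible = <-irrefl refl (<-≤-trans (fromℕ-mono-< {0} {1} (ℕ.s≤s ℕ.z≤n)) (≤-by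
          (solve 5 (λ q t M d S →
              let r = q :- # 28 :* ((t :+ con 1ℚ) :* (t :+ con 1ℚ))
                  s = t :- con 1ℚ
                  D = M :- d
                  w = D :- con 1ℚ in
              con 0ℚ := con 1ℚ :+
                ((# 2 :* q :* (q :* q :- (M :- con ¼)) :+ # 2 :* q :* (S :+ con 1/100 :- q :* q)
                   :+ (# 2 :* q :* d :+ # 5 :* t :* (# 2 :* (D :+ con 1ℚ) :+ # 8 :* t) :- # 2 :* q :* S))
                 -- The terms free of w expand 1.48 q - 20 t - 40 t² - 1 in s and r, where 1.48 = 2
                 -- (1 - 0.26); the terms with w are w (2 q - 10 t).
                 :+ (con ((ℤ.+ 36) / 25) :* s :* s :+ con ((ℤ.+ 1644) / 25) :* s :+ con ((ℤ.+ 2619) / 25) :+ con ((ℤ.+ 37) / 25) :* r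
                   :+ w :* (# 56 :* s :* s :+ # 214 :* s :+ # 214 :+ # 2 :* r))))
            refl q t M (deg u) (∑ (λ k → co u k * x k)))
          ((0≤fromℕ 2 ⊗ 0≤q ⊗ ≤⇒0≤- M-¼≤q² ⊕ 0≤fromℕ 2 ⊗ 0≤q ⊗ ≤⇒0≤- q²≤ ⊕ ≤⇒0≤- 2q∑co≤)
            ⊕ (nonNegative⁻¹ ((ℤ.+ 36) / 25) ⊗ 0≤s ⊗ 0≤s ⊕ nonNegative⁻¹ ((ℤ.+ 1644) / 25) ⊗ 0≤s ⊕ nonNegative⁻¹ ((ℤ.+ 2619) / 25) ⊕ nonNegative⁻¹ ((ℤ.+ 37) / 25) ⊗ 0≤r
               ⊕ ≤⇒0≤- 1≤D ⊗ (0≤fromℕ 56 ⊗ 0≤s ⊗ 0≤s ⊕ 0≤fromℕ 214 ⊗ 0≤s ⊕ 0≤fromℕ 214 ⊕ 0≤fromℕ 2 ⊗ 0≤r)))))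

    q²≤M-¼ : q * q ≤ M - ¼
    q²≤M-¼ with ≤-total (q * q) (M - ¼)
    ... | inj₁ q²≤ = q²≤
    ... | inj₂ ≤q² = ⊥-elim (Contradiction.impossible ≤q²)

-- Isomorphism invariance

module Graphs where

  open import Data.Rational.Base as ℚ using (ℚ; 0ℚ; 1ℚ)
  import Data.Rational.Properties as ℚ
  open import Defs using (K)
  open RationalSums
  open Subinvariance
  open EigenvalueApproximation
  open UpperBounds

  module Iso {G H : Graph} (iso : G ≅ H) where
    to : Vertex G → Vertex H
    to = Inverse.to (proj₁ iso)
    from : Vertex H → Vertex G
    from = Inverse.from (proj₁ iso)
    to-from : ∀ v → to (from v) ≡ v
    to-from = Inverse.strictlyInverseˡ (proj₁ iso)
    from-to : ∀ v → from (to v) ≡ v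
    from-to = Inverse.strictlyInverseʳ (proj₁ iso)
    adj-to : ∀ u v → adj G u v ≡ adj H (to u) (to v)
    adj-to = proj₂ iso
    adj-from : ∀ u v → adj H u v ≡ adj G (from u) (from v)
    adj-from u v = sym (trans (adj-to (from u) (from v)) (cong₂ (adj H) (to-from u) (to-from v)))
    from-injective : Injective _≡_ _≡_ from
    from-injective {u} {v} eq = trans (sym (to-from u)) (trans (cong to eq) (to-from v))

  ≅-sym : ∀ {G H} → G ≅ H → H ≅ G
  ≅-sym {G} {H} iso = mk↔ₛ′ from to from-to to-from , adj-from
    where open Iso {G} {H} iso

  ≅-trans : ∀ {G H K} → G ≅ H → H ≅ K → G ≅ K
  ≅-trans {G} {H} {K} f g =
    mk↔ₛ′ (G.to ∘ F.to) (F.from ∘ G.from)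
      (λ v → trans (cong G.to (F.to-from (G.from v))) (G.to-from v))
      (λ v → trans (cong F.from (G.from-to (F.to v))) (F.from-to v))
    , λ u v → trans (F.adj-to u v) (G.adj-to (F.to u) (F.to v))
    where
    module F = Iso {G} {H} f
    module G = Iso {H} {K} g

  OuterplanarFree-≅ : ∀ {n F G H} → G ≅ H → OuterplanarFree n F G → OuterplanarFree n F H
  OuterplanarFree-≅ {n} {F} {G} {H} iso (order≡ , (pos , pos-inj , planar) , free) =
    trans (sym (Perm.↔⇒≡ (proj₁ iso))) order≡ ,
    (pos ∘ from , from-injective ∘ pos-inj , λ a b c d ab cd →
      planar (from a) (from b) (from c) (from d) (subst T (adj-from a b) ab) (subst T (adj-from c d) cd)) ,
    λ (f , f-inj , f-adj) → free (from ∘ f , f-inj ∘ from-injective ,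
      λ u v uv → subst T (adj-from (f u) (f v)) (f-adj u v uv))
    where open Iso {G} {H} iso

  IsEigenvalue-≅ : ∀ {G H μ} → G ≅ H →
    IsEigenvalue (adjacencyMatrix G) μ → IsEigenvalue (adjacencyMatrix H) μ
  IsEigenvalue-≅ {G} {H} {μ} iso (v , (i₀ , v≢0) , eqs) =
    v ∘ from , (to i₀ , subst (λ i → NonZeroᶜ (v i)) (sym (from-to i₀)) v≢0) , λ i →
      (λ ε 0<ε → transport (λ k → re-eq i k) (proj₁ (eqs (from i)) ε 0<ε)) ,
      (λ ε 0<ε → transport (λ k → im-eq i k) (proj₂ (eqs (from i)) ε 0<ε))
    where
    open Iso {G} {H} iso
    reindex : ∀ (x : Vertex G → ℚ) i → (adj G ⊙ x) (from i) ≡ (adj H ⊙ (x ∘ from)) i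
    reindex x i = sym (trans (∑-permute (λ j → ⟦ adj H i j ⟧ ℚ.* x (from j)) (proj₁ iso))
      (∑-cong λ j → cong₂ (λ b w → ⟦ b ⟧ ℚ.* x w)
        (trans (adj-from i (to j)) (cong (adj G (from i)) (from-to j))) (from-to j)))
    re-eq : ∀ i k → seq (re ((adjacencyMatrix G · v) (from i))) k ≡ seq (re ((adjacencyMatrix H · (v ∘ from)) i)) k
    re-eq i k = trans (seq-re-⊙ (adj G) v (from i) k) (trans (reindex (λ j → seq (re (v j)) k) i)
      (sym (seq-re-⊙ (adj H) (v ∘ from) i k)))
    im-eq : ∀ i k → seq (im ((adjacencyMatrix G · v) (from i))) k ≡ seq (im ((adjacencyMatrix H · (v ∘ from)) i)) k
    im-eq i k = trans (seq-im-⊙ (adj G) v (from i) k) (trans (reindex (λ j → seq (im (v j)) k) i)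
      (sym (seq-im-⊙ (adj H) (v ∘ from) i k)))
    transport : ∀ {ε} {f g h : ℕ → ℚ} → (∀ k → f k ≡ g k) →
      Eventually (λ k → ℚ.∣ f k ℚ.- h k ∣ ℚ.≤ ε) → Eventually (λ k → ℚ.∣ g k ℚ.- h k ∣ ℚ.≤ ε)
    transport {ε} {h = h} eq = ev-map (λ k → subst (λ p → ℚ.∣ p ℚ.- h k ∣ ℚ.≤ ε) (eq k))

  IsSpectralRadius-≅ : ∀ {G H ρ} → G ≅ H → IsSpectralRadius G ρ → IsSpectralRadius H ρ
  IsSpectralRadius-≅ {G} {H} iso ((μ , eig , mod) , max) =
    (μ , IsEigenvalue-≅ {G} {H} {μ} iso eig , mod) ,
    λ ν r eig′ → max ν r (IsEigenvalue-≅ {H} {G} {ν} (≅-sym {G} {H} iso) eig′)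

  -- Common neighbours in an outerplanar drawing

  ∑≤0 : ∀ {n} (f : Fin n → Bool) → (∀ i → ¬ T (f i)) → ∑ (λ i → ⟦ f i ⟧) ℚ.≤ fromℕ 0
  ∑≤0 {n} f none = ℚ.≤-trans (∑-mono (λ i → zero-term (f i) (none i)))
    (ℚ.≤-reflexive (trans (∑-const n 0ℚ) (ℚ.*-zeroʳ (fromℕ n))))
    where
    zero-term : ∀ b → ¬ T b → ⟦ b ⟧ ℚ.≤ 0ℚ
    zero-term true  ¬b = ⊥-elim (¬b tt)
    zero-term false ¬b = ℚ.≤-refl

  ∑≤1 : ∀ {n} (f : Fin n → Bool) → (∀ i j → i ≢ j → T (f i) → ¬ T (f j)) → ∑ (λ i → ⟦ f i ⟧) ℚ.≤ fromℕ 1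
  ∑≤1 {zero}  f no-two = ℚ.≤-trans (ℚ.≤-reflexive (∑-zero (λ i → ⟦ f i ⟧))) (0≤fromℕ 1)
  ∑≤1 {suc n} f no-two = ℚ.≤-trans (ℚ.≤-reflexive (∑-suc (λ i → ⟦ f i ⟧))) (split (f zero) refl)
    where
    rest = λ i → f (suc i)
    split : ∀ b → f zero ≡ b → ⟦ b ⟧ ℚ.+ ∑ (λ i → ⟦ rest i ⟧) ℚ.≤ fromℕ 1
    split true  eq = ℚ.+-monoʳ-≤ 1ℚ (∑≤0 rest (λ i → no-two zero (suc i) (λ ()) (subst T (sym eq) tt)))
    split false eq = ℚ.≤-trans (ℚ.≤-reflexive (ℚ.+-identityˡ _))
      (∑≤1 rest (λ i j i≢j → no-two (suc i) (suc j) (i≢j ∘ Fin.suc-injective)))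

  ∑≤2 : ∀ {n} (f : Fin n → Bool) →
    (∀ i j k → i ≢ j → i ≢ k → j ≢ k → T (f i) → T (f j) → ¬ T (f k)) → ∑ (λ i → ⟦ f i ⟧) ℚ.≤ fromℕ 2
  ∑≤2 {zero}  f no-three = ℚ.≤-trans (ℚ.≤-reflexive (∑-zero (λ i → ⟦ f i ⟧))) (0≤fromℕ 2)
  ∑≤2 {suc n} f no-three = ℚ.≤-trans (ℚ.≤-reflexive (∑-suc (λ i → ⟦ f i ⟧))) (split (f zero) refl)
    where
    rest = λ i → f (suc i)
    split : ∀ b → f zero ≡ b → ⟦ b ⟧ ℚ.+ ∑ (λ i → ⟦ rest i ⟧) ℚ.≤ fromℕ 2
    split true  eq = ℚ.+-monoʳ-≤ 1ℚ (∑≤1 rest (λ i j i≢j →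
      no-three zero (suc i) (suc j) (λ ()) (λ ()) (i≢j ∘ Fin.suc-injective) (subst T (sym eq) tt)))
    split false eq = ℚ.≤-trans (ℚ.≤-reflexive (ℚ.+-identityˡ _))
      (∑≤2 rest (λ i j k i≢j i≢k j≢k → no-three (suc i) (suc j) (suc k)
        (i≢j ∘ Fin.suc-injective) (i≢k ∘ Fin.suc-injective) (j≢k ∘ Fin.suc-injective)))

  module Drawing (G : Graph) (pos : Vertex G → ℕ) (pos-inj : Injective _≡_ _≡_ pos)
    (planar : ∀ a b c d → Adj G a b → Adj G c d →
       ¬ (pos a ℕ.< pos c × pos c ℕ.< pos b × pos b ℕ.< pos d)) where

    flip : ∀ {u v} → Adj G u v → Adj G v u
    flip {u} {v} = subst T (adj-sym G u v)

    pos-total : ∀ {u v} → u ≢ v → pos u ℕ.< pos v ⊎ pos v ℕ.< pos u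
    pos-total {u} {v} u≢v with ℕ.<-cmp (pos u) (pos v)
    ... | tri< u<v _ _ = inj₁ u<v
    ... | tri≈ _ eq _  = ⊥-elim (u≢v (pos-inj eq))
    ... | tri> _ _ v<u = inj₂ v<u

    -- No K_{2,3}: two of three common neighbours of u and v would lie on the same
    -- one of the two arcs between u and v.
    module _ {u v} (u<v : pos u ℕ.< pos v) where

      Common : Vertex G → Set
      Common w = Adj G u w × Adj G v w

      -- The positions are a circle cut open, so the outer arc between u and v falls into two
      -- pieces; `before` and `after` share an index because they form one arc.
      data Side (w : Vertex G) : Bool → Set where
        inside : pos u ℕ.< pos w → pos w ℕ.< pos v → Side w true
        before : pos w ℕ.< pos u → Side w false
        after  : pos v ℕ.< pos w → Side w false

      side : ∀ w → Common w → ∃ (Side w)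
      side w (uw , vw) with pos-total {u} {w} (λ { refl → subst T (adj-irrefl G u) uw })
                          | pos-total {v} {w} (λ { refl → subst T (adj-irrefl G v) vw })
      ... | inj₂ w<u | _        = false , before w<u
      ... | inj₁ u<w | inj₁ v<w = false , after v<w
      ... | inj₁ u<w | inj₂ w<v = true , inside u<w w<v

      clash : ∀ {a b s} → pos a ℕ.< pos b → Common a → Common b → Side a s → Side b s → ⊥
      clash {a} {b} a<b (ua , va) (ub , vb) (inside u<a _) (inside _ b<v) =
        planar u b a v ub (flip va) (u<a , a<b , b<v)
      clash {a} {b} a<b (ua , va) (ub , vb) (before a<u) (before b<u) =
        planar a u b v (flip ua) (flip vb) (a<b , b<u , u<v)
      clash {a} {b} a<b (ua , va) (ub , vb) (before a<u) (after v<b) =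
        planar a v u b (flip va) ub (a<u , u<v , v<b)
      clash {a} {b} a<b (ua , va) (ub , vb) (after v<a) (before b<u) =
        ℕ.<-asym a<b (ℕ.<-trans b<u (ℕ.<-trans u<v v<a))
      clash {a} {b} a<b (ua , va) (ub , vb) (after v<a) (after v<b) =
        planar u a v b ua vb (u<v , v<a , a<b)

      same-side : ∀ {a b s} → a ≢ b → Common a → Common b → Side a s → Side b s → ⊥
      same-side {a} {b} a≢b ca cb sa sb with pos-total a≢b
      ... | inj₁ a<b = clash a<b ca cb sa sb
      ... | inj₂ b<a = clash b<a cb ca sb sa

      no-three : ∀ a b c → a ≢ b → a ≢ c → b ≢ c → Common a → Common b → ¬ Common c
      no-three a b c a≢b a≢c b≢c ca cb cc with side a ca | side b cb | side c cc
      ... | true  , sa | true  , sb | _     , sc = same-side a≢b ca cb sa sb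
      ... | false , sa | false , sb | _     , sc = same-side a≢b ca cb sa sb
      ... | true  , sa | false , sb | true  , sc = same-side a≢c ca cc sa sc
      ... | true  , sa | false , sb | false , sc = same-side b≢c cb cc sb sc
      ... | false , sa | true  , sb | true  , sc = same-side b≢c cb cc sb sc
      ... | false , sa | true  , sb | false , sc = same-side a≢c ca cc sa sc

    common≤2 : ∀ u v → u ≢ v → ∑ (λ w → ⟦ adj G u w ⟧ ℚ.* ⟦ adj G v w ⟧) ℚ.≤ fromℕ 2
    common≤2 u v u≢v = ℚ.≤-trans (ℚ.≤-reflexive (∑-cong λ w → and (adj G u w) (adj G v w)))
      (∑≤2 (λ w → adj G u w ∧ adj G v w) (λ a b c a≢b a≢c b≢c ca cb cc →
        absurd a≢b a≢c b≢c (both a ca) (both b cb) (both c cc)))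
      where
      and : ∀ b c → ⟦ b ⟧ ℚ.* ⟦ c ⟧ ≡ ⟦ b ∧ c ⟧
      and true  c = ℚ.*-identityˡ ⟦ c ⟧
      and false c = ℚ.*-zeroˡ ⟦ c ⟧
      both : ∀ w → T (adj G u w ∧ adj G v w) → Adj G u w × Adj G v w
      both w h with adj G u w
      ... | true = tt , h
      absurd : ∀ {a b c} → a ≢ b → a ≢ c → b ≢ c →
        Adj G u a × Adj G v a → Adj G u b × Adj G v b → Adj G u c × Adj G v c → ⊥
      absurd {a} {b} {c} a≢b a≢c b≢c (ua , va) (ub , vb) (uc , vc) with pos-total u≢v
      ... | inj₁ u<v = no-three u<v a b c a≢b a≢c b≢c (ua , va) (ub , vb) (uc , vc)
      ... | inj₂ v<u = no-three v<u a b c a≢b a≢c b≢c (va , ua) (vb , ub) (vc , uc)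

  -- Matchings and vertex covers

  Avoids : ∀ {G F} → Contains G F → Vertex G → Set
  Avoids c v = ∀ x → proj₁ c x ≢ v

  noEdges : ∀ {G} → Contains G (0 ×ᴳ K 2)
  noEdges = (λ ()) , (λ {}) , λ ()

  addEdge : ∀ {G k} (c : Contains G (k ×ᴳ K 2)) {u v} → Adj G u v →
    Avoids {G} {k ×ᴳ K 2} c u → Avoids {G} {k ×ᴳ K 2} c v → Contains G (suc k ×ᴳ K 2)
  addEdge {G} {k} (f , f-inj , f-adj) {u} {v} uv avoid-u avoid-v = g , (λ {x} {y} → g-inj x y) , g-adj
    where
    g : Vertex (suc k ×ᴳ K 2) → Vertex G
    g zero          = u
    g (suc zero)    = v
    g (suc (suc x)) = f x
    u≢v : u ≢ v
    u≢v refl = subst T (adj-irrefl G u) uv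
    g-inj : ∀ x y → g x ≡ g y → x ≡ y
    g-inj zero          zero          _  = refl
    g-inj zero          (suc zero)    eq = ⊥-elim (u≢v eq)
    g-inj zero          (suc (suc y)) eq = ⊥-elim (avoid-u y (sym eq))
    g-inj (suc zero)    zero          eq = ⊥-elim (u≢v (sym eq))
    g-inj (suc zero)    (suc zero)    _  = refl
    g-inj (suc zero)    (suc (suc y)) eq = ⊥-elim (avoid-v y (sym eq))
    g-inj (suc (suc x)) zero          eq = ⊥-elim (avoid-u x eq)
    g-inj (suc (suc x)) (suc zero)    eq = ⊥-elim (avoid-v x eq)
    g-inj (suc (suc x)) (suc (suc y)) eq = cong (λ z → suc (suc z)) (f-inj eq)
    g-adj : ∀ x y → Adj (suc k ×ᴳ K 2) x y → Adj G (g x) (g y)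
    g-adj zero          (suc zero)    _  = uv
    g-adj (suc zero)    zero          _  = subst T (adj-sym G u v) uv
    g-adj (suc zero)    (suc zero)    ()
    g-adj (suc zero)    (suc (suc y)) ()
    g-adj (suc (suc x)) (suc (suc y)) xy = f-adj x y xy

  order-kK₂ : ∀ k → order (k ×ᴳ K 2) ≡ 2 ℕ.* k
  order-kK₂ zero    = refl
  order-kK₂ (suc k) = trans (cong (2 ℕ.+_) (order-kK₂ k)) (sym (ℕ.*-suc 2 k))

  image? : ∀ {m n} (f : Fin m → Fin n) v → Dec (∃ λ x → f x ≡ v)
  image? f v = Fin.any? (λ x → f x Fin.≟ v)

  ∑image≤ : ∀ {m n} (f : Fin m → Fin n) → ∑ (λ v → ⟦ does (image? f v) ⟧) ℚ.≤ fromℕ m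
  ∑image≤ {m} f = ℚ.≤-trans (∑-mono hit) (ℚ.≤-reflexive (trans (∑-swap (λ v x → kronecker (f x) v))
      (trans (∑-cong λ x → trans (∑-cong λ v → sym (ℚ.*-identityʳ (kronecker (f x) v))) (∑-kronecker (f x) (λ _ → 1ℚ)))
             (trans (∑-const m 1ℚ) (ℚ.*-identityʳ (fromℕ m))))))
    where
    hit : ∀ v → ⟦ does (image? f v) ⟧ ℚ.≤ ∑ (λ x → kronecker (f x) v)
    hit v with image? f v
    ... | no _          = 0≤∑ (λ x → 0≤⟦ does (f x Fin.≟ v) ⟧)
    ... | yes (x , fx≡v) = ℚ.≤-trans (ℚ.≤-reflexive (one (f x Fin.≟ v) fx≡v))
            (term≤∑ (λ x → 0≤⟦ does (f x Fin.≟ v) ⟧) x)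
      where
      one : ∀ {w} (d : Dec (w ≡ v)) → w ≡ v → 1ℚ ≡ ⟦ does d ⟧
      one (yes _)  _  = refl
      one (no w≢v) eq = ⊥-elim (w≢v eq)

  Cover : Graph → ℕ → Set
  Cover G s = Σ (Vertex G → Bool) λ C →
    (∀ u v → ⟦ adj G u v ⟧ ℚ.≤ ⟦ C u ⟧ ℚ.+ ⟦ C v ⟧) × ∑ (λ v → ⟦ C v ⟧) ℚ.≤ fromℕ s

  module _ (G : Graph) (t : ℕ) (free : Free ((t ℕ.+ 1) ×ᴳ K 2) G) where

    private
      -- The ends of a maximal matching form a cover.
      grow : ∀ j k → j ℕ.+ k ≡ suc t → Contains G (k ×ᴳ K 2) → Cover G (2 ℕ.* t)
      grow zero    k refl c = ⊥-elim (free (subst (λ s → Contains G (s ×ᴳ K 2)) (ℕ.+-comm 1 t) c))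
      grow (suc j) k j+k≡t c@(f , _)
        with Fin.any? (λ u → Fin.any? (λ v → T? (adj G u v) ×-dec ¬? (image? f u) ×-dec ¬? (image? f v)))
      ... | yes (u , v , uv , u∉ , v∉) = grow j (suc k) (trans (ℕ.+-suc j k) j+k≡t)
              (addEdge {G} {k} c uv (λ x eq → u∉ (x , eq)) (λ x eq → v∉ (x , eq)))
      ... | no maximal = (λ v → does (image? f v)) , covered ,
              ℚ.≤-trans (∑image≤ f) (fromℕ-mono-≤ {order (k ×ᴳ K 2)} {2 ℕ.* t}
                (subst (ℕ._≤ 2 ℕ.* t) (sym (order-kK₂ k)) (ℕ.*-monoʳ-≤ 2 k≤t)))
        where
        k≤t : k ℕ.≤ t
        k≤t = subst (k ℕ.≤_) (ℕ.suc-injective j+k≡t) (ℕ.m≤n+m k j)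
        covered : ∀ u v → ⟦ adj G u v ⟧ ℚ.≤ ⟦ does (image? f u) ⟧ ℚ.+ ⟦ does (image? f v) ⟧
        covered u v = go (adj G u v) refl (image? f u) (image? f v)
          where
          go : ∀ b → adj G u v ≡ b → (du : Dec (∃ λ x → f x ≡ u)) (dv : Dec (∃ λ x → f x ≡ v)) →
            ⟦ b ⟧ ℚ.≤ ⟦ does du ⟧ ℚ.+ ⟦ does dv ⟧
          go false _  du      dv      = 0≤⟦ does du ⟧ ⊕ 0≤⟦ does dv ⟧
          go true  _  (yes _) dv      = ≤-by {d = ⟦ does dv ⟧} refl 0≤⟦ does dv ⟧
          go true  _  (no _)  (yes _) = ℚ.≤-refl
          go true  eq (no u∉) (no v∉) = ⊥-elim (maximal (u , v , subst T (sym eq) tt , u∉ , v∉))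

    free⇒cover : Cover G (2 ℕ.* t)
    free⇒cover = grow (suc t) 0 (ℕ.+-identityʳ (suc t)) (noEdges {G})

-- Outerplanar graphs with a hub are fans over linear forests

module Fans where

  open import Data.Nat.Base using (_≤_; _<_; _+_; _*_; _∸_; _<ᵇ_)
  open HubGraphs
  open Graphs

  start : (ℕ → Bool) → ℕ → Bool
  start b zero    = b 0
  start b (suc _) = false

  -- Recursion on both indices at once makes the deletion of the first vertex a definitional shift
  -- of `b`, on which the inductions over the forest rest.
  lin : (ℕ → Bool) → ℕ → ℕ → Bool
  lin b zero    zero    = false
  lin b zero    (suc j) = start b j
  lin b (suc i) zero    = start b i
  lin b (suc i) (suc j) = lin (b ∘ suc) i j

  lin-sym : ∀ b i j → lin b i j ≡ lin b j i
  lin-sym b zero    zero    = refl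
  lin-sym b zero    (suc j) = refl
  lin-sym b (suc i) zero    = refl
  lin-sym b (suc i) (suc j) = lin-sym (b ∘ suc) i j

  lin-irrefl : ∀ b i → lin b i i ≡ false
  lin-irrefl b zero    = refl
  lin-irrefl b (suc i) = lin-irrefl (b ∘ suc) i

  lin-suc : ∀ b i → lin b i (suc i) ≡ b i
  lin-suc b zero    = refl
  lin-suc b (suc i) = lin-suc (b ∘ suc) i

  start-cong : ∀ {b b′} → (∀ i → b i ≡ b′ i) → ∀ i → start b i ≡ start b′ i
  start-cong eq zero    = eq 0
  start-cong eq (suc i) = refl

  lin-cong : ∀ {b b′} → (∀ i → b i ≡ b′ i) → ∀ i j → lin b i j ≡ lin b′ i j
  lin-cong eq zero    zero    = refl
  lin-cong eq zero    (suc j) = start-cong eq j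
  lin-cong eq (suc i) zero    = start-cong eq i
  lin-cong eq (suc i) (suc j) = lin-cong (eq ∘ suc) i j

  lin-< : ∀ b i j → i < j → (j ≡ suc i → b i ≡ false) → lin b i j ≡ false
  lin-< b zero    (suc zero)    _         h = h refl
  lin-< b zero    (suc (suc j)) _         h = refl
  lin-< b (suc i) (suc j)       (s≤s i<j) h = lin-< (b ∘ suc) i j i<j (h ∘ cong suc)

  lin-edge : ∀ b i j → T (lin b i j) → (j ≡ suc i × T (b i)) ⊎ (i ≡ suc j × T (b j))
  lin-edge b zero       (suc zero) h = inj₁ (refl , h)
  lin-edge b (suc zero) zero       h = inj₂ (refl , h)
  lin-edge b (suc i)    (suc j)    h with lin-edge (b ∘ suc) i j h
  ... | inj₁ (eq , h′) = inj₁ (cong suc eq , h′)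
  ... | inj₂ (eq , h′) = inj₂ (cong suc eq , h′)

  segments : ∀ m → (ℕ → Bool) → Fin m → Fin m → Bool
  segments m b i j = lin b (toℕ i) (toℕ j)

  segments-sym : ∀ m b i j → segments m b i j ≡ segments m b j i
  segments-sym m b i j = lin-sym b (toℕ i) (toℕ j)

  -- A hub joined to the vertices of a linear forest, whose i-th and (i+1)-st
  -- vertices are adjacent when b i holds.
  Fan : ℕ → (ℕ → Bool) → Graph
  Fan m b = record
    { order      = suc m
    ; adj        = hubAdj (segments m b)
    ; adj-sym    = hubAdj-sym (segments-sym m b)
    ; adj-irrefl = λ { zero → refl ; (suc i) → lin-irrefl b (toℕ i) }
    }

  Fan-cong : ∀ m {b b′} → (∀ i → b i ≡ b′ i) → Fan m b ≅ Fan m b′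
  Fan-cong m eq = mk↔ₛ′ id id (λ _ → refl) (λ _ → refl) , λ where
    zero    zero    → refl
    zero    (suc _) → refl
    (suc _) zero    → refl
    (suc i) (suc j) → lin-cong eq (toℕ i) (toℕ j)

  argminℕ : ∀ {n} (f : Fin (suc n) → ℕ) → ∃ λ u → ∀ i → f u ≤ f i
  argminℕ {zero}  f = zero , λ { zero → ℕ.≤-refl }
  argminℕ {suc n} f with argminℕ (f ∘ suc)
  ... | u , min with ℕ.≤-total (f zero) (f (suc u))
  ...   | inj₁ ≤u = zero , λ { zero → ℕ.≤-refl ; (suc i) → ℕ.≤-trans ≤u (min i) }
  ...   | inj₂ u≤ = suc u , λ { zero → u≤ ; (suc i) → min i }

  sorting : ∀ {n} (key : Fin n → ℕ) → Injective _≡_ _≡_ key →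
    Σ (Permutation n n) λ σ → ∀ i j → toℕ i < toℕ j → key (σ ⟨$⟩ʳ i) < key (σ ⟨$⟩ʳ j)
  sorting {zero}  key key-inj = Perm.id , λ ()
  sorting {suc n} key key-inj = Perm.insert zero u τ , increasing
    where
    u = proj₁ (argminℕ key)
    rest = sorting (key ∘ punchIn u) (Fin.punchIn-injective u _ _ ∘ key-inj)
    τ = proj₁ rest
    later : ∀ j → key (Perm.insert zero u τ ⟨$⟩ʳ suc j) ≡ key (punchIn u (τ ⟨$⟩ʳ j))
    later j = cong key (Perm.insert-punchIn zero u τ j)
    increasing : ∀ i j → toℕ i < toℕ j →
      key (Perm.insert zero u τ ⟨$⟩ʳ i) < key (Perm.insert zero u τ ⟨$⟩ʳ j)
    increasing zero    (suc j) _ = subst (key u <_) (sym (later j))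
      (ℕ.≤∧≢⇒< (proj₂ (argminℕ key) (punchIn u (τ ⟨$⟩ʳ j)))
               (λ eq → Fin.punchInᵢ≢i u (τ ⟨$⟩ʳ j) (sym (key-inj eq))))
    increasing (suc i) (suc j) (s≤s i<j) = subst₂ _<_ (sym (later i)) (sym (later j)) (proj₂ rest i j i<j)

  bounded : ∀ {n} (f : Fin n → ℕ) → ∃ λ N → ∀ i → f i < N
  bounded {zero}  f = 0 , λ ()
  bounded {suc n} f with bounded (f ∘ suc)
  ... | N , f<N = suc (f zero) ℕ.⊔ N , λ where
    zero    → ℕ.m≤m⊔n (suc (f zero)) N
    (suc i) → ℕ.≤-trans (f<N i) (ℕ.m≤n⊔m (suc (f zero)) N)

  T⇒≡true : ∀ {b} → T b → b ≡ true
  T⇒≡true {true} _ = refl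

  ¬T⇒≡false : ∀ {b} → ¬ T b → b ≡ false
  ¬T⇒≡false {true}  ¬b = ⊥-elim (¬b tt)
  ¬T⇒≡false {false} _  = refl

  -- Bit i describes an edge only if suc i < m. The remaining bits are pinned down so that
  -- comparison with `window` can be made at every index.
  Normal : ℕ → (ℕ → Bool) → Set
  Normal m b = ∀ i → m ≤ suc i → b i ≡ false

  ∸-cancel-< : ∀ {m n} o → m ∸ o < n ∸ o → m < n
  ∸-cancel-< o h = ℕ.≰⇒> λ n≤m → ℕ.<⇒≱ h (ℕ.∸-monoˡ-≤ o n≤m)

  -- Cut the circle at the hub u: an edge avoiding u cannot jump over a vertex z,
  -- since it would cross the edge u z.
  module CutAtHub {m} (a : Fin (suc m) → Fin (suc m) → Bool) (a-sym : ∀ u v → a u v ≡ a v u)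
    (a-irrefl : ∀ v → a v v ≡ false) (pos : Fin (suc m) → ℕ) (pos-inj : Injective _≡_ _≡_ pos)
    (planar : ∀ x y z w → T (a x y) → T (a z w) → ¬ (pos x < pos z × pos z < pos y × pos y < pos w))
    (u : Fin (suc m)) (hub : ∀ v → v ≢ u → T (a u v)) where

    private
      N : ℕ
      N = proj₁ (bounded pos)

      -- The index is the position of v measured around the circle from the hub: adding N places the
      -- vertices before the hub behind all others.
      data Arc (v : Fin (suc m)) : ℕ → Set where
        after  : pos u ≤ pos v → Arc v (pos v ∸ pos u)
        before : pos v < pos u → Arc v (pos v + N)

      arcs : ∀ v → ∃ (Arc v)
      arcs v with pos u ℕ.≤? pos v
      ... | yes u≤v = pos v ∸ pos u , after u≤v
      ... | no u≰v  = pos v + N , before (ℕ.≰⇒> u≰v)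

      key : Fin (suc m) → ℕ
      key v = proj₁ (arcs v)

      arc : ∀ v → Arc v (key v)
      arc v = proj₂ (arcs v)

      after<before : ∀ v w → pos v ∸ pos u < pos w + N
      after<before v w = ℕ.<-≤-trans (ℕ.≤-<-trans (ℕ.m∸n≤m (pos v) (pos u)) (proj₂ (bounded pos) v)) (ℕ.m≤n+m N (pos w))

      key-injective : Injective _≡_ _≡_ key
      key-injective {v} {w} = go (arc v) (arc w)
        where
        go : ∀ {k l} → Arc v k → Arc w l → k ≡ l → v ≡ w
        go (after u≤v)  (after u≤w)  eq = pos-inj (ℕ.∸-cancelʳ-≡ u≤v u≤w eq)
        go (after u≤v)  (before w<u) eq = ⊥-elim (ℕ.<⇒≢ (after<before v w) eq)
        go (before v<u) (after u≤w)  eq = ⊥-elim (ℕ.<⇒≢ (after<before w v) (sym eq))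
        go (before v<u) (before w<u) eq = pos-inj (ℕ.+-cancelʳ-≡ N (pos v) (pos w) eq)

      key-u : key u ≡ 0
      key-u = go (arc u)
        where
        go : ∀ {k} → Arc u k → k ≡ 0
        go (after _)    = ℕ.n∸n≡0 (pos u)
        go (before u<u) = ⊥-elim (ℕ.<-irrefl refl u<u)

      flip : ∀ {v w} → T (a v w) → T (a w v)
      flip {v} {w} = subst T (a-sym v w)

      strict : ∀ {v} → v ≢ u → pos u ≤ pos v → pos u < pos v
      strict v≢u u≤v = ℕ.≤∧≢⇒< u≤v (v≢u ∘ sym ∘ pos-inj)

      no-jump : ∀ v z w → v ≢ u → z ≢ u → w ≢ u → key v < key z → key z < key w → ¬ T (a v w)
      no-jump v z w v≢u z≢u w≢u v<z z<w vw = go (arc v) (arc z) (arc w) v<z z<w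
        where
        uz = hub z z≢u
        -- Relative to the cyclic order u, v, z, w the circle was cut at one of four places, and
        -- each presents the same crossing with its ends in another linear order. The last two
        -- clauses contradict the order of the keys.
        go : ∀ {k l n} → Arc v k → Arc z l → Arc w n → k < l → l < n → ⊥
        go (after u≤v) (after u≤z) (after u≤w) v<z z<w =
          planar u z v w uz vw (strict v≢u u≤v , ∸-cancel-< (pos u) v<z , ∸-cancel-< (pos u) z<w)
        go (after u≤v) (after u≤z) (before w<u) v<z _ =
          planar w v u z (flip vw) uz (w<u , strict v≢u u≤v , ∸-cancel-< (pos u) v<z)
        go (after u≤v) (before z<u) (before w<u) _ z<w =
          planar z u w v (flip uz) (flip vw) (ℕ.+-cancelʳ-< N (pos z) (pos w) z<w , w<u , strict v≢u u≤v)
        go (before v<u) (before z<u) (before w<u) v<z z<w =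
          planar v w z u vw (flip uz) (ℕ.+-cancelʳ-< N (pos v) (pos z) v<z , ℕ.+-cancelʳ-< N (pos z) (pos w) z<w , w<u)
        go _ (before _) (after _) _ z<w = ℕ.<-asym z<w (after<before w z)
        go (before _) (after _) _ v<z _ = ℕ.<-asym v<z (after<before z v)

      σ : Permutation (suc m) (suc m)
      σ = proj₁ (sorting key key-injective)

      σ-increasing : ∀ i j → toℕ i < toℕ j → key (σ ⟨$⟩ʳ i) < key (σ ⟨$⟩ʳ j)
      σ-increasing = proj₂ (sorting key key-injective)

      σ₀≡u : σ ⟨$⟩ʳ zero ≡ u
      σ₀≡u = go (σ ⟨$⟩ˡ u) (Perm.inverseʳ σ)
        where
        go : ∀ j → σ ⟨$⟩ʳ j ≡ u → σ ⟨$⟩ʳ zero ≡ u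
        go zero    eq = eq
        go (suc j) eq = ⊥-elim (ℕ.n≮0 (subst (key (σ ⟨$⟩ʳ zero) <_) (trans (cong key eq) key-u) (σ-increasing zero (suc j) (s≤s z≤n))))

      v : Fin m → Fin (suc m)
      v i = σ ⟨$⟩ʳ suc i

      v≢u : ∀ i → v i ≢ u
      v≢u i eq = Fin.0≢1+n (trans (sym (Perm.inverseˡ σ)) (trans (cong (σ ⟨$⟩ˡ_) (trans σ₀≡u (sym eq))) (Perm.inverseˡ σ)))

    bits : ℕ → Bool
    bits i with suc i ℕ.<? m
    ... | yes 1+i<m = a (v (fromℕ< (ℕ.<-trans (ℕ.n<1+n i) 1+i<m))) (v (fromℕ< 1+i<m))
    ... | no _      = false

    bits-normal : Normal m bits
    bits-normal i m≤1+i with suc i ℕ.<? m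
    ... | yes 1+i<m = ⊥-elim (ℕ.<⇒≱ 1+i<m m≤1+i)
    ... | no _      = refl

    private
      bits-next : ∀ i j → toℕ j ≡ suc (toℕ i) → bits (toℕ i) ≡ a (v i) (v j)
      bits-next i j j≡1+i with suc (toℕ i) ℕ.<? m
      ... | yes 1+i<m = cong₂ (λ x y → a (v x) (v y)) (Fin.toℕ-injective (Fin.toℕ-fromℕ< _))
                              (Fin.toℕ-injective (trans (Fin.toℕ-fromℕ< 1+i<m) (sym j≡1+i)))
      ... | no 1+i≮m  = ⊥-elim (1+i≮m (subst (_< m) j≡1+i (Fin.toℕ<n j)))

      lin-bits : ∀ i j → toℕ i < toℕ j → lin bits (toℕ i) (toℕ j) ≡ a (v i) (v j)
      lin-bits i j i<j with toℕ j ℕ.≟ suc (toℕ i)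
      ... | yes j≡1+i = trans (cong (lin bits (toℕ i)) j≡1+i) (trans (lin-suc bits (toℕ i)) (bits-next i j j≡1+i))
      ... | no j≢1+i  = trans (lin-< bits (toℕ i) (toℕ j) i<j (⊥-elim ∘ j≢1+i)) (sym (¬T⇒≡false
          (no-jump (v i) (v k) (v j) (v≢u i) (v≢u k) (v≢u j)
            (σ-increasing (suc i) (suc k) (s≤s (subst (toℕ i <_) (sym k≡) (ℕ.n<1+n (toℕ i)))))
            (σ-increasing (suc k) (suc j) (s≤s (subst (_< toℕ j) (sym k≡) 1+i<j))))))
        where
        1+i<j : suc (toℕ i) < toℕ j
        1+i<j = ℕ.≤∧≢⇒< i<j (j≢1+i ∘ sym)
        1+i<m : suc (toℕ i) < m
        1+i<m = ℕ.<-trans 1+i<j (Fin.toℕ<n j)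
        k : Fin m
        k = fromℕ< 1+i<m
        k≡ : toℕ k ≡ suc (toℕ i)
        k≡ = Fin.toℕ-fromℕ< 1+i<m

      adj-σ : ∀ x y → hubAdj (segments m bits) x y ≡ a (σ ⟨$⟩ʳ x) (σ ⟨$⟩ʳ y)
      adj-σ zero    zero    = sym (a-irrefl (σ ⟨$⟩ʳ zero))
      adj-σ zero    (suc j) = sym (trans (cong (λ w → a w (v j)) σ₀≡u) (T⇒≡true (hub (v j) (v≢u j))))
      adj-σ (suc i) zero    = sym (trans (a-sym (v i) (σ ⟨$⟩ʳ zero)) (trans (cong (λ w → a w (v i)) σ₀≡u) (T⇒≡true (hub (v i) (v≢u i)))))
      adj-σ (suc i) (suc j) with ℕ.<-cmp (toℕ i) (toℕ j)
      ... | tri< i<j _ _ = lin-bits i j i<j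
      ... | tri> _ _ j<i = trans (lin-sym bits (toℕ i) (toℕ j)) (trans (lin-bits j i j<i) (a-sym (v j) (v i)))
      ... | tri≈ _ i≡j _ with refl ← Fin.toℕ-injective i≡j = trans (lin-irrefl bits (toℕ i)) (sym (a-irrefl (v i)))

    fan≅ : Fan m bits ≅ record { order = suc m ; adj = a ; adj-sym = a-sym ; adj-irrefl = a-irrefl }
    fan≅ = σ , adj-σ

  hub⇒fan : ∀ m (G : Graph) → order G ≡ suc m → Outerplanar G → (u : Vertex G) → (∀ v → v ≢ u → Adj G u v) →
    ∃ λ b → Normal m b × Fan m b ≅ G
  hub⇒fan m record { order = .(suc m) ; adj = a ; adj-sym = a-sym ; adj-irrefl = a-irrefl } refl (pos , pos-inj , planar) u hub =
    bits , bits-normal , fan≅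
    where open CutAtHub a a-sym a-irrefl pos pos-inj planar u hub

  -- Edges and consecutive edges of a linear forest

  bit : Bool → ℕ
  bit true  = 1
  bit false = 0

  -- In a linear forest on m vertices: the first edge, the edges, and the pairs of
  -- consecutive edges.
  edge₀ ones adjs : ℕ → (ℕ → Bool) → ℕ
  edge₀ zero    b = 0
  edge₀ (suc m) b = bit (b 0)
  ones zero    b = 0
  ones (suc m) b = edge₀ m b + ones m (b ∘ suc)
  adjs zero    b = 0
  adjs (suc m) b = edge₀ m b * edge₀ (ℕ.pred m) (b ∘ suc) + adjs m (b ∘ suc)

  bit≤1 : ∀ b → bit b ≤ 1
  bit≤1 true  = ℕ.≤-refl
  bit≤1 false = z≤n

  edge₀≤1 : ∀ m b → edge₀ m b ≤ 1
  edge₀≤1 zero    b = z≤n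
  edge₀≤1 (suc m) b = bit≤1 (b 0)

  -- As a forest: k isolated vertices, a path with s edges, and isolated vertices again.
  window : ℕ → ℕ → ℕ → Bool
  window zero    s i       = i <ᵇ s
  window (suc k) s zero    = false
  window (suc k) s (suc i) = window k s i

  <ᵇ-false : ∀ i s → s ≤ i → (i <ᵇ s) ≡ false
  <ᵇ-false i       zero    _         = refl
  <ᵇ-false (suc i) (suc s) (s≤s s≤i) = <ᵇ-false i s s≤i

  window-outside : ∀ k s i → k + s ≤ i → window k s i ≡ false
  window-outside zero    s i       h       = <ᵇ-false i s h
  window-outside (suc k) s (suc i) (s≤s h) = window-outside k s i h

  edge₀-zero : ∀ m b → (∀ i → b i ≡ false) → edge₀ m b ≡ 0
  edge₀-zero zero    b none = refl
  edge₀-zero (suc m) b none = cong bit (none 0)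

  ones-zero : ∀ m b → (∀ i → b i ≡ false) → ones m b ≡ 0
  ones-zero zero    b none = refl
  ones-zero (suc m) b none = cong₂ _+_ (edge₀-zero m b none) (ones-zero m (b ∘ suc) (none ∘ suc))

  adjs-zero : ∀ m b → (∀ i → b i ≡ false) → adjs m b ≡ 0
  adjs-zero zero    b none = refl
  adjs-zero (suc m) b none = cong₂ _+_ (cong (_* edge₀ (ℕ.pred m) (b ∘ suc)) (edge₀-zero m b none)) (adjs-zero m (b ∘ suc) (none ∘ suc))

  ones-window : ∀ m s → s < m → ones m (window 0 s) ≡ s
  ones-window m             zero    _         = ones-zero m (window 0 0) (λ _ → refl)
  ones-window (suc (suc m)) (suc s) (s≤s s<m) = cong suc (ones-window (suc m) s s<m)

  adjs-window : ∀ m s → suc s < m → adjs m (window 0 (suc s)) ≡ s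
  adjs-window (suc zero)          zero    (s≤s ())
  adjs-window (suc (suc zero))    (suc s) (s≤s (s≤s ()))
  adjs-window (suc (suc m))       zero    _         = trans
    (cong (λ e → (e + 0) + adjs (suc m) (window 0 0)) (edge₀-zero m (window 0 0) (λ _ → refl))) (adjs-zero (suc m) (window 0 0) (λ _ → refl))
  adjs-window (suc (suc (suc m))) (suc s) (s≤s s<m) = cong suc (adjs-window (suc (suc m)) s s<m)

  -- `ones` minus `adjs` is the number of paths having an edge. Thus `scattered` means at least two
  -- of them, and a single one is a window.
  data Shape (m : ℕ) (b : ℕ → Bool) : Set where
    empty     : (∀ i → b i ≡ false) → Shape m b
    segment   : ∀ k s → ones m b ≡ suc s → k + suc s < m → adjs m b ≡ s → (∀ i → b i ≡ window k (suc s) i) → Shape m b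
    scattered : 2 + adjs m b ≤ ones m b → Shape m b

  shape : ∀ m b → Normal m b → Shape m b
  shape zero       b normal = empty (λ i → normal i z≤n)
  shape (suc zero) b normal = empty (λ i → normal i (s≤s z≤n))
  shape (suc (suc m)) b normal = combine (b 0) refl (shape (suc m) b′ (λ i → normal (suc i) ∘ s≤s))
    where
    b′ = b ∘ suc
    combine : ∀ b₀ → b 0 ≡ b₀ → Shape (suc m) b′ → Shape (suc (suc m)) b
    combine false eq (empty none) = empty λ { zero → eq ; (suc i) → none i }
    combine false eq (segment k s ones≡ fits adjs≡ b≡) = segment (suc k) s
      (trans (cong (λ c → bit c + ones (suc m) b′) eq) ones≡) (s≤s fits)
      (trans (cong (λ c → bit c * edge₀ m b′ + adjs (suc m) b′) eq) adjs≡)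
      λ { zero → eq ; (suc i) → b≡ i }
    combine false eq (scattered gap) = scattered (subst₂ (λ p q → 2 + p ≤ q)
      (cong (λ c → bit c * edge₀ m b′ + adjs (suc m) b′) (sym eq)) (cong (λ c → bit c + ones (suc m) b′) (sym eq)) gap)
    combine true eq = true-case
      where
      ones≡1+ : ones (suc (suc m)) b ≡ suc (ones (suc m) b′)
      ones≡1+ = cong (λ c → bit c + ones (suc m) b′) eq
      adjs≡+ : adjs (suc (suc m)) b ≡ edge₀ m b′ + adjs (suc m) b′
      adjs≡+ = trans (cong (λ c → bit c * edge₀ m b′ + adjs (suc m) b′) eq) (cong (_+ adjs (suc m) b′) (ℕ.+-identityʳ (edge₀ m b′)))
      first : ∀ {s} m → 0 + suc s < suc m → b′ 0 ≡ true → edge₀ m b′ ≡ 1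
      first (suc m) _ b′₀ = cong bit b′₀
      first zero (s≤s ()) _
      not-first : ∀ m → b′ 0 ≡ false → edge₀ m b′ ≡ 0
      not-first zero    _   = refl
      not-first (suc m) b′₀ = cong bit b′₀
      true-case : Shape (suc m) b′ → Shape (suc (suc m)) b
      true-case (empty none) = segment 0 0
        (trans ones≡1+ (cong suc (ones-zero (suc m) b′ none))) (s≤s (s≤s z≤n))
        (trans adjs≡+ (cong₂ _+_ (edge₀-zero m b′ none) (adjs-zero (suc m) b′ none)))
        λ { zero → eq ; (suc i) → none i }
      true-case (segment zero s ones≡ fits adjs≡ b≡) = segment 0 (suc s)
        (trans ones≡1+ (cong suc ones≡)) (s≤s fits)
        (trans adjs≡+ (cong₂ _+_ (first m fits (b≡ 0)) adjs≡))
        λ { zero → eq ; (suc i) → b≡ i }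
      true-case (segment (suc k) s ones≡ fits adjs≡ b≡) = scattered (ℕ.≤-reflexive (sym
        (trans ones≡1+ (trans (cong suc ones≡) (cong (2 +_) (sym (trans adjs≡+ (cong₂ _+_ (not-first m (b≡ 0)) adjs≡))))))))
      true-case (scattered gap) = scattered (subst₂ (λ p q → 2 + p ≤ q) (sym adjs≡+) (sym ones≡1+)
        (ℕ.≤-trans (ℕ.+-monoʳ-≤ 2 (ℕ.+-monoˡ-≤ (adjs (suc m) b′) (edge₀≤1 m b′))) (s≤s gap)))

-- Degrees, matchings and drawings of fans

module FanProperties where

  open import Data.Nat.Base using (_≤_; _<_; _+_; _*_; _∸_)
  open import Data.Rational.Base as ℚ using (ℚ; 0ℚ; 1ℚ)
  import Data.Rational.Properties as ℚ
  open import Defs using (K)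
  open RationalSums
  open HubGraphs
  open UpperBounds
  open Graphs
  open Fans

  fromℕ-bit : ∀ b → ⟦ b ⟧ ≡ fromℕ (bit b)
  fromℕ-bit true  = refl
  fromℕ-bit false = refl

  ∑0 : ∀ n → ∑ {n} (λ _ → 0ℚ) ≡ 0ℚ
  ∑0 n = trans (∑-const n 0ℚ) (ℚ.*-zeroʳ (fromℕ n))

  module _ where
    open Degrees

    row : ∀ m → (ℕ → Bool) → Fin m → ℚ
    row m b j = ⟦ start b (toℕ j) ⟧

    ∑-row : ∀ m b (f : Fin m → ℚ) (c : ℚ) → (∀ {k} → (eq : m ≡ suc k) → f (subst Fin (sym eq) zero) ≡ c) →
      ∑ (λ j → row m b j ℚ.* f j) ≡ fromℕ (edge₀ m b) ℚ.* c
    ∑-row zero    b f c _  = trans (∑-zero (λ j → row 0 b j ℚ.* f j)) (sym (ℚ.*-zeroˡ c))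
    ∑-row (suc m) b f c f₀ = trans (∑-suc (λ j → row (suc m) b j ℚ.* f j)) (trans
      (cong₂ ℚ._+_ (cong₂ ℚ._*_ (fromℕ-bit (b 0)) (f₀ refl)) (trans (∑-cong λ j → ℚ.*-zeroˡ (f (suc j))) (∑0 m)))
      (ℚ.+-identityʳ _))

    ∑-row-1 : ∀ m b → ∑ (row m b) ≡ fromℕ (edge₀ m b)
    ∑-row-1 m b = trans (∑-cong λ j → sym (ℚ.*-identityʳ (row m b j)))
      (trans (∑-row m b (λ _ → 1ℚ) 1ℚ (λ _ → refl)) (ℚ.*-identityʳ _))

    deg-zero : ∀ m b → deg (segments (suc m) b) zero ≡ fromℕ (edge₀ m b)
    deg-zero m b = trans (∑-suc (λ j → ⟦ lin b 0 (toℕ j) ⟧)) (trans (ℚ.+-identityˡ _) (∑-row-1 m b))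

    deg-suc : ∀ m b i → deg (segments (suc m) b) (suc i) ≡ row m b i ℚ.+ deg (segments m (b ∘ suc)) i
    deg-suc m b i = ∑-suc (λ j → ⟦ lin b (suc (toℕ i)) (toℕ j) ⟧)

    deg₀≤1 : ∀ m b → deg (segments (suc m) b) zero ℚ.≤ fromℕ 1
    deg₀≤1 m b = ℚ.≤-trans (ℚ.≤-reflexive (deg-zero m b)) (fromℕ-mono-≤ {edge₀ m b} {1} (edge₀≤1 m b))

    segments-deg≤2 : ∀ m b i → deg (segments m b) i ℚ.≤ fromℕ 2
    segments-deg≤2 (suc m) b zero = ℚ.≤-trans (deg₀≤1 m b) (fromℕ-mono-≤ {1} {2} (s≤s z≤n))
    segments-deg≤2 (suc (suc m)) b (suc zero) = ℚ.≤-trans (ℚ.≤-reflexive (deg-suc (suc m) b zero))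
      (ℚ.+-mono-≤ ⟦ b 0 ⟧≤1 (deg₀≤1 m (b ∘ suc)))
    segments-deg≤2 (suc (suc m)) b (suc (suc i)) = ℚ.≤-trans
      (ℚ.≤-reflexive (trans (deg-suc (suc m) b (suc i)) (ℚ.+-identityˡ _)))
      (segments-deg≤2 (suc m) (b ∘ suc) (suc i))

    segments-W₁ : ∀ m b → W₁ (segments m b) ≡ fromℕ (2 * ones m b)
    segments-W₁ zero    b = ∑-zero (deg (segments 0 b))
    segments-W₁ (suc m) b = begin
      ∑ (deg (segments (suc m) b))
        ≡⟨ ∑-suc (deg (segments (suc m) b)) ⟩
      deg (segments (suc m) b) zero ℚ.+ ∑ (λ i → deg (segments (suc m) b) (suc i))
        ≡⟨ cong₂ ℚ._+_ (deg-zero m b) (trans (∑-cong (deg-suc m b)) (trans (∑-+ (row m b) _) (cong₂ ℚ._+_ (∑-row-1 m b) (segments-W₁ m (b ∘ suc))))) ⟩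
      e ℚ.+ (e ℚ.+ fromℕ (2 * o))
        ≡⟨ cong (λ w → e ℚ.+ (e ℚ.+ w)) (fromℕ-* 2 o) ⟩
      e ℚ.+ (e ℚ.+ fromℕ 2 ℚ.* fromℕ o)
        ≡⟨ solve 2 (λ e o → e :+ (e :+ # 2 :* o) := # 2 :* (e :+ o)) refl e (fromℕ o) ⟩
      fromℕ 2 ℚ.* (e ℚ.+ fromℕ o)
        ≡⟨ sym (trans (fromℕ-* 2 (edge₀ m b + o)) (cong (fromℕ 2 ℚ.*_) (fromℕ-+ (edge₀ m b) o))) ⟩
      fromℕ (2 * (edge₀ m b + o)) ∎
      where
      open ≡-Reasoning
      e = fromℕ (edge₀ m b)
      o = ones m (b ∘ suc)

    -- A vertex of degree 2 contributes 4 to the sum of squares but 2 to the degree sum, so each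
    -- pair of consecutive edges adds 2 to W₁.
    segments-W₂ : ∀ m b → W₂ (segments m b) ≡ fromℕ (2 * (ones m b + adjs m b))
    segments-W₂ zero    b = ∑-zero (λ i → deg (segments 0 b) i ℚ.* deg (segments 0 b) i)
    segments-W₂ (suc m) b = begin
      ∑ (λ i → d i ℚ.* d i)
        ≡⟨ ∑-suc (λ i → d i ℚ.* d i) ⟩
      d zero ℚ.* d zero ℚ.+ ∑ (λ i → d (suc i) ℚ.* d (suc i))
        ≡⟨ cong₂ ℚ._+_ (trans (cong₂ ℚ._*_ (deg-zero m b) (deg-zero m b)) e²) (∑-cong λ i → trans (cong₂ ℚ._*_ (deg-suc m b i) (deg-suc m b i)) (square i)) ⟩
      e ℚ.+ ∑ (λ i → (r i ℚ.+ fromℕ 2 ℚ.* (r i ℚ.* d′ i)) ℚ.+ d′ i ℚ.* d′ i)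
        ≡⟨ cong (e ℚ.+_) (trans (∑-+ (λ i → r i ℚ.+ fromℕ 2 ℚ.* (r i ℚ.* d′ i)) _) (cong₂ ℚ._+_
             (trans (∑-+ r _) (cong₂ ℚ._+_ (∑-row-1 m b) (trans (sym (∑-*ˡ (fromℕ 2) _)) (cong (fromℕ 2 ℚ.*_) (∑-row m b d′ f (d′₀ m))))))
             (segments-W₂ m (b ∘ suc)))) ⟩
      e ℚ.+ ((e ℚ.+ fromℕ 2 ℚ.* (e ℚ.* f)) ℚ.+ fromℕ (2 * (o + p)))
        ≡⟨ cong (λ w → e ℚ.+ ((e ℚ.+ fromℕ 2 ℚ.* (e ℚ.* f)) ℚ.+ w)) (trans (fromℕ-* 2 (o + p)) (cong (fromℕ 2 ℚ.*_) (fromℕ-+ o p))) ⟩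
      e ℚ.+ ((e ℚ.+ fromℕ 2 ℚ.* (e ℚ.* f)) ℚ.+ fromℕ 2 ℚ.* (fromℕ o ℚ.+ fromℕ p))
        ≡⟨ solve 4 (λ e f o p → e :+ ((e :+ # 2 :* (e :* f)) :+ # 2 :* (o :+ p)) := # 2 :* ((e :+ o) :+ (e :* f :+ p))) refl e f (fromℕ o) (fromℕ p) ⟩
      fromℕ 2 ℚ.* ((e ℚ.+ fromℕ o) ℚ.+ (e ℚ.* f ℚ.+ fromℕ p))
        ≡⟨ sym (trans (fromℕ-* 2 (ones (suc m) b + adjs (suc m) b)) (cong (fromℕ 2 ℚ.*_) (trans (fromℕ-+ (ones (suc m) b) (adjs (suc m) b))
             (cong₂ ℚ._+_ (fromℕ-+ (edge₀ m b) o) (trans (fromℕ-+ (edge₀ m b * edge₀ (ℕ.pred m) (b ∘ suc)) p) (cong (ℚ._+ fromℕ p) (fromℕ-* (edge₀ m b) (edge₀ (ℕ.pred m) (b ∘ suc))))))))) ⟩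
      fromℕ (2 * (ones (suc m) b + adjs (suc m) b)) ∎
      where
      open ≡-Reasoning
      e = fromℕ (edge₀ m b)
      f = fromℕ (edge₀ (ℕ.pred m) (b ∘ suc))
      o = ones m (b ∘ suc)
      p = adjs m (b ∘ suc)
      d = deg (segments (suc m) b)
      d′ = deg (segments m (b ∘ suc))
      r = row m b
      e²-bit : ∀ k c → edge₀ k b ≡ bit c → fromℕ (edge₀ k b) ℚ.* fromℕ (edge₀ k b) ≡ fromℕ (edge₀ k b)
      e²-bit k c eq = subst (λ x → fromℕ x ℚ.* fromℕ x ≡ fromℕ x) (sym eq)
        (subst (λ x → x ℚ.* x ≡ x) (fromℕ-bit c) (⟦⟧-idem c))
      e² : e ℚ.* e ≡ e
      e² = go m
        where
        go : ∀ m → fromℕ (edge₀ m b) ℚ.* fromℕ (edge₀ m b) ≡ fromℕ (edge₀ m b)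
        go zero    = refl
        go (suc m) = e²-bit (suc m) (b 0) refl
      square : ∀ i → (r i ℚ.+ d′ i) ℚ.* (r i ℚ.+ d′ i) ≡ (r i ℚ.+ fromℕ 2 ℚ.* (r i ℚ.* d′ i)) ℚ.+ d′ i ℚ.* d′ i
      square i = trans (solve 2 (λ r d → (r :+ d) :* (r :+ d) := (r :* r :+ # 2 :* (r :* d)) :+ d :* d) refl (r i) (d′ i))
        (cong (λ x → (x ℚ.+ fromℕ 2 ℚ.* (r i ℚ.* d′ i)) ℚ.+ d′ i ℚ.* d′ i) (⟦⟧-idem (start b (toℕ i))))
      d′₀ : ∀ m {k} (eq : m ≡ suc k) → deg (segments m (b ∘ suc)) (subst Fin (sym eq) zero) ≡ fromℕ (edge₀ (ℕ.pred m) (b ∘ suc))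
      d′₀ (suc k) refl = deg-zero k (b ∘ suc)

  module _ (m₀ : ℕ) (β : ℕ → Bool) where

    private
      G : Graph
      G = Fan m₀ β

      node : ∀ {i} → i < m₀ → Vertex G
      node i<m₀ = suc (fromℕ< i<m₀)

      node-edge : ∀ {i} (p : i < m₀) (q : suc i < m₀) → T (β i) → Adj G (node p) (node q)
      node-edge {i} p q βi = subst₂ (λ x y → T (lin β x y)) (sym (Fin.toℕ-fromℕ< p)) (sym (Fin.toℕ-fromℕ< q))
        (subst T (sym (lin-suc β i)) βi)

    -- Greedily: an edge of the path and its successor are covered by one edge of a matching.
    pathMatching : ∀ m o b j → o + m ≡ m₀ → (∀ i → b i ≡ β (o + i)) → 2 * j ≤ suc (ones m b) →
      Σ (Contains G (j ×ᴳ K 2)) λ c → ∀ x → o < toℕ (proj₁ c x)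
    pathMatching m o b zero _ _ _ = noEdges {G} , λ ()
    pathMatching zero o b (suc j) _ _ h = ⊥-elim (ℕ.<⇒≱ (s≤s (s≤s z≤n)) (ℕ.≤-trans (ℕ.≤-reflexive (sym (ℕ.*-suc 2 j))) h))
    pathMatching (suc zero) o b (suc j) _ _ h = ⊥-elim (ℕ.<⇒≱ (s≤s (s≤s z≤n)) (ℕ.≤-trans (ℕ.≤-reflexive (sym (ℕ.*-suc 2 j))) h))
    pathMatching (suc (suc m)) o b (suc j) o+m≡ b≡ h = split (b 0) refl
        (pathMatching (suc m) (suc o) b₁ (suc j) (trans (sym (ℕ.+-suc o (suc m))) o+m≡) b≡₁)
        (pathMatching m (suc (suc o)) b₂ j (trans (sym 2+o+m≡) o+m≡) (λ i → trans (b≡₁ (suc i)) (cong (β ∘ suc) (ℕ.+-suc o i))))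
      where
      b₁ b₂ : ℕ → Bool
      b₁ i = b (suc i)
      b₂ i = b (suc (suc i))
      b≡₁ : ∀ i → b₁ i ≡ β (suc o + i)
      b≡₁ i = trans (b≡ (suc i)) (cong β (ℕ.+-suc o i))
      2+o+m≡ : o + suc (suc m) ≡ suc (suc (o + m))
      2+o+m≡ = trans (ℕ.+-suc o (suc m)) (cong suc (ℕ.+-suc o m))
      1+o<m₀ : suc o < m₀
      1+o<m₀ = subst (suc o <_) o+m≡ (subst (suc o <_) (sym 2+o+m≡) (s≤s (s≤s (ℕ.m≤m+n o m))))
      o<m₀ : o < m₀
      o<m₀ = ℕ.<-trans (ℕ.n<1+n o) 1+o<m₀
      o<2+o : o < suc (suc o)
      o<2+o = ℕ.<-trans (ℕ.n<1+n o) (ℕ.n<1+n (suc o))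
      toℕ-node : ∀ {i} (p : i < m₀) → toℕ (node p) ≡ suc i
      toℕ-node p = cong suc (Fin.toℕ-fromℕ< p)
      2+2j≤ : 2 + 2 * j ≤ suc (ones (suc (suc m)) b)
      2+2j≤ = ℕ.≤-trans (ℕ.≤-reflexive (sym (ℕ.*-suc 2 j))) h
      ones≤ : ones (suc (suc m)) b ≤ 2 + ones m b₂
      ones≤ = ℕ.+-mono-≤ (bit≤1 (b 0)) (ℕ.+-monoˡ-≤ (ones m b₂) (edge₀≤1 m b₁))
      split : ∀ b₀ → b 0 ≡ b₀ →
        (2 * suc j ≤ suc (ones (suc m) b₁) → Σ (Contains G (suc j ×ᴳ K 2)) λ c → ∀ x → suc o < toℕ (proj₁ c x)) →
        (2 * j ≤ suc (ones m b₂) → Σ (Contains G (j ×ᴳ K 2)) λ c → ∀ x → suc (suc o) < toℕ (proj₁ c x)) →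
        Σ (Contains G (suc j ×ᴳ K 2)) λ c → ∀ x → o < toℕ (proj₁ c x)
      split false eq rec₁ _ with rec₁ (subst (λ c → 2 * suc j ≤ suc (bit c + ones (suc m) b₁)) eq h)
      ... | c , far = c , λ x → ℕ.<-trans (ℕ.n<1+n o) (far x)
      split true eq _ rec₂ with rec₂ (ℕ.≤-pred (ℕ.≤-pred (ℕ.≤-trans 2+2j≤ (s≤s ones≤))))
      ... | c , far = addEdge {G} {j} c (node-edge o<m₀ 1+o<m₀ (subst T (trans (sym eq) (trans (b≡ 0) (cong β (ℕ.+-identityʳ o)))) tt))
          (λ x eq → ℕ.<⇒≱ (subst (suc (suc o) <_) (trans (cong toℕ eq) (toℕ-node o<m₀)) (far x)) (ℕ.n≤1+n (suc o)))
          (λ x eq → ℕ.<-irrefl refl (subst (suc (suc o) <_) (trans (cong toℕ eq) (toℕ-node 1+o<m₀)) (far x))) ,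
        λ { zero          → subst (o <_) (sym (toℕ-node o<m₀)) (ℕ.n<1+n o)
          ; (suc zero)    → subst (o <_) (sym (toℕ-node 1+o<m₀)) o<2+o
          ; (suc (suc x)) → ℕ.<-trans o<2+o (far x) }

    -- If 2 t ≤ ones + 1, the forest alone has a matching of t edges. It leaves the hub free and, as
    -- m₀ > 2 t, some forest vertex too; these two are joined by a further edge.
    ones-bound : ∀ t → 2 * t < m₀ → Free ((t + 1) ×ᴳ K 2) G → 2 + ones m₀ β ≤ 2 * t
    ones-bound t 2t<m₀ free = ℕ.≮⇒≥ λ 2t<2+ones → absurd (pathMatching m₀ 0 β t refl (λ _ → refl) (ℕ.≤-pred 2t<2+ones))
      where
      absurd : ¬ (Σ (Contains G (t ×ᴳ K 2)) λ c → ∀ x → 0 < toℕ (proj₁ c x))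
      absurd (c@(f , _) , far) = free (subst (λ s → Contains G (s ×ᴳ K 2)) (ℕ.+-comm 1 t)
          (addEdge {G} {t} c {zero} {suc z} tt
            (λ x eq → ℕ.<-irrefl refl (subst (0 <_) (cong toℕ eq) (far x)))
            (λ x eq → z∉ (x , eq))))
        where
        unused : ∃ λ z → ¬ (∃ λ x → f x ≡ suc z)
        unused = Fin.¬∀⟶∃¬ m₀ _ (λ z → image? f (suc z)) λ all → ℕ.<⇒≱ 2t<m₀ (subst (m₀ ≤_) (order-kK₂ t)
          (Fin.injective⇒≤ {f = λ z → proj₁ (all z)} (λ {z} {z′} eq → Fin.suc-injective
            (trans (sym (proj₂ (all z))) (trans (cong f eq) (proj₂ (all z′)))))))
        z = proj₁ unused
        z∉ = proj₂ unused

  toℕ-punchIn-last : ∀ m (i : Fin m) → toℕ (punchIn (Fin.fromℕ m) i) ≡ toℕ i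
  toℕ-punchIn-last (suc m) zero    = refl
  toℕ-punchIn-last (suc m) (suc i) = cong suc (toℕ-punchIn-last m i)

  -- Move the first, isolated, path vertex to the end.
  rotate : ∀ k s m → suc k + s < m → Fan m (window (suc k) s) ≅ Fan m (window k s)
  rotate k s (suc m) (s≤s k+s<m) = Perm.lift₀ π , adj-π
    where
    π : Permutation (suc m) (suc m)
    π = Perm.insert zero (Fin.fromℕ m) Perm.id
    π-suc : ∀ i → toℕ (π ⟨$⟩ʳ suc i) ≡ toℕ i
    π-suc i = trans (cong toℕ (Perm.insert-punchIn zero (Fin.fromℕ m) Perm.id i)) (toℕ-punchIn-last m i)
    start-false : ∀ j → start (window (suc k) s) j ≡ false
    start-false zero    = refl
    start-false (suc j) = refl
    last-isolated : ∀ j → j < m → lin (window k s) m j ≡ false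
    last-isolated j j<m = trans (lin-sym (window k s) m j) (lin-< (window k s) j m j<m
      (λ m≡1+j → window-outside k s j (ℕ.≤-pred (subst (k + s <_) m≡1+j k+s<m))))
    to-last : ∀ j → lin (window k s) (toℕ (Fin.fromℕ m)) (toℕ (π ⟨$⟩ʳ suc j)) ≡ false
    to-last j = trans (cong₂ (lin (window k s)) (Fin.toℕ-fromℕ m) (π-suc j)) (last-isolated (toℕ j) (Fin.toℕ<n j))
    adj-π : ∀ u v → hubAdj (segments (suc m) (window (suc k) s)) u v
      ≡ hubAdj (segments (suc m) (window k s)) (Perm.lift₀ π ⟨$⟩ʳ u) (Perm.lift₀ π ⟨$⟩ʳ v)
    adj-π zero          zero          = refl
    adj-π zero          (suc v)       = refl
    adj-π (suc u)       zero          = refl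
    adj-π (suc zero)    (suc zero)    = sym (lin-irrefl (window k s) (toℕ (Fin.fromℕ m)))
    adj-π (suc zero)    (suc (suc j)) = trans (start-false (toℕ j)) (sym (to-last j))
    adj-π (suc (suc i)) (suc zero)    = trans (start-false (toℕ i)) (sym (trans (lin-sym (window k s) (toℕ (π ⟨$⟩ʳ suc i)) _) (to-last i)))
    adj-π (suc (suc i)) (suc (suc j)) = sym (cong₂ (lin (window k s)) (π-suc i) (π-suc j))

  Fan-window≅ : ∀ k s m → k + s < m → Fan m (window k s) ≅ Fan m (window 0 s)
  Fan-window≅ zero    s m h = Fan-cong m (λ _ → refl)
  Fan-window≅ (suc k) s m h = ≅-trans {Fan m (window (suc k) s)} {Fan m (window k s)} {Fan m (window 0 s)}
    (rotate k s m h) (Fan-window≅ k s m (ℕ.<-trans (ℕ.n<1+n (k + s)) h))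

  -- The hub takes position 0. Forest edges then join neighbouring positions, which leave no room
  -- for an end in between, and two edges at the hub share an end.
  Fan-outerplanar : ∀ m b → Outerplanar (Fan m b)
  Fan-outerplanar m b = toℕ , Fin.toℕ-injective , noncrossing
    where
    close : ∀ (i j : Fin m) → T (segments m b i j) → toℕ j ≤ suc (toℕ i)
    close i j h with lin-edge b (toℕ i) (toℕ j) h
    ... | inj₁ (eq , _) = ℕ.≤-reflexive eq
    ... | inj₂ (eq , _) = ℕ.≤-trans (ℕ.n≤1+n (toℕ j)) (ℕ.≤-trans (ℕ.≤-reflexive (sym eq)) (ℕ.n≤1+n (toℕ i)))
    noncrossing : ∀ x y z w → Adj (Fan m b) x y → Adj (Fan m b) z w → ¬ (toℕ x < toℕ z × toℕ z < toℕ y × toℕ y < toℕ w)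
    noncrossing (suc x) (suc y) z w xy _ (x<z , z<y , _) = ℕ.<⇒≱ (ℕ.≤-trans (s≤s x<z) z<y) (s≤s (close x y xy))
    noncrossing (suc x) zero    z w _ _ (_ , () , _)
    noncrossing zero y (suc z) zero    _ _  (_ , _ , ())
    noncrossing zero y (suc z) (suc w) _ zw (_ , z<y , y<w) = ℕ.<⇒≱ (ℕ.≤-trans (s≤s z<y) y<w) (s≤s (close z w zw))

  module _ where

    lo hi : ∀ k → Fin k → Vertex (k ×ᴳ K 2)
    lo (suc k) zero    = zero
    lo (suc k) (suc e) = suc (suc (lo k e))
    hi (suc k) zero    = suc zero
    hi (suc k) (suc e) = suc (suc (hi k e))

    edge-of : ∀ k → Vertex (k ×ᴳ K 2) → Fin k
    edge-of (suc k) zero          = zero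
    edge-of (suc k) (suc zero)    = zero
    edge-of (suc k) (suc (suc x)) = suc (edge-of k x)

    edge-lo : ∀ k e → edge-of k (lo k e) ≡ e
    edge-lo (suc k) zero    = refl
    edge-lo (suc k) (suc e) = cong suc (edge-lo k e)

    edge-hi : ∀ k e → edge-of k (hi k e) ≡ e
    edge-hi (suc k) zero    = refl
    edge-hi (suc k) (suc e) = cong suc (edge-hi k e)

    lo-hi : ∀ k e → Adj (k ×ᴳ K 2) (lo k e) (hi k e)
    lo-hi (suc k) zero    = tt
    lo-hi (suc k) (suc e) = lo-hi k e

  -- The hub 0 and the path vertices 2, 4, …, 2t − 2 cover all edges.
  Fan-free : ∀ t m → 1 ≤ t → Free ((t + 1) ×ᴳ K 2) (Fan m (window 0 (2 * t ∸ 2)))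
  Fan-free t m 1≤t contains with subst (λ s → Contains (Fan m (window 0 (2 * t ∸ 2))) (s ×ᴳ K 2)) (ℕ.+-comm t 1) contains
  ... | f , f-inj , f-adj = ℕ.<⇒≱ (ℕ.n<1+n t) (Fin.injective⇒≤ {f = index} index-injective)
    where
    G = Fan m (window 0 (2 * t ∸ 2))
    Covered : Vertex G → Set
    Covered v = Σ (Fin t) λ h → toℕ v ≡ 2 * toℕ h

    halve : ∀ v → toℕ v < 2 * t → ∀ h → toℕ v ≡ 2 * h → Covered v
    halve v v<2t h eq = fromℕ< h<t , trans eq (cong (2 *_) (sym (Fin.toℕ-fromℕ< h<t)))
      where
      h<t : h < t
      h<t = ℕ.*-cancelˡ-< 2 h t (subst (_< 2 * t) eq v<2t)

    parity : ∀ n → (∃ λ h → n ≡ 2 * h) ⊎ (∃ λ h → suc n ≡ 2 * h)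
    parity zero    = inj₁ (0 , refl)
    parity (suc n) with parity n
    ... | inj₁ (h , eq) = inj₂ (suc h , trans (cong (2 +_) eq) (sym (ℕ.*-suc 2 h)))
    ... | inj₂ (h , eq) = inj₁ (h , eq)

    -- Forest edge i joins the vertices i + 1 and i + 2 of the fan, since the hub is vertex 0; hence
    -- the offset.
    below : ∀ i → T (window 0 (2 * t ∸ 2) i) → 2 + i < 2 * t
    below i h = ℕ.≤-trans (s≤s (s≤s (ℕ.<ᵇ⇒< i (2 * t ∸ 2) h))) (ℕ.≤-reflexive (ℕ.m+[n∸m]≡n (ℕ.*-monoʳ-≤ 2 1≤t)))

    consecutive : ∀ (x y : Fin m) → toℕ y ≡ suc (toℕ x) → T (window 0 (2 * t ∸ 2) (toℕ x)) → Covered (suc x) ⊎ Covered (suc y)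
    consecutive x y y≡ h with parity (suc (toℕ x))
    ... | inj₁ (k , eq) = inj₁ (halve (suc x) (ℕ.<-trans (ℕ.n<1+n _) (below (toℕ x) h)) k eq)
    ... | inj₂ (k , eq) = inj₂ (halve (suc y) (subst (_< 2 * t) (cong suc (sym y≡)) (below (toℕ x) h)) k (trans (cong suc y≡) eq))

    covered : ∀ u v → Adj G u v → Covered u ⊎ Covered v
    covered zero    v    _ = inj₁ (fromℕ< 1≤t , sym (trans (cong (2 *_) (Fin.toℕ-fromℕ< 1≤t)) refl))
    covered (suc x) zero _ = inj₂ (fromℕ< 1≤t , sym (trans (cong (2 *_) (Fin.toℕ-fromℕ< 1≤t)) refl))
    covered (suc x) (suc y) h with lin-edge (window 0 (2 * t ∸ 2)) (toℕ x) (toℕ y) h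
    ... | inj₁ (eq , w) = consecutive x y eq w
    ... | inj₂ (eq , w) with consecutive y x eq w
    ...   | inj₁ c = inj₂ c
    ...   | inj₂ c = inj₁ c

    choose : ∀ e → ∃ λ x → edge-of (suc t) x ≡ e × Covered (f x)
    choose e with covered (f (lo (suc t) e)) (f (hi (suc t) e)) (f-adj (lo (suc t) e) (hi (suc t) e) (lo-hi (suc t) e))
    ... | inj₁ c = lo (suc t) e , edge-lo (suc t) e , c
    ... | inj₂ c = hi (suc t) e , edge-hi (suc t) e , c

    index : Fin (suc t) → Fin t
    index e = proj₁ (proj₂ (proj₂ (choose e)))

    -- The chosen vertex determines the matching edge it lies on, so t + 1 disjoint edges would
    -- inject into a cover of t vertices.
    index-injective : Injective _≡_ _≡_ index
    index-injective {e} {e′} eq with choose e | choose e′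
    ... | x , refl , h , fx≡ | x′ , refl , h′ , fx′≡ =
      cong (edge-of (suc t)) (f-inj (Fin.toℕ-injective (trans fx≡ (trans (cong (λ h → 2 * toℕ h) eq) (sym fx′≡)))))

-- The stated extremal graphs as fans

module ExtremalGraphs where

  open import Data.Nat.Base using (_≤_; _<_; _+_; _*_; _∸_; _<ᵇ_; _≡ᵇ_)
  open import Data.Nat.DivMod using (n/1≡n) renaming (_/_ to _div_)
  open import Data.Nat.Divisibility using (_∣?_; 1∣_)
  open import Defs using (P; K)
  open Graphs
  open Fans

  lin-window-outside : ∀ s i j → s < j → lin (window 0 s) i j ≡ false
  lin-window-outside s i j s<j = ¬T⇒≡false λ h → absurd (lin-edge (window 0 s) i j h)
    where
    absurd : (j ≡ suc i × T (i <ᵇ s)) ⊎ (i ≡ suc j × T (j <ᵇ s)) → ⊥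
    absurd (inj₁ (refl , i<s)) = ℕ.<⇒≱ s<j (ℕ.<ᵇ⇒< i s i<s)
    absurd (inj₂ (_ , j<s))    = ℕ.<-asym s<j (ℕ.<ᵇ⇒< j s j<s)

  path-lin : ∀ s i j → i ≤ s → j ≤ s → (suc i ≡ᵇ j) ∨ (suc j ≡ᵇ i) ≡ lin (window 0 s) i j
  path-lin s       zero          zero          _         _         = refl
  path-lin (suc s) zero          (suc zero)    _         _         = refl
  path-lin (suc s) zero          (suc (suc j)) _         _         = refl
  path-lin (suc s) (suc zero)    zero          _         _         = refl
  path-lin (suc s) (suc (suc i)) zero          _         _         = refl
  path-lin (suc s) (suc i)       (suc j)       (s≤s i≤s) (s≤s j≤s) = path-lin s i j i≤s j≤s

  K₁∨≅Fan : ∀ m b H → order H ≡ m → (∀ x y → adj H x y ≡ lin b (toℕ x) (toℕ y)) → K 1 ∨ᴳ H ≅ Fan m b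
  K₁∨≅Fan m b H refl adj≡ = mk↔ₛ′ id id (λ _ → refl) (λ _ → refl) , λ where
    zero    zero    → refl
    zero    (suc _) → refl
    (suc _) zero    → refl
    (suc x) (suc y) → adj≡ x y

  star≅Fan : ∀ m → K[ 1 , m ] ≅ Fan m (window 0 0)
  star≅Fan m = mk↔ₛ′ id id (λ _ → refl) (λ _ → refl) , λ where
      zero    zero    → refl
      zero    (suc _) → refl
      (suc _) zero    → refl
      (suc x) (suc y) → sym (no-edge (toℕ x) (toℕ y))
    where
    no-edge : ∀ i j → lin (window 0 0) i j ≡ false
    no-edge i (suc j) = lin-window-outside 0 i (suc j) (s≤s z≤n)
    no-edge i zero    = trans (lin-sym (window 0 0) i 0) (lin-zero i)
      where
      lin-zero : ∀ i → lin (window 0 0) 0 i ≡ false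
      lin-zero zero    = refl
      lin-zero (suc i) = lin-window-outside 0 0 (suc i) (s≤s z≤n)

  order-rP₁ : ∀ r → order (r ×ᴳ P 1) ≡ r
  order-rP₁ zero    = refl
  order-rP₁ (suc r) = cong suc (order-rP₁ r)

  adj-rP₁ : ∀ r x y → adj (r ×ᴳ P 1) x y ≡ false
  adj-rP₁ (suc r) zero    zero    = refl
  adj-rP₁ (suc r) zero    (suc y) = refl
  adj-rP₁ (suc r) (suc x) zero    = refl
  adj-rP₁ (suc r) (suc x) (suc y) = adj-rP₁ r x y

  splitAt-inj₁ : ∀ s {r} (x : Fin (suc s + r)) {i} → splitAt (suc s) x ≡ inj₁ i → toℕ i ≡ toℕ x
  splitAt-inj₁ s {r} x {i} eq = trans (sym (Fin.toℕ-↑ˡ i r)) (cong toℕ (Fin.splitAt⁻¹-↑ˡ eq))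

  splitAt-inj₂ : ∀ s {r} (x : Fin (suc s + r)) {i} → splitAt (suc s) x ≡ inj₂ i → s < toℕ x
  splitAt-inj₂ s x {i} eq = subst (s <_) (trans (sym (Fin.toℕ-↑ʳ (suc s) i)) (cong toℕ (Fin.splitAt⁻¹-↑ʳ {m = suc s} eq)))
    (ℕ.m≤m+n (suc s) (toℕ i))

  adj-linearForest : ∀ s r x y → adj (P (suc s) ∪ᴳ r ×ᴳ P 1) x y ≡ lin (window 0 s) (toℕ x) (toℕ y)
  adj-linearForest s r x y with splitAt (suc s) x in eqx | splitAt (suc s) y in eqy
  ... | inj₁ i | inj₁ j = trans (path-lin s (toℕ i) (toℕ j) (Fin.toℕ≤pred[n] i) (Fin.toℕ≤pred[n] j))
                                (cong₂ (lin (window 0 s)) (splitAt-inj₁ s x eqx) (splitAt-inj₁ s y eqy))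
  ... | inj₁ i | inj₂ j = sym (lin-window-outside s (toℕ x) (toℕ y) (splitAt-inj₂ s y eqy))
  ... | inj₂ i | inj₁ j = sym (trans (lin-sym (window 0 s) (toℕ x) (toℕ y)) (lin-window-outside s (toℕ y) (toℕ x) (splitAt-inj₂ s x eqx)))
  ... | inj₂ i | inj₂ j = trans (adj-rP₁ r i j) (sym (lin-window-outside s (toℕ x) (toℕ y) (splitAt-inj₂ s y eqy)))

  -- The test `1 ∣? r` is stuck for a variable `r`, so its branch is selected propositionally.
  H-OP≡ : ∀ n n₁ → H-OP n n₁ 1 ≡ P n₁ ∪ᴳ (n ∸ 1 ∸ n₁) ×ᴳ P 1
  H-OP≡ n n₁ = trans
    (cong (λ c → if c then P n₁ ∪ᴳ (r div 1) ×ᴳ P 1 else P n₁ ∪ᴳ (r div 1) ×ᴳ P 1 ∪ᴳ P (r ∸ (r div 1) * 1))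
      (dec-true (1 ∣? r) (1∣ r)))
    (cong (λ q → P n₁ ∪ᴳ q ×ᴳ P 1) (n/1≡n r))
    where
    r : ℕ
    r = n ∸ 1 ∸ n₁

  -- The path on 2 t - 1 vertices has 2 t - 2 edges, and `window` counts edges.
  extremal≅Fan : ∀ t m → 1 ≤ t → 2 * t ≤ m → K 1 ∨ᴳ H-OP (suc m) (2 * t ∸ 1) 1 ≅ Fan m (window 0 (2 * t ∸ 2))
  extremal≅Fan t m 1≤t 2t≤m = subst (λ H → K 1 ∨ᴳ H ≅ Fan m (window 0 s))
    (trans (cong (λ k → P k ∪ᴳ (m ∸ k) ×ᴳ P 1) (sym n₁≡)) (sym (H-OP≡ (suc m) (2 * t ∸ 1))))
    (K₁∨≅Fan m (window 0 s) (P (suc s) ∪ᴳ (m ∸ suc s) ×ᴳ P 1)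
      (trans (cong (suc s +_) (order-rP₁ (m ∸ suc s))) (ℕ.m+[n∸m]≡n (subst (_≤ m) n₁≡ (ℕ.≤-trans (ℕ.m∸n≤m (2 * t) 1) 2t≤m))))
      (adj-linearForest s (m ∸ suc s)))
    where
    s : ℕ
    s = 2 * t ∸ 2
    n₁≡ : 2 * t ∸ 1 ≡ suc s
    n₁≡ = ℕ.+-∸-assoc 1 (ℕ.*-monoʳ-≤ 2 1≤t)

-- Comparison with the extremal radius

module Comparison where

  import Data.Nat.Solver as ℕSolver
  open import Data.Rational.Base hiding (_≃_)
  open import Data.Rational.Properties
  open import Defs using (K)
  open RationalSums
  open Subinvariance
  open EigenvalueApproximation
  open GeometricSequences
  open HubGraphs
  open HubEigenpair
  open UpperBounds
  open Graphs
  open Fans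
  open FanProperties

  adjs≤ones : ∀ m b → adjs m b ℕ.≤ ones m b
  adjs≤ones zero    b = z≤n
  adjs≤ones (suc m) b = ℕ.+-mono-≤
    (ℕ.≤-trans (ℕ.*-monoʳ-≤ (edge₀ m b) (edge₀≤1 (ℕ.pred m) (b ∘ suc))) (ℕ.≤-reflexive (ℕ.*-identityʳ (edge₀ m b))))
    (adjs≤ones m (b ∘ suc))

  SubEigen-weaken : ∀ {n} {A : Fin n → Fin n → Bool} {q ε ε′} → ε ≤ ε′ → SubEigen A q ε → SubEigen A q ε′
  SubEigen-weaken {A = A} ε≤ε′ se = record
    { x = x ; 0≤x = 0≤x ; x≤1 = x≤1 ; top = top ; x-top = x-top ; 0≤q = 0≤q
    ; sub = λ i → ≤-trans (sub i) (+-monoʳ-≤ ((A ⊙ x) i) ε≤ε′) }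
    where open SubEigen se

  <ᵣ⇒≤ᵣ : ∀ x y → x <ᵣ y → x ≤ᵣ y
  <ᵣ⇒≤ᵣ x y (δ , 0<δ , ev) ε 0<ε = ev-map (λ k h → ≤-trans (≤-by {d = δ} refl (<⇒≤ 0<δ)) (≤-trans h (≤-by {d = ε} refl (<⇒≤ 0<ε)))) ev

  <ᵣ-irrefl : ∀ x → ¬ (x <ᵣ x)
  <ᵣ-irrefl x (δ , 0<δ , N , h) = <-irrefl refl (<-≤-trans (<-by {d = δ} refl 0<δ) (h N ℕ.≤-refl))

  root-bound : ∀ r q ε τ → 0ℚ ≤ q → 0ℚ ≤ τ → fromℕ 2 * ε ≤ τ * τ → r * r ≤ q * q + fromℕ 2 * ε → r ≤ q + τ
  root-bound r q ε τ 0≤q 0≤τ 2ε≤τ² r²≤ = square-cancel-≤ (0≤q ⊕ 0≤τ) (≤-trans r²≤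
    (≤-trans (+-monoʳ-≤ (q * q) 2ε≤τ²)
      (≤-by (solve 2 (λ q τ → (q :+ τ) :* (q :+ τ) := q :* q :+ τ :* τ :+ # 2 :* q :* τ) refl q τ)
            (0≤fromℕ 2 ⊗ 0≤q ⊗ 0≤τ))))

  -- The margin is uniform in q because the q extracted from an eigenvector changes with the stage.
  Gap : ∀ {n} → (Fin n → Fin n → Bool) → ℝ → Set
  Gap A ρ = ∃ λ ε → ∃ λ δ → 0ℚ < ε × 0ℚ < δ × Eventually (λ k → ∀ q → SubEigen A q ε → q + δ ≤ seq ρ k)

  gap⇒< : ∀ {n} (A : Fin n → Fin n → Bool) → (∀ i j → A i j ≡ A j i) → ∀ ρ → Gap A ρ →
    ∀ μ r → IsEigenvalue (λ i j → bitᶜ (A i j)) μ → IsModulus r μ → r <ᵣ ρ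
  gap⇒< A A-sym ρ (ε , δ , 0<ε , 0<δ , gap) μ r eig mod =
    -- One half of δ absorbs the passage from r² to q², the other half is the final margin.
    ½ * δ , 0<½δ , ev-map₂ (λ k below (q , se , r²≤) → begin
        seq r k + ½ * δ ≤⟨ +-monoˡ-≤ (½ * δ) (root-bound (seq r k) q ε₁ (½ * δ) (SubEigen.0≤q se) (<⇒≤ 0<½δ) 2ε₁≤ r²≤) ⟩
        q + ½ * δ + ½ * δ ≡⟨ solve 2 (λ q d → q :+ con ½ :* d :+ con ½ :* d := q :+ d) refl q δ ⟩
        q + δ ≤⟨ below q (SubEigen-weaken (p⊓q≤q (ε₂ ⊓ 1ℚ) ε) se) ⟩
        seq ρ k ∎)
      gap (eigenvalue⇒subEigen A A-sym μ r eig mod ε₁ 0<ε₁ (≤-trans (p⊓q≤p (ε₂ ⊓ 1ℚ) ε) (p⊓q≤q ε₂ 1ℚ)))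
    where
    open ≤-Reasoning
    0<½δ : 0ℚ < ½ * δ
    0<½δ = *-pos (positive⁻¹ ½) 0<δ
    small : ∃ λ ε₂ → 0ℚ < ε₂ × fromℕ 2 * ε₂ ≤ ½ * δ * (½ * δ)
    small = small-multiple (fromℕ 2) (½ * δ * (½ * δ)) (0<1+ 1) (*-pos 0<½δ 0<½δ)
    ε₂ ε₁ : ℚ
    ε₂ = proj₁ small
    ε₁ = (ε₂ ⊓ 1ℚ) ⊓ ε
    0<ε₁ : 0ℚ < ε₁
    0<ε₁ = ⊓-pos (⊓-pos (proj₁ (proj₂ small)) (positive⁻¹ 1ℚ)) 0<ε
    2ε₁≤ : fromℕ 2 * ε₁ ≤ ½ * δ * (½ * δ)
    2ε₁≤ = ≤-trans (*-monoˡ (0≤fromℕ 2) (≤-trans (p⊓q≤p (ε₂ ⊓ 1ℚ) ε) (p⊓q≤p ε₂ 1ℚ))) (proj₂ (proj₂ small))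

  noHub-deg : ∀ {m} (A : Fin (suc m) → Fin (suc m) → Bool) → (∀ v → A v v ≡ false) →
    ∀ u v → v ≢ u → ¬ T (A u v) → Degrees.deg A u ≤ fromℕ m - 1ℚ
  noHub-deg {m} A A-irrefl u v v≢u uv = begin
      ∑ (λ j → ⟦ A u j ⟧)
        ≤⟨ ∑-mono term ⟩
      ∑ (λ j → (1ℚ + - kronecker u j) + - kronecker v j)
        ≡⟨ trans (∑-+ (λ j → 1ℚ + - kronecker u j) _) (cong₂ _+_ (∑-+ (λ _ → 1ℚ) (λ j → - kronecker u j)) (trans (∑-neg (kronecker v)) (cong -_ (total v)))) ⟩
      (∑ {suc m} (λ _ → 1ℚ) + ∑ (λ j → - kronecker u j)) + - 1ℚ
        ≡⟨ cong₂ (λ a b → (a + b) + - 1ℚ) (trans (∑-const (suc m) 1ℚ) (trans (*-identityʳ (fromℕ (suc m))) (fromℕ-+ 1 m))) (trans (∑-neg (kronecker u)) (cong -_ (total u))) ⟩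
      (1ℚ + fromℕ m + - 1ℚ) + - 1ℚ
        ≡⟨ solve 1 (λ M → (con 1ℚ :+ M :+ :- con 1ℚ) :+ :- con 1ℚ := M :- con 1ℚ) refl (fromℕ m) ⟩
      fromℕ m - 1ℚ ∎
    where
    open ≤-Reasoning
    total : ∀ w → ∑ (kronecker w) ≡ 1ℚ
    total w = trans (∑-cong λ j → sym (*-identityʳ (kronecker w j))) (∑-kronecker w (λ _ → 1ℚ))
    term : ∀ j → ⟦ A u j ⟧ ≤ (1ℚ + - kronecker u j) + - kronecker v j
    term j with u Fin.≟ j | v Fin.≟ j
    ... | yes refl | yes refl = ⊥-elim (v≢u refl)
    ... | yes refl | no _     = ≤-reflexive (cong ⟦_⟧ (A-irrefl u))
    ... | no _     | yes refl = ≤-reflexive (cong ⟦_⟧ (¬T⇒≡false uv))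
    ... | no _     | no _     = ⟦ A u j ⟧≤1

  module Extremal (t m : ℕ) (1≤t : 1 ℕ.≤ t)
    (big : suc (28 ℕ.* (suc t ℕ.* suc t) ℕ.* (28 ℕ.* (suc t ℕ.* suc t))) ℕ.≤ m) where

    s Q : ℕ
    s = 2 ℕ.* t ℕ.∸ 2
    Q = 28 ℕ.* (suc t ℕ.* suc t)

    -- From (t + 1)² ≥ 4 t. The bounds linear in t that are needed against Q or m have coefficient
    -- at most 112.
    112t≤Q : 112 ℕ.* t ℕ.≤ Q
    112t≤Q = go t 1≤t
      where
      open ℕSolver.+-*-Solver renaming (solve to solveℕ; _:+_ to _⊹_; _:*_ to _⊛_; _:=_ to _≐_; con to lit)
      go : ∀ t → 1 ℕ.≤ t → 112 ℕ.* t ℕ.≤ 28 ℕ.* (suc t ℕ.* suc t)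
      go (suc r) _ = ℕ.≤-trans (ℕ.m≤m+n (112 ℕ.* suc r) (28 ℕ.* (r ℕ.* r))) (ℕ.≤-reflexive
        (solveℕ 1 (λ r → lit 112 ⊛ (lit 1 ⊹ r) ⊹ lit 28 ⊛ (r ⊛ r) ≐ lit 28 ⊛ ((lit 2 ⊹ r) ⊛ (lit 2 ⊹ r))) refl r))

    s≤2t : s ℕ.≤ 2 ℕ.* t
    s≤2t = ℕ.m∸n≤m (2 ℕ.* t) 2

    multiple≤Q : ∀ c → c ℕ.≤ 112 → c ℕ.* t ℕ.≤ Q
    multiple≤Q c c≤112 = ℕ.≤-trans (ℕ.*-monoˡ-≤ t c≤112) 112t≤Q

    112≤Q : 112 ℕ.≤ Q
    112≤Q = ℕ.≤-trans (ℕ.*-monoʳ-≤ 112 1≤t) 112t≤Q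

    Q<m : Q ℕ.< m
    Q<m = ℕ.≤-trans (s≤s (ℕ.m≤m*n Q Q {{ℕ.>-nonZero (ℕ.≤-trans (s≤s z≤n) 112≤Q)}})) big

    2t<m : 2 ℕ.* t ℕ.< m
    2t<m = ℕ.≤-<-trans (multiple≤Q 2 (s≤s (s≤s z≤n))) Q<m

    s<m : s ℕ.< m
    s<m = ℕ.≤-<-trans s≤2t 2t<m

    M R τ N : ℚ
    M = fromℕ m
    τ = fromℕ t
    R = fromℕ 28 * ((τ + 1ℚ) * (τ + 1ℚ))
    N = M + 1ℚ

    Q≡R : fromℕ Q ≡ R
    Q≡R = trans (fromℕ-* 28 (suc t ℕ.* suc t)) (cong (fromℕ 28 *_) (trans (fromℕ-* (suc t) (suc t))
      (cong (λ x → x * x) (trans (fromℕ-+ 1 t) (+-comm 1ℚ τ)))))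

    R²+1≤M : R * R + 1ℚ ≤ M
    R²+1≤M = ≤-trans (≤-reflexive (trans (cong (λ x → x * x + 1ℚ) (sym Q≡R)) (trans (cong (_+ 1ℚ) (sym (fromℕ-* Q Q)))
      (trans (+-comm (fromℕ (Q ℕ.* Q)) 1ℚ) (sym (fromℕ-+ 1 (Q ℕ.* Q))))))) (fromℕ-mono-≤ {suc (Q ℕ.* Q)} {m} big)

    size : R * R ≤ M - ¼
    size = ≤-by (solve 2 (λ r M → M :- con ¼ := r :+ (M :- (r :+ con 1ℚ) :+ con ¾)) refl (R * R) M)
      (≤⇒0≤- R²+1≤M ⊕ nonNegative⁻¹ ¾)

    B : Fin m → Fin m → Bool
    B = segments m (window 0 s)

    W₁≡ : Degrees.W₁ B ≡ fromℕ (2 ℕ.* s)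
    W₁≡ = trans (segments-W₁ m (window 0 s)) (cong (λ o → fromℕ (2 ℕ.* o)) (ones-window m s s<m))

    8W₁≤m : fromℕ 8 * Degrees.W₁ B ≤ fromℕ m
    8W₁≤m = subst (_≤ M) (trans (fromℕ-* 8 (2 ℕ.* s)) (cong (fromℕ 8 *_) (sym W₁≡)))
      (fromℕ-mono-≤ {8 ℕ.* (2 ℕ.* s)} {m} (ℕ.<⇒≤ (ℕ.≤-<-trans
        (ℕ.≤-trans (ℕ.*-monoʳ-≤ 8 (ℕ.*-monoʳ-≤ 2 s≤2t)) (ℕ.≤-trans (ℕ.≤-reflexive (trans (cong (8 ℕ.*_) (sym (ℕ.*-assoc 2 2 t))) (sym (ℕ.*-assoc 8 4 t))))
          (multiple≤Q 32 (ℕ.m≤m+n 32 80)))) Q<m)))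

    16≤m : fromℕ 16 ≤ fromℕ m
    16≤m = fromℕ-mono-≤ {16} {m} (ℕ.<⇒≤ (ℕ.≤-<-trans (ℕ.≤-trans (ℕ.m≤m+n 16 96) 112≤Q) Q<m))

    open Eigenpair B (segments-sym m (window 0 s)) (segments-deg≤2 m (window 0 s)) 8W₁≤m 16≤m
      using (ρ; P; charpoly; charpoly-P; isEigenvalue; isModulus; subEigen≤; module Orbit; E; 0≤E)

    Std : Graph
    Std = Fan m (window 0 s)

    private
      open Degrees B using (W₁; W₂; 0≤deg)

      0≤M : 0ℚ ≤ M
      0≤M = 0≤fromℕ m

      1≤N : 1ℚ ≤ N
      1≤N = ≤-by (+-comm M 1ℚ) 0≤M

      0≤N : 0ℚ ≤ N
      0≤N = ≤-trans (nonNegative⁻¹ 1ℚ) 1≤N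

      N³ : ℚ
      N³ = N * N * N

      0<N : 0ℚ < N
      0<N = <-≤-trans (positive⁻¹ 1ℚ) 1≤N

      0<N³ : 0ℚ < N³
      0<N³ = *-pos (*-pos 0<N 0<N) 0<N

      0≤N³ : 0ℚ ≤ N³
      0≤N³ = <⇒≤ 0<N³

      N≤N³ : N ≤ N³
      N≤N³ = ≤-trans (≤-reflexive (sym (*-identityˡ N))) (*-monoʳ 0≤N (*-mono 0≤N (nonNegative⁻¹ 1ℚ) 1≤N 1≤N))

      M≤N³ : M ≤ N³
      M≤N³ = ≤-trans (≤-by {d = 1ℚ} refl (nonNegative⁻¹ 1ℚ)) N≤N³

      -- Multiples of N³ dominate all error coefficients: 2 N³ without a hub, against 1/100, which
      -- accounts for 200, and 4 N³ with a hub, against ½.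
      ε-choice : ∃ λ ε → 0ℚ < ε × fromℕ 200 * N³ * ε ≤ 1ℚ
      ε-choice = small-multiple (fromℕ 200 * N³) 1ℚ (*-pos (0<1+ 199) 0<N³) (positive⁻¹ 1ℚ)

      ε₀ : ℚ
      ε₀ = proj₁ ε-choice

      0<ε₀ : 0ℚ < ε₀
      0<ε₀ = proj₁ (proj₂ ε-choice)

      0≤ε₀ : 0ℚ ≤ ε₀
      0≤ε₀ = <⇒≤ 0<ε₀

      N³ε₀≤ : N³ * ε₀ ≤ (ℤ.+ 1) / 200
      N³ε₀≤ = *-cancelˡ (0<1+ 199) (≤-trans (≤-reflexive (sym (*-assoc (fromℕ 200) N³ ε₀))) (proj₂ (proj₂ ε-choice)))

      ε₀≤1 : ε₀ ≤ 1ℚ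
      ε₀≤1 = ≤-trans (≤-trans (≤-reflexive (sym (*-identityˡ ε₀))) (*-monoʳ 0≤ε₀ (≤-trans 1≤N N≤N³)))
        (≤-trans N³ε₀≤ (≤-by {d = (ℤ.+ 199) / 200} refl (nonNegative⁻¹ ((ℤ.+ 199) / 200))))

      -- 4 N³ bounds both p + q and the difference quotient `slope` used in `Separate`.
      δ-choice : ∃ λ δ → 0ℚ < δ × fromℕ 4 * N³ * δ ≤ (ℤ.+ 1) / 8
      δ-choice = small-multiple (fromℕ 4 * N³) ((ℤ.+ 1) / 8) (*-pos (0<1+ 3) 0<N³) (positive⁻¹ ((ℤ.+ 1) / 8))

      δ : ℚ
      δ = proj₁ δ-choice

      ⅛ : ℚ
      ⅛ = (ℤ.+ 1) / 8

      -- Two ways of lying below ρ: below √M with room to spare, or in the range where `charpoly`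
      -- has nonnegative difference quotients, with a value clearly below the one at ρ.
      Low : ℚ → Set
      Low q = q * q ≤ M - ¼ ⊎ (M - ¼ ≤ q * q × charpoly q ≤ - ¼)

      W₁+1≤M : W₁ + 1ℚ ≤ M
      W₁+1≤M = ≤-trans (≤-reflexive (trans (cong (_+ 1ℚ) W₁≡) (trans (+-comm (fromℕ (2 ℕ.* s)) 1ℚ) (sym (fromℕ-+ 1 (2 ℕ.* s))))))
        (fromℕ-mono-≤ {suc (2 ℕ.* s)} {m} (ℕ.≤-<-trans (ℕ.≤-trans (ℕ.*-monoʳ-≤ 2 s≤2t) (ℕ.≤-trans (ℕ.≤-reflexive (sym (ℕ.*-assoc 2 2 t))) (multiple≤Q 4 (ℕ.m≤m+n 4 108)))) Q<m))

      module Separate {p q : ℚ} (M≤p² : M ≤ p * p) (1≤p : 1ℚ ≤ p) (p≤M : p ≤ M) (0≤q : 0ℚ ≤ q) (q≤N : q ≤ N)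
        (Fp : - ⅛ ≤ charpoly p) where

        0≤p : 0ℚ ≤ p
        0≤p = ≤-trans (nonNegative⁻¹ 1ℚ) 1≤p

        p≤N : p ≤ N
        p≤N = ≤-trans p≤M (≤-by {d = 1ℚ} refl (nonNegative⁻¹ 1ℚ))

        finish : 0ℚ ≤ p - q → ∀ c → c ≤ fromℕ 4 * N³ → ⅛ ≤ (p - q) * c → q + δ ≤ p
        finish 0≤p-q c c≤ ⅛≤ = ≤-by {d = p - q - δ} (solve 3 (λ p q d → p := q :+ d :+ (p :- q :- d)) refl p q δ)
          (≤⇒0≤- (*-cancelˡ {fromℕ 4 * N³} (*-pos (0<1+ 3) 0<N³)
            (≤-trans (proj₂ (proj₂ δ-choice)) (≤-trans ⅛≤ (≤-trans (*-monoˡ 0≤p-q c≤) (≤-reflexive (*-comm (p - q) (fromℕ 4 * N³))))))))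

        p+q≤ : p + q ≤ fromℕ 4 * N³
        p+q≤ = ≤-trans (+-mono-≤ (≤-trans p≤N N≤N³) (≤-trans q≤N N≤N³))
          (≤-by (solve 1 (λ n → # 4 :* n := n :+ n :+ # 2 :* n) refl N³) (0≤fromℕ 2 ⊗ 0≤N³))

        slope : ℚ
        slope = (p + q) * (p * p + q * q) - M * (p + q) - W₁

        charpoly-diff : charpoly p ≡ charpoly q + (p - q) * slope
        charpoly-diff = solve 5 (λ p q M w₁ w₂ →
            p :* p :* p :* p :- M :* (p :* p) :- w₁ :* p :- w₂
            := (q :* q :* q :* q :- M :* (q :* q) :- w₁ :* q :- w₂)
               :+ (p :- q) :* ((p :+ q) :* (p :* p :+ q :* q) :- M :* (p :+ q) :- w₁)) refl p q M W₁ W₂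

        slope≤ : slope ≤ fromℕ 4 * N³
        slope≤ = ≤-trans
          (≤-by (solve 4 (λ a b M w → a :* b := (a :* b :- M :* a :- w) :+ (M :* a :+ w)) refl (p + q) (p * p + q * q) M W₁)
                (0≤M ⊗ (0≤p ⊕ 0≤q) ⊕ 0≤∑ 0≤deg))
          (≤-trans (*-mono (0≤N ⊕ 0≤N) (0≤p ⊗ 0≤p ⊕ 0≤q ⊗ 0≤q) (+-mono-≤ p≤N q≤N)
              (+-mono-≤ (*-mono 0≤N 0≤p p≤N p≤N) (*-mono 0≤N 0≤q q≤N q≤N)))
            (≤-reflexive (solve 1 (λ n → (n :+ n) :* (n :* n :+ n :* n) := # 4 :* (n :* n :* n)) refl N)))

        separate : Low q → q + δ ≤ p
        separate (inj₁ q²≤) = finish (≤⇒0≤- (square-cancel-≤ 0≤p q²≤p²)) (p + q) p+q≤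
          (≤-by (solve 3 (λ p q M → (p :- q) :* (p :+ q) := con ⅛ :+ ((M :- con ¼ :- q :* q) :+ (p :* p :- M) :+ con ⅛)) refl p q M)
                (≤⇒0≤- q²≤ ⊕ ≤⇒0≤- M≤p² ⊕ nonNegative⁻¹ ⅛))
          where
          q²≤p² : q * q ≤ p * p
          q²≤p² = ≤-trans q²≤ (≤-trans (≤-by (solve 1 (λ M → M := M :- con ¼ :+ con ¼) refl M) (nonNegative⁻¹ ¼)) M≤p²)
        separate (inj₂ (M-¼≤q² , Fq)) = finish (≤⇒0≤- q≤p) slope slope≤ ⅛≤
          where
          ⅛≤ : ⅛ ≤ (p - q) * slope
          ⅛≤ = ≤-by (trans (solve 2 (λ x G → x := x :+ G :- G) refl ((p - q) * slope) (charpoly q))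
              (trans (cong (_- charpoly q) (trans (+-comm ((p - q) * slope) (charpoly q)) (sym charpoly-diff)))
                (solve 2 (λ F G → F :- G := con ⅛ :+ (F :- (:- con ⅛) :+ (:- con ¼ :- G))) refl (charpoly p) (charpoly q))))
            (≤⇒0≤- Fp ⊕ ≤⇒0≤- Fq)
          -- p² + q² ≥ 2 M - ¼ leaves at least (p + q) (M - ¼) - W₁, which is positive since p ≥ 1
          -- and W₁ ≤ M - 1.
          0≤slope : 0ℚ ≤ slope
          0≤slope = subst (0ℚ ≤_)
            (solve 4 (λ p q M w →
                (p :- con 1ℚ :+ q) :* ((p :* p :- M) :+ (q :* q :- (M :- con ¼)) :+ (M :- (w :+ con 1ℚ)) :+ (w :+ con ¾))
                :+ ((p :* p :- M) :+ (q :* q :- (M :- con ¼)) :+ (M :- (w :+ con 1ℚ)) :+ con ¾)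
                := (p :+ q) :* (p :* p :+ q :* q) :- M :* (p :+ q) :- w) refl p q M W₁)
            ((≤⇒0≤- 1≤p ⊕ 0≤q) ⊗ (≤⇒0≤- M≤p² ⊕ ≤⇒0≤- M-¼≤q² ⊕ ≤⇒0≤- W₁+1≤M ⊕ (0≤∑ 0≤deg ⊕ nonNegative⁻¹ ¾))
              ⊕ (≤⇒0≤- M≤p² ⊕ ≤⇒0≤- M-¼≤q² ⊕ ≤⇒0≤- W₁+1≤M ⊕ nonNegative⁻¹ ¾))
          q≤p : q ≤ p
          q≤p = ≮⇒≥ λ p<q → <-irrefl refl (<-≤-trans (positive⁻¹ ⅛) (≤-trans ⅛≤
            (≤-by (solve 3 (λ p q s → con 0ℚ := (p :- q) :* s :+ (q :- p) :* s) refl p q slope) (≤⇒0≤- (<⇒≤ p<q) ⊗ 0≤slope))))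

      -- At late stages the iteration error pulls `charpoly (P k)` down to -⅛ at worst. This uses
      -- half of the deficit ¼ in `Low`; the other half pays for δ.
      low⇒gap : ∀ {n} (A : Fin n → Fin n → Bool) → (∀ q → SubEigen A q ε₀ → q ≤ N × Low q) → Gap A ρ
      low⇒gap A low = ε₀ , δ , 0<ε₀ , proj₁ (proj₂ δ-choice) , ev-map (λ k small q se →
          Separate.separate (Orbit.M≤p² k) (≤-trans (fromℕ-mono-≤ {1} {4} (s≤s z≤n)) (Orbit.4≤p k)) (Orbit.p≤M k)
            (SubEigen.0≤q se) (proj₁ (low q se))
            (≤-trans (neg-antimono-≤ (≤-trans (≤-reflexive (sym (*-assoc (fromℕ 5 * (M * M * M)) E (decay k)))) small)) (charpoly-P k))
            (proj₂ (low q se)))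
        (decay→0 (fromℕ 5 * (M * M * M) * E) ⅛ (0≤fromℕ 5 ⊗ (0≤M ⊗ 0≤M ⊗ 0≤M) ⊗ 0≤E) (positive⁻¹ ⅛))

      module HubCase (b : ℕ → Bool)
        (fewer : suc (ones m b) ℕ.≤ s ⊎ (ones m b ≡ s × 2 ℕ.+ adjs m b ℕ.≤ s)) where

        private
          o a : ℕ
          o = ones m b
          a = adjs m b
          B′ : Fin m → Fin m → Bool
          B′ = segments m b
          W₁′ W₂′ : ℚ
          W₁′ = Degrees.W₁ B′
          W₂′ = Degrees.W₂ B′

          o≤s : o ℕ.≤ s
          o≤s = go fewer
            where
            go : suc o ℕ.≤ s ⊎ (o ≡ s × 2 ℕ.+ a ℕ.≤ s) → o ℕ.≤ s
            go (inj₁ o<s)       = ℕ.<⇒≤ o<s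
            go (inj₂ (o≡s , _)) = ℕ.≤-reflexive o≡s

          o+a≤ : 2 ℕ.* (o ℕ.+ a) ℕ.≤ 8 ℕ.* t
          o+a≤ = ℕ.≤-trans (ℕ.*-monoʳ-≤ 2 (ℕ.+-mono-≤ (ℕ.≤-trans o≤s s≤2t) (ℕ.≤-trans (ℕ.≤-trans (adjs≤ones m b) o≤s) s≤2t)))
            (ℕ.≤-reflexive (trans (cong (2 ℕ.*_) (sym (ℕ.*-distribʳ-+ t 2 2))) (sym (ℕ.*-assoc 2 4 t))))

          W₂′≤M : W₂′ ≤ M
          W₂′≤M = ≤-trans (≤-reflexive (segments-W₂ m b)) (fromℕ-mono-≤ {2 ℕ.* (o ℕ.+ a)} {m}
            (ℕ.<⇒≤ (ℕ.≤-<-trans (ℕ.≤-trans o+a≤ (multiple≤Q 8 (ℕ.m≤m+n 8 104))) Q<m)))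

          8W₂′≤Q : fromℕ 8 * W₂′ ≤ R
          8W₂′≤Q = subst₂ _≤_ (trans (fromℕ-* 8 (2 ℕ.* (o ℕ.+ a))) (cong (fromℕ 8 *_) (sym (segments-W₂ m b)))) Q≡R
            (fromℕ-mono-≤ {8 ℕ.* (2 ℕ.* (o ℕ.+ a))} {Q} (ℕ.≤-trans (ℕ.*-monoʳ-≤ 8 o+a≤)
              (ℕ.≤-trans (ℕ.≤-reflexive (sym (ℕ.*-assoc 8 8 t))) (multiple≤Q 64 (ℕ.m≤m+n 64 48)))))

          W₁′≤W₁ : W₁′ ≤ W₁
          W₁′≤W₁ = subst₂ _≤_ (sym (segments-W₁ m b)) (sym W₁≡) (fromℕ-mono-≤ {2 ℕ.* o} {2 ℕ.* s} (ℕ.*-monoʳ-≤ 2 o≤s))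

          0≤W₁′ : 0ℚ ≤ W₁′
          0≤W₁′ = 0≤∑ (Degrees.0≤deg B′)

          W₂≡ : W₂ ≡ fromℕ (2 ℕ.* (s ℕ.+ ℕ.pred s))
          W₂≡ = trans (segments-W₂ m (window 0 s)) (cong₂ (λ x y → fromℕ (2 ℕ.* (x ℕ.+ y))) (ones-window m s s<m) (go s s<m))
            where
            go : ∀ s → s ℕ.< m → adjs m (window 0 s) ≡ ℕ.pred s
            go zero    _   = adjs-zero m (window 0 0) (λ _ → refl)
            go (suc s) s<m = adjs-window m s s<m

          scaled : ∀ k l → suc k ℕ.≤ l → fromℕ (2 ℕ.* k) + fromℕ 2 ≤ fromℕ (2 ℕ.* l)
          scaled k l k<l = ≤-trans (≤-reflexive (trans (sym (fromℕ-+ (2 ℕ.* k) 2)) (cong fromℕ (trans (ℕ.+-comm (2 ℕ.* k) 2) (sym (ℕ.*-suc 2 k))))))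
            (fromℕ-mono-≤ {2 ℕ.* suc k} {2 ℕ.* l} (ℕ.*-monoʳ-≤ 2 k<l))

          -- W₁ carries the factor q ≥ 1, so a loss of 2 in W₁, or in W₂ at equal W₁, costs 2.
          deficit : ∀ q → 1ℚ ≤ q → q * W₁′ + W₂′ + fromℕ 2 ≤ q * W₁ + W₂
          deficit q 1≤q = go fewer
            where
            0≤q : 0ℚ ≤ q
            0≤q = ≤-trans (nonNegative⁻¹ 1ℚ) 1≤q
            go : suc o ℕ.≤ s ⊎ (o ≡ s × 2 ℕ.+ a ℕ.≤ s) → q * W₁′ + W₂′ + fromℕ 2 ≤ q * W₁ + W₂
            go (inj₁ o<s) = ≤-by
              (solve 5 (λ q w₁ w₂ v₁ v₂ → q :* w₁ :+ w₂ := q :* v₁ :+ v₂ :+ # 2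
                  :+ (q :* (w₁ :- (v₁ :+ # 2)) :+ # 2 :* (q :- con 1ℚ) :+ (w₂ :- v₂))) refl q W₁ W₂ W₁′ W₂′)
              (0≤q ⊗ ≤⇒0≤- (subst₂ _≤_ (cong (_+ fromℕ 2) (sym (segments-W₁ m b))) (sym W₁≡) (scaled o s o<s))
                ⊕ 0≤fromℕ 2 ⊗ ≤⇒0≤- 1≤q
                ⊕ ≤⇒0≤- (subst₂ _≤_ (sym (segments-W₂ m b)) (sym W₂≡) (fromℕ-mono-≤ {2 ℕ.* (o ℕ.+ a)} {2 ℕ.* (s ℕ.+ ℕ.pred s)}
                    (ℕ.*-monoʳ-≤ 2 (ℕ.+-mono-≤ (ℕ.<⇒≤ o<s) (ℕ.≤-trans (adjs≤ones m b) (ℕ.≤-pred (ℕ.≤-trans o<s (suc-pred s)))))))))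
              where
              suc-pred : ∀ s → s ℕ.≤ suc (ℕ.pred s)
              suc-pred zero    = z≤n
              suc-pred (suc s) = ℕ.≤-refl
            go (inj₂ (o≡s , 2+a≤s)) = ≤-by
              (solve 5 (λ q w₁ w₂ v₁ v₂ → q :* w₁ :+ w₂ := q :* v₁ :+ v₂ :+ # 2
                  :+ (q :* (w₁ :- v₁) :+ (w₂ :- (v₂ :+ # 2)))) refl q W₁ W₂ W₁′ W₂′)
              (0≤q ⊗ ≤⇒0≤- W₁′≤W₁ ⊕ ≤⇒0≤- (subst₂ _≤_ (cong (_+ fromℕ 2) (sym (segments-W₂ m b))) (sym W₂≡)
                (scaled (o ℕ.+ a) (s ℕ.+ ℕ.pred s) (ℕ.≤-trans (ℕ.≤-reflexive (sym (ℕ.+-suc o a)))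
                  (ℕ.+-mono-≤ (ℕ.≤-reflexive o≡s) (ℕ.pred-mono-≤ 2+a≤s))))))

        module HighCase (q : ℚ) (se : SubEigen (hubAdj B′) q ε₀) (q≤N : q ≤ N) (≤q² : M - ¼ ≤ q * q) where
          0≤q : 0ℚ ≤ q
          0≤q = SubEigen.0≤q se
          R≤q : R ≤ q
          R≤q = square-cancel-≤ 0≤q (≤-trans size ≤q²)
          4<q : fromℕ 4 < q
          4<q = <-≤-trans (fromℕ-mono-< {4} {Q} (ℕ.≤-trans (ℕ.m≤m+n 5 107) 112≤Q)) (≤-trans (≤-reflexive Q≡R) R≤q)
          error : ℚ
          error = (W₂′ + q * W₁′ + q * q * (M + q)) * ε₀
          M≤N : M ≤ N
          M≤N = ≤-by {d = 1ℚ} refl (nonNegative⁻¹ 1ℚ)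
          W₁′≤N : W₁′ ≤ N
          W₁′≤N = ≤-trans W₁′≤W₁ (≤-trans (≤-by {d = 1ℚ} refl (nonNegative⁻¹ 1ℚ)) (≤-trans W₁+1≤M M≤N))
          qW₁′≤N³ : q * W₁′ ≤ N³
          qW₁′≤N³ = ≤-trans (*-mono 0≤N 0≤W₁′ q≤N W₁′≤N) (≤-trans (≤-reflexive (sym (*-identityʳ (N * N)))) (*-monoˡ (0≤N ⊗ 0≤N) 1≤N))
          q²Mq≤ : q * q * (M + q) ≤ N³ + N³
          q²Mq≤ = ≤-trans (*-mono (0≤N ⊗ 0≤N) (0≤M ⊕ 0≤q) (*-mono 0≤N 0≤q q≤N q≤N) (+-mono-≤ M≤N q≤N))
            (≤-reflexive (*-distribˡ-+ (N * N) N N))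
          error≤ : error ≤ ½
          error≤ = ≤-trans (*-monoʳ 0≤ε₀ (+-mono-≤ (+-mono-≤ (≤-trans W₂′≤M M≤N³) qW₁′≤N³) q²Mq≤))
            (≤-trans (≤-reflexive (solve 2 (λ n e → (n :+ n :+ (n :+ n)) :* e := # 4 :* (n :* e)) refl N³ ε₀))
              (≤-trans (*-monoˡ (0≤fromℕ 4) N³ε₀≤) (≤-by {d = (ℤ.+ 12) / 25} refl (nonNegative⁻¹ ((ℤ.+ 12) / 25)))))
          -- κ = 1 is admissible because 8 W₂′ ≤ 64 t ≤ R ≤ q.
          F′≤ : q * q * q * q - M * (q * q) - W₁′ * q - W₂′ ≤ 1ℚ + error
          F′≤ = charpoly-subEigen B′ (segments-sym m b) (segments-deg≤2 m b) se 0≤ε₀ ε₀≤1 4<q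
            (≤-trans 8W₂′≤Q (≤-trans R≤q (≤-reflexive (sym (*-identityʳ q)))))
          -- The deficit 2 exceeds the remainder 1 plus the error ½ by ½, of which ¼ is given away.
          Fq : charpoly q ≤ - ¼
          Fq = ≤-by (solve 7 (λ q M w₁ w₂ v₁ v₂ e →
                :- con ¼ := (q :* q :* q :* q :- M :* (q :* q) :- w₁ :* q :- w₂)
                  :+ ((con 1ℚ :+ e :- (q :* q :* q :* q :- M :* (q :* q) :- v₁ :* q :- v₂))
                      :+ (q :* w₁ :+ w₂ :- (q :* v₁ :+ v₂ :+ # 2)) :+ (con ½ :- e) :+ con ¼)) refl q M W₁ W₂ W₁′ W₂′ error)
            (≤⇒0≤- F′≤ ⊕ ≤⇒0≤- (deficit q (≤-trans (fromℕ-mono-≤ {1} {4} (s≤s z≤n)) (<⇒≤ 4<q))) ⊕ ≤⇒0≤- error≤ ⊕ nonNegative⁻¹ ¼)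

        low : ∀ q → SubEigen (hubAdj B′) q ε₀ → q ≤ N × Low q
        low q se = q≤N , dichotomy
          where
          q≤N : q ≤ N
          -- `q≤M+ε` presupposes 4 < q; any q up to 5 is below 16 ≤ m.
          q≤N = go (≤-total q (fromℕ 5))
            where
            go : q ≤ fromℕ 5 ⊎ fromℕ 5 ≤ q → q ≤ N
            go (inj₁ q≤5) = ≤-trans q≤5 (≤-trans (fromℕ-mono-≤ {5} {16} (ℕ.m≤m+n 5 11)) (≤-trans 16≤m (≤-by {d = 1ℚ} refl (nonNegative⁻¹ 1ℚ))))
            go (inj₂ 5≤q) = ≤-trans (q≤M+ε B′ (segments-sym m b) (segments-deg≤2 m b) se 0≤ε₀ ε₀≤1
              (<-≤-trans (fromℕ-mono-< {4} {5} ℕ.≤-refl) 5≤q)) (+-monoʳ-≤ M ε₀≤1)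
          dichotomy : Low q
          dichotomy = go (≤-total (q * q) (M - ¼))
            where
            go : q * q ≤ M - ¼ ⊎ M - ¼ ≤ q * q → Low q
            go (inj₁ q²≤) = inj₁ q²≤
            go (inj₂ ≤q²) = inj₂ (≤q² , HighCase.Fq q se q≤N ≤q²)

    F : Graph
    F = (t ℕ.+ 1) ×ᴳ K 2

    Below : Graph → Set
    Below G = ∀ μ r → IsEigenvalue (adjacencyMatrix G) μ → IsModulus r μ → r <ᵣ ρ

    -- A forest falls short by having fewer than s edges, or by spreading s edges over two or more
    -- paths. A single path differs from the standard one only by isolated vertices in front, which
    -- can be moved to the end.
    fan-dichotomy : ∀ b → Normal m b → Free F (Fan m b) → Std ≅ Fan m b ⊎ Below (Fan m b)
    fan-dichotomy b normal free = go (ones m b ℕ.≟ s) (shape m b normal)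
      where
      ones≤s : ones m b ℕ.≤ s
      ones≤s = ℕ.≤-trans (ℕ.≤-reflexive (sym (ℕ.m+n∸m≡n 2 (ones m b)))) (ℕ.∸-monoˡ-≤ 2 (ones-bound m b t 2t<m free))
      below : suc (ones m b) ℕ.≤ s ⊎ (ones m b ≡ s × 2 ℕ.+ adjs m b ℕ.≤ s) → Below (Fan m b)
      below fewer = gap⇒< (hubAdj (segments m b)) (hubAdj-sym (segments-sym m b)) ρ
        (low⇒gap (hubAdj (segments m b)) (HubCase.low b fewer))
      go : Dec (ones m b ≡ s) → Shape m b → Std ≅ Fan m b ⊎ Below (Fan m b)
      go (no ones≢s) _ = inj₂ (below (inj₁ (ℕ.≤∧≢⇒< ones≤s ones≢s)))
      go (yes ones≡s) (scattered gap) = inj₂ (below (inj₂ (ones≡s , subst (2 ℕ.+ adjs m b ℕ.≤_) ones≡s gap)))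
      go (yes ones≡s) (empty none) = inj₁ (subst (λ z → Fan m (window 0 z) ≅ Fan m b)
        (trans (sym (ones-zero m b none)) ones≡s) (Fan-cong m {window 0 0} {b} (λ i → sym (none i))))
      go (yes ones≡s) (segment k z ones≡ fits _ b≡) = inj₁ (subst (λ z → Fan m (window 0 z) ≅ Fan m b)
        (trans (sym ones≡) ones≡s)
        (≅-sym {Fan m b} {Fan m (window 0 (suc z))} (≅-trans {Fan m b} {Fan m (window k (suc z))} {Fan m (window 0 (suc z))}
          (Fan-cong m {b} {window k (suc z)} b≡) (Fan-window≅ k (suc z) m fits))))

    -- Whether some vertex is a hub is a decidable question on a finite graph; this replaces any
    -- case distinction on real numbers.
    dichotomy : ∀ G → OuterplanarFree (suc m) F G → Std ≅ G ⊎ Below G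
    dichotomy G@record { order = .(suc m) ; adj = A ; adj-sym = A-sym ; adj-irrefl = A-irrefl } ofree@(refl , outer@(pos , pos-inj , planar) , free)
      = split (Fin.any? (λ u → Fin.all? (λ v → Fin._≟_ v u ⊎-dec T? (A u v))))
      where
      hub-adj : ∀ {u v} → v ≢ u → v ≡ u ⊎ T (A u v) → T (A u v)
      hub-adj v≢u (inj₁ v≡u) = ⊥-elim (v≢u v≡u)
      hub-adj v≢u (inj₂ uv)  = uv
      via : (∃ λ b → Normal m b × Fan m b ≅ G) → Std ≅ G ⊎ Below G
      via (b , normal , iso) = go (fan-dichotomy b normal (proj₂ (proj₂ (OuterplanarFree-≅ {suc m} {F} {G} {Fan m b} (≅-sym {Fan m b} {G} iso) ofree))))
        where
        go : Std ≅ Fan m b ⊎ Below (Fan m b) → Std ≅ G ⊎ Below G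
        go (inj₁ std)   = inj₁ (≅-trans {Std} {Fan m b} {G} std iso)
        go (inj₂ below) = inj₂ λ μ r eig → below μ r (IsEigenvalue-≅ {G} {Fan m b} {μ} (≅-sym {Fan m b} {G} iso) eig)
      cover = free⇒cover G t free
      noHub-gap : ¬ (∃ λ u → ∀ v → v ≡ u ⊎ T (A u v)) → Gap A ρ
      noHub-gap noHub = low⇒gap A λ q se → q≤N q se , inj₁ (NoHubCase.q²≤M-¼ se)
        where
        noHub-deg′ : ∀ u → Degrees.deg A u ≤ M - 1ℚ
        noHub-deg′ u = go (Fin.¬∀⟶∃¬ (suc m) _ (λ v → Fin._≟_ v u ⊎-dec T? (A u v)) (λ all → noHub (u , all)))
          where
          go : (∃ λ v → ¬ (v ≡ u ⊎ T (A u v))) → Degrees.deg A u ≤ M - 1ℚ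
          go (v , ¬adj) = noHub-deg A A-irrefl u v (¬adj ∘ inj₁) (¬adj ∘ inj₂)
        error≤ : (fromℕ (suc m) + M) * ε₀ ≤ 1/100
        error≤ = ≤-trans (*-monoʳ 0≤ε₀ (≤-trans (+-mono-≤ (≤-trans (≤-reflexive (trans (fromℕ-+ 1 m) (+-comm 1ℚ M))) N≤N³) M≤N³)
            (≤-reflexive (solve 1 (λ n → n :+ n := # 2 :* n) refl N³))))
          (≤-trans (≤-reflexive (*-assoc (fromℕ 2) N³ ε₀)) (*-monoˡ (0≤fromℕ 2) N³ε₀≤))
        module NoHubCase {q} (se : SubEigen A q ε₀) = NoHub A A-sym A-irrefl (proj₁ cover) (proj₁ (proj₂ cover))
          τ (fromℕ-mono-≤ {1} {t} 1≤t) (≤-trans (proj₂ (proj₂ cover)) (≤-reflexive (fromℕ-* 2 t)))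
          (Drawing.common≤2 G pos pos-inj planar) noHub-deg′ size se 0≤ε₀ error≤ ε₀≤1
        q≤N : ∀ q → SubEigen A q ε₀ → q ≤ N
        q≤N q se = square-cancel-≤ 0≤N (≤-trans (NoHubCase.q²≤M-¼ se) (≤-by
          (solve 1 (λ M → (M :+ con 1ℚ) :* (M :+ con 1ℚ) := M :- con ¼ :+ (M :* M :+ M :+ con (fromℕ 1 + ¼))) refl M)
          (0≤M ⊗ 0≤M ⊕ 0≤M ⊕ nonNegative⁻¹ (fromℕ 1 + ¼))))
      split : Dec (∃ λ u → ∀ v → v ≡ u ⊎ T (A u v)) → Std ≅ G ⊎ Below G
      split (yes (u , hub)) = via (hub⇒fan m G refl outer u (λ v v≢u → hub-adj v≢u (hub v)))
      split (no noHub)      = inj₂ (gap⇒< A A-sym ρ (noHub-gap noHub))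

    -- The extremal graph admits no gap against its own radius, so `ε₁` has to shrink with `ε`: one
    -- half of `ε` goes to the square root, one quarter to the iteration error and one quarter to
    -- `ε₁`.
    eigenvalue≤ρ : ∀ μ r → IsEigenvalue (adjacencyMatrix Std) μ → IsModulus r μ → r ≤ᵣ ρ
    eigenvalue≤ρ μ r eig mod ε 0<ε = ev-map₂ (λ k (q , se , r²≤) small → begin
        seq r k ≤⟨ root-bound (seq r k) q ε₁ (½ * ε) (SubEigen.0≤q se) (<⇒≤ 0<½ε) 2ε₁≤ r²≤ ⟩
        q + ½ * ε ≤⟨ +-monoˡ-≤ (½ * ε) (subEigen≤ (<⇒≤ 0<ε₁) se k) ⟩
        P k + C * (fromℕ 2 * E * decay k + ε₁) + ½ * ε ≤⟨ close k small ⟩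
        P k + ε ∎)
      (eigenvalue⇒subEigen (adj Std) (adj-sym Std) μ r eig mod ε₁ 0<ε₁ (p⊓q≤q (a ⊓ b) 1ℚ))
      (decay→0 (C * (fromℕ 2 * E)) (¼ * ε) (0≤C ⊗ (0≤fromℕ 2 ⊗ 0≤E)) 0<¼ε)
      where
      open ≤-Reasoning
      C : ℚ
      C = M * fromℕ (suc m)
      0≤C : 0ℚ ≤ C
      0≤C = 0≤M ⊗ 0≤fromℕ (suc m)
      0<½ε : 0ℚ < ½ * ε
      0<½ε = *-pos (positive⁻¹ ½) 0<ε
      0<¼ε : 0ℚ < ¼ * ε
      0<¼ε = *-pos (positive⁻¹ ¼) 0<ε
      small₁ : ∃ λ a → 0ℚ < a × fromℕ 2 * a ≤ ½ * ε * (½ * ε)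
      small₁ = small-multiple (fromℕ 2) (½ * ε * (½ * ε)) (0<1+ 1) (*-pos 0<½ε 0<½ε)
      small₂ : ∃ λ b → 0ℚ < b × (C + 1ℚ) * b ≤ ¼ * ε
      small₂ = small-multiple (C + 1ℚ) (¼ * ε) (+-mono-≤-< 0≤C (positive⁻¹ 1ℚ)) 0<¼ε
      a b ε₁ : ℚ
      a = proj₁ small₁
      b = proj₁ small₂
      ε₁ = (a ⊓ b) ⊓ 1ℚ
      0<ε₁ : 0ℚ < ε₁
      0<ε₁ = ⊓-pos (⊓-pos (proj₁ (proj₂ small₁)) (proj₁ (proj₂ small₂))) (positive⁻¹ 1ℚ)
      2ε₁≤ : fromℕ 2 * ε₁ ≤ ½ * ε * (½ * ε)
      2ε₁≤ = ≤-trans (*-monoˡ (0≤fromℕ 2) (≤-trans (p⊓q≤p (a ⊓ b) 1ℚ) (p⊓q≤p a b))) (proj₂ (proj₂ small₁))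
      Cε₁≤ : (C + 1ℚ) * ε₁ ≤ ¼ * ε
      Cε₁≤ = ≤-trans (*-monoˡ (0≤C ⊕ nonNegative⁻¹ 1ℚ) (≤-trans (p⊓q≤p (a ⊓ b) 1ℚ) (p⊓q≤q a b))) (proj₂ (proj₂ small₂))
      close : ∀ k → C * (fromℕ 2 * E) * decay k ≤ ¼ * ε → P k + C * (fromℕ 2 * E * decay k + ε₁) + ½ * ε ≤ P k + ε
      close k small = ≤-by (solve 6 (λ p c e d h ε → p :+ ε := p :+ c :* (# 2 :* e :* d :+ h) :+ con ½ :* ε
          :+ ((con ¼ :* ε :- c :* (# 2 :* e) :* d) :+ (con ¼ :* ε :- (c :+ con 1ℚ) :* h) :+ h)) refl (P k) C E (decay k) ε₁ ε)
        (≤⇒0≤- small ⊕ ≤⇒0≤- Cε₁≤ ⊕ <⇒≤ 0<ε₁)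

    Std-OuterplanarFree : OuterplanarFree (suc m) F Std
    Std-OuterplanarFree = refl , Fan-outerplanar m (window 0 s) , Fan-free t m 1≤t

    Std-spectralRadius : IsSpectralRadius Std ρ
    Std-spectralRadius = (ρ +i 0ᵣ , isEigenvalue , isModulus) , eigenvalue≤ρ

    uniqueExtremal : ∀ H → H ≅ Std → IsUniqueExtremalOP (suc m) F H
    uniqueExtremal H H≅Std = ρ , ((Std , Std-OuterplanarFree , Std-spectralRadius) , maximal) ,
        λ G → mk⇔ (unique G) (attained G)
      where
      maximal : ∀ G r → OuterplanarFree (suc m) F G → IsSpectralRadius G r → r ≤ᵣ ρ
      maximal G r ofree ((μ , eig , mod) , _) = go (dichotomy G ofree)
        where
        go : Std ≅ G ⊎ Below G → r ≤ᵣ ρ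
        go (inj₁ iso)   = eigenvalue≤ρ μ r (IsEigenvalue-≅ {G} {Std} {μ} (≅-sym {Std} {G} iso) eig) mod
        go (inj₂ below) = <ᵣ⇒≤ᵣ r ρ (below μ r eig mod)
      unique : ∀ G → OuterplanarFree (suc m) F G × IsSpectralRadius G ρ → G ≅ H
      unique G (ofree , ((μ , eig , mod) , _)) = go (dichotomy G ofree)
        where
        go : Std ≅ G ⊎ Below G → G ≅ H
        go (inj₁ iso)   = ≅-trans {G} {Std} {H} (≅-sym {Std} {G} iso) (≅-sym {H} {Std} H≅Std)
        go (inj₂ below) = ⊥-elim (<ᵣ-irrefl ρ (below μ ρ eig mod))
      attained : ∀ G → G ≅ H → OuterplanarFree (suc m) F G × IsSpectralRadius G ρ
      attained G G≅H = OuterplanarFree-≅ {suc m} {F} {Std} {G} iso Std-OuterplanarFree , IsSpectralRadius-≅ {Std} {G} {ρ} iso Std-spectralRadius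
        where
        iso : Std ≅ G
        iso = ≅-sym {G} {Std} (≅-trans {G} {H} {Std} G≅H H≅Std)

-- From the threshold to the size condition

open import Defs using (N; P; K)
open import Data.Nat using (ℕ; suc; _≤_; _+_; _*_; _∸_; _^_)
open import Data.Integer using (+_)
open import Data.Rational using (_/_)
open import Data.Product using (_×_)
open import Relation.Binary.PropositionalEquality using (_≡_)
import Data.Nat.Solver as ℕSolver
import Data.Rational.Base as ℚ
import Data.Rational.Properties as ℚ
open RationalSums
open ExtremalGraphs
open Comparison

threshold⇒N≤ : ∀ t n s → 0ᵣ ≤ᵣ s →
  fromℚ (N t) +ᵣ fromℚ (+ 3 / 2) +ᵣ fromℚ (+ 3 / 1) *ᵣ s ≤ᵣ fromℚ (fromℕ n) → N t ℚ.≤ fromℕ n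
threshold⇒N≤ t n s 0≤s h = go (0≤s ε₄ 0<ε₄) (h ε₄ 0<ε₄)
  where
  ε₄ = + 1 / 4
  0<ε₄ = ℚ.positive⁻¹ ε₄
  go : _ → _ → N t ℚ.≤ fromℕ n
  go (j , s≥) (k , ≤n) = ≤-by
    -- At tolerance ¼ the two approximations cost ¼ + 3 · ¼ = 1, which the summand 3/2 absorbs with
    -- ½ to spare.
    (solve 3 (λ N s n → n := N :+ ((n :+ con ε₄ :- (N :+ con (+ 3 / 2) :+ con (+ 3 / 1) :* s)) :+ con (+ 3 / 1) :* (s :+ con ε₄ :- con ℚ.0ℚ) :+ con (+ 1 / 2)))
      refl (N t) (seq s i) (fromℕ n))
    (≤⇒0≤- (≤n i (ℕ.m≤n⊔m j k)) ⊕ ℚ.nonNegative⁻¹ (+ 3 / 1) ⊗ ≤⇒0≤- (s≥ i (ℕ.m≤m⊔n j k)) ⊕ ℚ.nonNegative⁻¹ (+ 1 / 2))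
    where
    open import Data.Nat using (_⊔_)
    i = j ⊔ k

-- The only consequence of the threshold that is needed: n − 2 ≥ (28 (t + 1)²)².
quartic : ℕ → ℕ
quartic t = 2 + 28 * (suc t * suc t) * (28 * (suc t * suc t))

quartic-mono : ∀ {t u} → t ≤ u → quartic t ≤ quartic u
quartic-mono {t} {u} t≤u = ℕ.+-monoʳ-≤ 2 (ℕ.*-mono-≤ square square)
  where
  square : 28 * (suc t * suc t) ≤ 28 * (suc u * suc u)
  square = ℕ.*-monoʳ-≤ 28 (ℕ.*-mono-≤ (s≤s t≤u) (s≤s t≤u))

-- One step of d multiplies the right side by 4. On the left 28 (t + 1)² at most doubles once t ≥
-- 10, so the quartic at most quadruples. The coefficient 6 is 6.5025 rounded down to stay within
-- the naturals.
quartic≤exponential : ∀ d → quartic (10 + d) ≤ 6 * 2 ^ (2 * (10 + d) + 1)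
quartic≤exponential zero    = ℕ.≤ᵇ⇒≤ (quartic 10) (6 * 2 ^ 21) tt
quartic≤exponential (suc d) = ℕ.≤-trans (ℕ.≤-trans (ℕ.+-mono-≤ (ℕ.m≤m+n 2 6) (ℕ.*-mono-≤ double double))
    (ℕ.≤-reflexive (quadruple (28 * (suc (10 + d) * suc (10 + d))))))
  (ℕ.≤-trans (ℕ.*-monoʳ-≤ 4 (quartic≤exponential d)) (ℕ.≤-reflexive exponent))
  where
  open ℕSolver.+-*-Solver renaming (solve to solveℕ; _:+_ to _⊹_; _:*_ to _⊛_; _:=_ to _≐_; con to lit)
  double : 28 * (suc (10 + suc d) * suc (10 + suc d)) ≤ 2 * (28 * (suc (10 + d) * suc (10 + d)))
  double = ℕ.≤-trans (ℕ.m≤m+n _ (28 * (d * d + 20 * d + 98))) (ℕ.≤-reflexive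
    (solveℕ 1 (λ d → lit 28 ⊛ ((lit 12 ⊹ d) ⊛ (lit 12 ⊹ d)) ⊹ lit 28 ⊛ (d ⊛ d ⊹ lit 20 ⊛ d ⊹ lit 98)
      ≐ lit 2 ⊛ (lit 28 ⊛ ((lit 11 ⊹ d) ⊛ (lit 11 ⊹ d)))) refl d))
  quadruple : ∀ x → 8 + 2 * x * (2 * x) ≡ 4 * (2 + x * x)
  quadruple x = solveℕ 1 (λ x → lit 8 ⊹ lit 2 ⊛ x ⊛ (lit 2 ⊛ x) ≐ lit 4 ⊛ (lit 2 ⊹ x ⊛ x)) refl x
  exponent : 4 * (6 * 2 ^ (2 * (10 + d) + 1)) ≡ 6 * 2 ^ (2 * (10 + suc d) + 1)
  exponent = trans (solveℕ 1 (λ p → lit 4 ⊛ (lit 6 ⊛ p) ≐ lit 6 ⊛ (lit 2 ⊛ (lit 2 ⊛ p))) refl (2 ^ (2 * (10 + d) + 1)))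
    (cong (λ e → 6 * 2 ^ (e + 1)) (sym (trans (cong (2 *_) (ℕ.+-suc 10 d)) (ℕ.*-suc 2 (10 + d)))))

N≤⇒quartic≤ : ∀ t n → N t ℚ.≤ fromℕ n → quartic t ≤ n
N≤⇒quartic≤ t n N≤n = go (ℕ.≤-total t 10)
  where
  A B : ℚ.ℚ
  A = fromℕ (127 * 10 ^ 5)
  B = (+ 65025 / 10000) ℚ.* fromℕ (2 ^ (2 * t + 1))
  12700000≤n : 127 * 10 ^ 5 ≤ n
  12700000≤n = fromℕ-cancel-≤ {127 * 10 ^ 5} {n} (ℚ.≤-trans (ℚ.p≤p⊔q A B) N≤n)
  6·2^≤n : 6 * 2 ^ (2 * t + 1) ≤ n
  6·2^≤n = fromℕ-cancel-≤ {6 * 2 ^ (2 * t + 1)} {n} (ℚ.≤-trans (ℚ.≤-reflexive (fromℕ-* 6 (2 ^ (2 * t + 1))))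
    (ℚ.≤-trans (*-monoʳ {p = fromℕ 6} {+ 65025 / 10000} (0≤fromℕ (2 ^ (2 * t + 1))) (≤-by {d = + 5025 / 10000} refl (ℚ.nonNegative⁻¹ (+ 5025 / 10000))))
      (ℚ.≤-trans (ℚ.p≤q⊔p A B) N≤n)))
  -- The split at 10 is forced: `quartic 10` = 11478546 lies below both 12700000 and 6 · 2^21 =
  -- 12582912, whereas `quartic 9` exceeds 6 · 2^19 and `quartic 11` exceeds 12700000.
  go : t ≤ 10 ⊎ 10 ≤ t → quartic t ≤ n
  go (inj₁ t≤10) = ℕ.≤-trans (quartic-mono t≤10) (ℕ.≤-trans (ℕ.≤ᵇ⇒≤ (quartic 10) (127 * 10 ^ 5) tt) 12700000≤n)
  go (inj₂ 10≤t) = ℕ.≤-trans (subst (λ u → quartic u ≤ 6 * 2 ^ (2 * u + 1)) (ℕ.m+[n∸m]≡n 10≤t) (quartic≤exponential (t ∸ 10))) 6·2^≤n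

theorem3 : (t : ℕ) → 1 ≤ t →
    (n : ℕ) →
    (s : ℝ) → IsSqrt s (fromℚ (N t) -ᵣ fromℚ (+ 7 / 4)) →
    fromℚ (N t) +ᵣ fromℚ (+ 3 / 2) +ᵣ fromℚ (+ 3 / 1) *ᵣ s ≤ᵣ fromℚ (fromℕ n) →
    (t ≡ 1 → IsUniqueExtremalOP n ((t + 1) ×ᴳ K 2) K[ 1 , n ∸ 1 ]) ×
    (2 ≤ t → IsUniqueExtremalOP n ((t + 1) ×ᴳ K 2) (K 1 ∨ᴳ H-OP n (2 * t ∸ 1) 1))
theorem3 t 1≤t n s (0≤s , _) threshold = go n (N≤⇒quartic≤ t n (threshold⇒N≤ t n s 0≤s threshold))
  where
  go : ∀ n → quartic t ≤ n →
    (t ≡ 1 → IsUniqueExtremalOP n ((t + 1) ×ᴳ K 2) K[ 1 , n ∸ 1 ]) ×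
    (2 ≤ t → IsUniqueExtremalOP n ((t + 1) ×ᴳ K 2) (K 1 ∨ᴳ H-OP n (2 * t ∸ 1) 1))
  go (suc m) (s≤s big) =
    -- For t = 1 the path has 2 t - 2 = 0 edges, and the fan is a star.
    (λ { refl → Extremal.uniqueExtremal 1 m 1≤t big K[ 1 , m ] (star≅Fan m) }) ,
    (λ _ → Extremal.uniqueExtremal t m 1≤t big (K 1 ∨ᴳ H-OP (suc m) (2 * t ∸ 1) 1)
             (extremal≅Fan t m 1≤t (ℕ.<⇒≤ (Extremal.2t<m t m 1≤t big))))
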